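{- There is a positive constant $C$ such that for infinitely many positive integers $n$, $$ D(n) > 1 - \frac{C}{(\log\log n)^{1-\frac12 e\log 2}}. $$ (Here $1-\frac12 e\log 2\approx 0.057915$.)
   Context: A subset $S\subseteq \mathbb{Z}/n\mathbb{Z}$ is called product-free if there are no $a,b,c\in S$ (not necessarily distinct) with $ab\equiv c \pmod n$. For a positive integer $n$, $D(n)$ denotes the maximum of $|S|/n$ over all product-free subsets $S$ of $\mathbb{Z}/n\mathbb{Z}$. Here $e$ is Euler's number and $\log$ is the natural logarithm. -}

module Defs where

open import Data.Bool using (true; false)
open import Data.Fin using (Fin; toℕ)
open import Data.Fin.Properties using (all?)
open import Data.Fin.Subset using (Subset; _∈_) renaming (∣_∣ to card)
open import Data.Fin.Subset.Properties using (_∈?_)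
import Data.Integer as ℤ
import Data.Integer.Properties as ℤ
open import Data.List using (List; []; _∷_; _++_; map; filter)
open import Data.List.Extrema using (max)
open import Data.Nat as ℕ using (ℕ; zero; suc; z≤n; s≤s)
import Data.Nat.DivMod as ℕ
import Data.Nat.Properties as ℕ
open import Data.Product using (Σ; ∃-syntax; _×_; _,_; proj₁; proj₂)
open import Data.Rational
open import Data.Rational.Properties
import Data.Rational.Unnormalised as ℚᵘ
import Data.Rational.Unnormalised.Properties as ℚᵘ
open import Data.Rational.Solver using (module +-*-Solver)
open import Data.Sum using (_⊎_; inj₁; inj₂)
open import Data.Vec using ([]; _∷_)
open import Function using (_∘_)
open import Relation.Binary.Bundles using (DecTotalOrder)
open import Relation.Binary.PropositionalEquality
open import Relation.Nullary using (Dec; yes; no; ¬_; contradiction)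
open import Relation.Nullary.Decidable using (¬?; _→-dec_)

-- Residue classes modulo n are represented by Fin n.
ProductFree : ∀ n → .{{ℕ.NonZero n}} → Subset n → Set
ProductFree n S = ∀ a → a ∈ S → ∀ b → b ∈ S → ∀ c → c ∈ S →
  ¬ ((toℕ a ℕ.* toℕ b) ℕ.% n ≡ toℕ c ℕ.% n)

productFree? : ∀ n .{{_ : ℕ.NonZero n}} (S : Subset n) → Dec (ProductFree n S)
productFree? n S =
  all? λ a → (a ∈? S) →-dec all? λ b → (b ∈? S) →-dec all? λ c → (c ∈? S) →-dec
  ¬? ((toℕ a ℕ.* toℕ b) ℕ.% n ℕ.≟ toℕ c ℕ.% n)

subsets : ∀ n → List (Subset n)
subsets zero    = [] ∷ []
subsets (suc n) = map (true ∷_) (subsets n) ++ map (false ∷_) (subsets n)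

density : ∀ n → .{{ℕ.NonZero n}} → Subset n → ℚ
density n S = ℤ.+ card S / n

-- The default value 0 is the density of the empty set, which is product-free.
D : ∀ n → .{{ℕ.NonZero n}} → ℚ
D n {{n≢0}} = max (DecTotalOrder.totalOrder ≤-decTotalOrder) 0ℚ
  (map (density n) (filter (productFree? n) (subsets n)))

module Rationals where

  open import Data.Integer using (+_; -[1+_])
  open +-*-Solver

  diff≥0 : ∀ {p q} → p ≤ q → 0ℚ ≤ q - p
  diff≥0 {p} {q} h = subst (_≤ q - p) (+-inverseʳ p) (+-monoˡ-≤ (- p) h)

  ≤-by : ∀ {p q r} → q - p ≡ r → 0ℚ ≤ r → p ≤ q
  ≤-by {p} {q} refl h = subst₂ _≤_ (+-identityˡ p)
    (solve 2 (λ p q → (q :- p) :+ p := q) refl p q) (+-monoˡ-≤ p h)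

  <-by : ∀ {p q r} → q - p ≡ r → 0ℚ < r → p < q
  <-by {p} {q} refl h = subst₂ _<_ (+-identityˡ p)
    (solve 2 (λ p q → (q :- p) :+ p := q) refl p q) (+-monoˡ-< p h)

  diff>0 : ∀ {p q} → p < q → 0ℚ < q - p
  diff>0 {p} {q} h = subst (_< q - p) (+-inverseʳ p) (+-monoˡ-< (- p) h)

  *≥0 : ∀ {p q} → 0ℚ ≤ p → 0ℚ ≤ q → 0ℚ ≤ p * q
  *≥0 {p} {q} hp hq =
    nonNegative⁻¹ (p * q) {{nonNeg*nonNeg⇒nonNeg p {{nonNegative hp}} q {{nonNegative hq}}}}

  *>0 : ∀ {p q} → 0ℚ < p → 0ℚ < q → 0ℚ < p * q
  *>0 {p} {q} hp hq = positive⁻¹ (p * q) {{pos*pos⇒pos p {{positive hp}} q {{positive hq}}}}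

  +≥0 : ∀ {p q} → 0ℚ ≤ p → 0ℚ ≤ q → 0ℚ ≤ p + q
  +≥0 = +-mono-≤

  *-mono : ∀ {p q r s} → 0ℚ ≤ p → p ≤ q → 0ℚ ≤ r → r ≤ s → p * r ≤ q * s
  *-mono {p} {q} {r} {s} hp hq hr hs = ≤-trans
    (*-monoʳ-≤-nonNeg r {{nonNegative hr}} hq)
    (*-monoˡ-≤-nonNeg q {{nonNegative (≤-trans hp hq)}} hs)

  0≤1 : 0ℚ ≤ 1ℚ
  0≤1 = nonNegative⁻¹ 1ℚ

  0<1 : 0ℚ < 1ℚ
  0<1 = positive⁻¹ 1ℚ

  ≤∣∣ : ∀ p → p ≤ ∣ p ∣
  ≤∣∣ p with ≤-total 0ℚ p
  ... | inj₁ h = ≤-reflexive (sym (0≤p⇒∣p∣≡p h))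
  ... | inj₂ h = ≤-trans h (0≤∣p∣ p)

  -≤∣∣ : ∀ p → - p ≤ ∣ p ∣
  -≤∣∣ p = subst (- p ≤_) (∣-p∣≡∣p∣ p) (≤∣∣ (- p))

  ∣∣≤ : ∀ {p q} → p ≤ q → - p ≤ q → ∣ p ∣ ≤ q
  ∣∣≤ {p} h h′ with ∣p∣≡p∨∣p∣≡-p p
  ... | inj₁ e = subst (_≤ _) (sym e) h
  ... | inj₂ e = subst (_≤ _) (sym e) h′

  ∣-∣-sym : ∀ p q → ∣ p - q ∣ ≡ ∣ q - p ∣
  ∣-∣-sym p q = trans (sym (∣-p∣≡∣p∣ (p - q)))
    (cong ∣_∣ (solve 2 (λ p q → :- (p :- q) := q :- p) refl p q))

  ℕ→ℚ : ℕ → ℚ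
  ℕ→ℚ k = + k / 1

  -- 1 / (k + 1)
  recip : ℕ → ℚ
  recip k = + 1 / suc k

  private
    module ≃ᵘ where
      open import Relation.Binary.Reasoning.Setoid ℚᵘ.≃-setoid public

  ℕ→ℚ-suc : ∀ k → ℕ→ℚ (suc k) ≡ 1ℚ + ℕ→ℚ k
  ℕ→ℚ-suc k = toℚᵘ-injective (begin
    toℚᵘ (+ suc k / 1)                        ≈⟨ toℚᵘ-fromℚᵘ (ℚᵘ.mkℚᵘ (+ suc k) 0) ⟩
    ℚᵘ.mkℚᵘ (+ suc k) 0                       ≈⟨ ℚᵘ.*≡* (cong (ℤ._* (+ 1)) (cong (λ z → + 1 ℤ.+ z) (sym (ℤ.*-identityʳ (+ k))))) ⟩
    ℚᵘ.mkℚᵘ (+ 1) 0 ℚᵘ.+ ℚᵘ.mkℚᵘ (+ k) 0      ≈⟨ ℚᵘ.+-cong {ℚᵘ.mkℚᵘ (+ 1) 0} {ℚᵘ.mkℚᵘ (+ 1) 0} ℚᵘ.≃-refl (ℚᵘ.≃-sym (toℚᵘ-fromℚᵘ (ℚᵘ.mkℚᵘ (+ k) 0))) ⟩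
    ℚᵘ.mkℚᵘ (+ 1) 0 ℚᵘ.+ toℚᵘ (+ k / 1)       ≈⟨ ℚᵘ.≃-sym (toℚᵘ-homo-+ 1ℚ (+ k / 1)) ⟩
    toℚᵘ (1ℚ + ℕ→ℚ k) ∎)
    where open ≃ᵘ

  recip-inv : ∀ k → recip k * ℕ→ℚ (suc k) ≡ 1ℚ
  recip-inv k = toℚᵘ-injective (begin
    toℚᵘ (recip k * ℕ→ℚ (suc k))                   ≈⟨ toℚᵘ-homo-* (recip k) (ℕ→ℚ (suc k)) ⟩
    toℚᵘ (recip k) ℚᵘ.* toℚᵘ (ℕ→ℚ (suc k))
       ≈⟨ ℚᵘ.*-cong (toℚᵘ-fromℚᵘ (ℚᵘ.mkℚᵘ (+ 1) k)) (toℚᵘ-fromℚᵘ (ℚᵘ.mkℚᵘ (+ suc k) 0)) ⟩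
    ℚᵘ.mkℚᵘ (+ 1) k ℚᵘ.* ℚᵘ.mkℚᵘ (+ suc k) 0       ≈⟨ ℚᵘ.*≡* (trans (ℤ.*-identityʳ _) (trans (ℤ.*-identityˡ (+ suc k)) (sym (trans (ℤ.*-identityˡ _) (cong (λ j → + suc j) (ℕ.*-identityʳ k)))))) ⟩
    ℚᵘ.1ℚᵘ ∎)
    where open ≃ᵘ

  0≤ℕ→ℚ : ∀ k → 0ℚ ≤ ℕ→ℚ k
  0≤ℕ→ℚ k = nonNegative⁻¹ (ℕ→ℚ k) {{normalize-nonNeg k 1}}

  0<recip : ∀ k → 0ℚ < recip k
  0<recip k = positive⁻¹ (recip k) {{normalize-pos 1 (suc k)}}

  0<ℕ→ℚ-suc : ∀ k → 0ℚ < ℕ→ℚ (suc k)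
  0<ℕ→ℚ-suc k = positive⁻¹ (ℕ→ℚ (suc k)) {{normalize-pos (suc k) 1}}

  ℕ→ℚ-mono : ∀ {j k} → j ℕ.≤ k → ℕ→ℚ j ≤ ℕ→ℚ k
  ℕ→ℚ-mono {k = k} z≤n = 0≤ℕ→ℚ k
  ℕ→ℚ-mono {suc j} {suc k} (s≤s h) =
    subst₂ _≤_ (sym (ℕ→ℚ-suc j)) (sym (ℕ→ℚ-suc k)) (+-monoʳ-≤ 1ℚ (ℕ→ℚ-mono h))

  archimedean : ∀ q → ∃[ k ] q ≤ ℕ→ℚ k
  archimedean q@(mkℚ z d-1 _) = ℤ.∣ z ∣ , toℚᵘ-cancel-≤ (ℚᵘ.≤-respʳ-≃
    (ℚᵘ.≃-sym (toℚᵘ-fromℚᵘ (ℚᵘ.mkℚᵘ (+ ℤ.∣ z ∣) 0))) (ℚᵘ.*≤* (lem z)))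
    where
    lem : ∀ z → z ℤ.* + 1 ℤ.≤ + ℤ.∣ z ∣ ℤ.* + suc d-1
    lem (+ n) = ℤ.≤-trans (ℤ.≤-reflexive (ℤ.*-identityʳ (+ n)))
      (subst (+ n ℤ.≤_) (ℤ.pos-* n (suc d-1)) (ℤ.+≤+ (ℕ.m≤m*n n (suc d-1))))
    lem -[1+ n ] = ℤ.-≤+

  reciprocal : ∀ ε → 0ℚ < ε → Σ ℚ λ r → 0ℚ < r × ε * r ≡ 1ℚ
  reciprocal ε h = 1/ ε , positive⁻¹ (1/ ε) {{1/pos⇒pos ε}} , *-inverseʳ ε
    where
    instance
      pε : Positive ε
      pε = positive h
      nε : NonZero ε
      nε = pos⇒nonZero ε

  recip-antimono : ∀ {j k} → j ℕ.≤ k → recip k ≤ recip j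
  recip-antimono {j} {k} h = ≤-by
    (trans
      (cong₂ _-_ (trans (sym (*-identityʳ (recip j))) (cong (recip j *_) (sym (recip-inv k))))
                 (trans (sym (*-identityʳ (recip k))) (cong (recip k *_) (sym (recip-inv j)))))
      (solve 4 (λ a b x y → a :* (b :* y) :- b :* (a :* x) := (a :* b) :* (y :- x)) refl
        (recip j) (recip k) (ℕ→ℚ (suc j)) (ℕ→ℚ (suc k))))
    (*≥0 (*≥0 (<⇒≤ (0<recip j)) (<⇒≤ (0<recip k))) (diff≥0 (ℕ→ℚ-mono (s≤s h))))

  recip-small : ∀ ε → 0ℚ < ε → ∃[ k ] recip k < ε
  recip-small ε h with reciprocal ε h
  ... | r , 0<r , εr≡1 with archimedean r
  ... | k , r≤k = k , <-by
    (trans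
      (cong₂ _-_ (trans (sym (*-identityʳ ε)) (cong (ε *_) (sym (recip-inv k))))
                 (trans (sym (*-identityʳ (recip k))) (cong (recip k *_) (sym εr≡1))))
      (solve 4 (λ a b x y → a :* (b :* y) :- b :* (a :* x) := (a :* b) :* (y :- x)) refl
        ε (recip k) r (ℕ→ℚ (suc k))))
    (*>0 (*>0 h (0<recip k))
       (diff>0 (≤-<-trans r≤k (subst (ℕ→ℚ k <_) (sym (ℕ→ℚ-suc k))
          (<-by (solve 1 (λ x → (con 1ℚ :+ x) :- x := con 1ℚ) refl (ℕ→ℚ k)) 0<1)))))

module Sequences where

  open Rationals
  open +-*-Solver

  Eventually : (ℕ → Set) → Set
  Eventually P = ∃[ N ] ∀ n → N ℕ.≤ n → P n

  Eventually₂ : (ℕ → ℕ → Set) → Set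
  Eventually₂ P = ∃[ N ] ∀ m n → N ℕ.≤ m → N ℕ.≤ n → P m n

  Vanishing : (ℕ → ℕ → ℚ) → Set
  Vanishing d = ∀ ε → 0ℚ < ε → Eventually₂ λ m n → ∣ d m n ∣ < ε

  infix 4 _~_

  -- f ~ f says that f is a Cauchy sequence; on Cauchy sequences _~_ is equality of limits.
  record _~_ (f g : ℕ → ℚ) : Set where
    constructor mk~
    field
      difference : Vanishing λ m n → f m - g n

  open _~_ public

  ev₂-map₂ : ∀ {P Q R : ℕ → ℕ → Set} → (∀ m n → P m n → Q m n → R m n) →
             Eventually₂ P → Eventually₂ Q → Eventually₂ R
  ev₂-map₂ h (M , p) (N , q) = M ℕ.⊔ N , λ m n lm ln →
    h m n (p m n (ℕ.≤-trans (ℕ.m≤m⊔n M N) lm) (ℕ.≤-trans (ℕ.m≤m⊔n M N) ln))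
          (q m n (ℕ.≤-trans (ℕ.m≤n⊔m M N) lm) (ℕ.≤-trans (ℕ.m≤n⊔m M N) ln))

  both : ∀ {P Q : ℕ → Set} → Eventually P → Eventually Q → Eventually₂ λ m n → P m × Q n
  both (M , p) (N , q) = M ℕ.⊔ N , λ m n lm ln →
    p m (ℕ.≤-trans (ℕ.m≤m⊔n M N) lm) , q n (ℕ.≤-trans (ℕ.m≤n⊔m M N) ln)

  van-dom : ∀ {d e} → Eventually₂ (λ m n → ∣ d m n ∣ ≤ e m n) → Vanishing e → Vanishing d
  van-dom h v ε 0<ε = ev₂-map₂
    (λ m n d≤e e<ε → ≤-<-trans d≤e (≤-<-trans (≤∣∣ _) e<ε)) h (v ε 0<ε)

  van-≤ : ∀ {d e} → (∀ m n → ∣ d m n ∣ ≤ e m n) → Vanishing e → Vanishing d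
  van-≤ h = van-dom (0 , λ m n _ _ → h m n)

  van-abs : ∀ {d} → Vanishing d → Vanishing λ m n → ∣ d m n ∣
  van-abs {d} v ε 0<ε with v ε 0<ε
  ... | N , h = N , λ m n lm ln → subst (_< ε) (sym (∣∣p∣∣≡∣p∣ (d m n))) (h m n lm ln)

  van-cong : ∀ {d e} → (∀ m n → d m n ≡ e m n) → Vanishing e → Vanishing d
  van-cong h v = van-≤ (λ m n → ≤-reflexive (cong ∣_∣ (h m n))) (van-abs v)

  van-+ : ∀ {d e} → Vanishing d → Vanishing e → Vanishing λ m n → d m n + e m n
  van-+ {d} {e} v w ε 0<ε = ev₂-map₂
    (λ m n p q → ≤-<-trans (∣p+q∣≤∣p∣+∣q∣ (d m n) (e m n))
       (subst (∣ d m n ∣ + ∣ e m n ∣ <_)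
          (solve 1 (λ x → x :* con ½ :+ x :* con ½ := x) refl ε)
          (+-mono-< p q)))
    (v (ε * ½) 0<ε/2) (w (ε * ½) 0<ε/2)
    where
    0<ε/2 : 0ℚ < ε * ½
    0<ε/2 = *>0 0<ε (positive⁻¹ ½)

  van-neg : ∀ {d} → Vanishing d → Vanishing λ m n → - d m n
  van-neg {d} v = van-≤ (λ m n → ≤-reflexive (∣-p∣≡∣p∣ (d m n))) (van-abs v)

  van-swap : ∀ {d} → Vanishing d → Vanishing λ m n → d n m
  van-swap v ε 0<ε with v ε 0<ε
  ... | N , h = N , λ m n lm ln → h n m ln lm

  van-diag : ∀ {d} → Vanishing d → Vanishing λ m n → d m m
  van-diag v ε 0<ε with v ε 0<ε
  ... | N , h = N , λ m n lm ln → h m m lm lm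

  van-0 : Vanishing λ _ _ → 0ℚ
  van-0 ε 0<ε = 0 , λ _ _ _ _ → 0<ε

  van-scale : ∀ {d} B → 0ℚ < B → Vanishing d → Vanishing λ m n → B * d m n
  van-scale {d} B 0<B v ε 0<ε with reciprocal B 0<B
  ... | r , 0<r , Br≡1 with v (ε * r) (*>0 0<ε 0<r)
  ... | N , h = N , λ m n lm ln → subst₂ _<_
    (sym (trans (∣p*q∣≡∣p∣*∣q∣ B (d m n)) (cong (_* ∣ d m n ∣) (0≤p⇒∣p∣≡p (<⇒≤ 0<B)))))
    (trans (solve 3 (λ b e r → b :* (e :* r) := e :* (b :* r)) refl B ε r)
      (trans (cong (ε *_) Br≡1) (*-identityʳ ε)))
    (*-monoʳ-<-pos B {{positive 0<B}} (h m n lm ln))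

  ~-const : ∀ q → (λ _ → q) ~ (λ _ → q)
  ~-const q = mk~ (van-cong (λ _ _ → +-inverseʳ q) van-0)

  ~-sym : ∀ {f g} → f ~ g → g ~ f
  ~-sym {f} {g} (mk~ v) = mk~ (van-cong
    (λ m n → solve 2 (λ x y → y :- x := :- (x :- y)) refl (f n) (g m)) (van-neg (van-swap v)))

  ~-trans : ∀ {f g h} → f ~ g → g ~ h → f ~ h
  ~-trans {f} {g} {h} (mk~ v) (mk~ w) = mk~ (van-cong
    (λ m n → solve 3 (λ x y z → x :- z := (x :- y) :+ (y :- z)) refl (f m) (g m) (h n))
    (van-+ (van-diag v) w))

  -- A Cauchy sequence is equivalent to any sequence at vanishing distance from it.
  ~-null : ∀ {f g} → Vanishing (λ m _ → f m - g m) → g ~ g → f ~ g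
  ~-null {f} {g} v (mk~ w) = mk~ (van-cong
    (λ m n → solve 3 (λ x y z → x :- z := (x :- y) :+ (y :- z)) refl (f m) (g m) (g n))
    (van-+ v w))

  ~-+ : ∀ {f f′ g g′} → f ~ f′ → g ~ g′ → (λ n → f n + g n) ~ (λ n → f′ n + g′ n)
  ~-+ {f} {f′} {g} {g′} (mk~ v) (mk~ w) = mk~ (van-cong
    (λ m n → solve 4 (λ a b c d → (a :+ c) :- (b :+ d) := (a :- b) :+ (c :- d)) refl
       (f m) (f′ n) (g m) (g′ n))
    (van-+ v w))

  ~-neg : ∀ {f f′} → f ~ f′ → (λ n → - f n) ~ (λ n → - f′ n)
  ~-neg {f} {f′} (mk~ v) = mk~ (van-cong
    (λ m n → solve 2 (λ a b → :- a :- :- b := :- (a :- b)) refl (f m) (f′ n)) (van-neg v))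

  Bounded : (ℕ → ℚ) → Set
  Bounded f = Σ ℚ λ B → 0ℚ < B × Eventually λ n → ∣ f n ∣ ≤ B

  ~-bounded : ∀ {f g} → f ~ g → Bounded f
  ~-bounded {f} {g} v = let N , h = difference v 1ℚ 0<1 in ∣ g N ∣ + 1ℚ , +-mono-≤-< (0≤∣p∣ (g N)) 0<1 , N , λ n le →
    ≤-trans
      (subst (λ z → ∣ z ∣ ≤ ∣ g N ∣ + ∣ f n - g N ∣)
         (solve 2 (λ x y → y :+ (x :- y) := x) refl (f n) (g N))
         (∣p+q∣≤∣p∣+∣q∣ (g N) (f n - g N)))
      (+-monoʳ-≤ ∣ g N ∣ (<⇒≤ (h n N le ℕ.≤-refl)))

  *-bound : ∀ {B C} a a′ b b′ → ∣ a ∣ ≤ B → ∣ b′ ∣ ≤ C →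
            ∣ a * b - a′ * b′ ∣ ≤ B * ∣ b - b′ ∣ + C * ∣ a - a′ ∣
  *-bound {B} {C} a a′ b b′ p q = begin
    ∣ a * b - a′ * b′ ∣
      ≡⟨ cong ∣_∣ (solve 4 (λ a a′ b b′ → a :* b :- a′ :* b′ := a :* (b :- b′) :+ b′ :* (a :- a′))
           refl a a′ b b′) ⟩
    ∣ a * (b - b′) + b′ * (a - a′) ∣
      ≤⟨ ∣p+q∣≤∣p∣+∣q∣ (a * (b - b′)) (b′ * (a - a′)) ⟩
    ∣ a * (b - b′) ∣ + ∣ b′ * (a - a′) ∣
      ≡⟨ cong₂ _+_ (∣p*q∣≡∣p∣*∣q∣ a (b - b′)) (∣p*q∣≡∣p∣*∣q∣ b′ (a - a′)) ⟩
    ∣ a ∣ * ∣ b - b′ ∣ + ∣ b′ ∣ * ∣ a - a′ ∣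
      ≤⟨ +-mono-≤ (*-mono (0≤∣p∣ a) p (0≤∣p∣ (b - b′)) ≤-refl)
                  (*-mono (0≤∣p∣ b′) q (0≤∣p∣ (a - a′)) ≤-refl) ⟩
    B * ∣ b - b′ ∣ + C * ∣ a - a′ ∣ ∎
    where open ≤-Reasoning

  ~-* : ∀ {f f′ g g′} → f ~ f′ → g ~ g′ → (λ n → f n * g n) ~ (λ n → f′ n * g′ n)
  ~-* {f} {f′} {g} {g′} v w =
    let B , 0<B , evB = ~-bounded v
        C , 0<C , evC = ~-bounded (~-sym w)
        N , ev = both evB evC
    in mk~ (van-dom
         (N , λ m n lm ln →
           *-bound (f m) (f′ n) (g m) (g′ n) (proj₁ (ev m n lm ln)) (proj₂ (ev m n lm ln)))
         (van-+ (van-scale B 0<B (van-abs (difference w))) (van-scale C 0<C (van-abs (difference v)))))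

  -- Only applied to sequences eventually ≥ δ > 0, so the value at q ≤ 0 affects no limit.
  inv : ℚ → ℚ
  inv q with 0ℚ <? q
  ... | yes h = proj₁ (reciprocal q h)
  ... | no  _ = 0ℚ

  inv-spec : ∀ q → 0ℚ < q → 0ℚ < inv q × q * inv q ≡ 1ℚ
  inv-spec q h with 0ℚ <? q
  ... | yes h′ = proj₂ (reciprocal q h′)
  ... | no  ¬h = contradiction h ¬h

  inv-diff : ∀ a b → 0ℚ < a → 0ℚ < b → inv a - inv b ≡ (inv a * inv b) * (b - a)
  inv-diff a b 0<a 0<b = begin
    inv a - inv b                                 ≡⟨ cong₂ _-_ (sym (*-identityʳ (inv a))) (sym (*-identityʳ (inv b))) ⟩
    inv a * 1ℚ - inv b * 1ℚ                       ≡⟨ cong₂ (λ s t → inv a * s - inv b * t)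
                                                       (sym (proj₂ (inv-spec b 0<b))) (sym (proj₂ (inv-spec a 0<a))) ⟩
    inv a * (b * inv b) - inv b * (a * inv a)     ≡⟨ solve 4 (λ a b x y → x :* (b :* y) :- y :* (a :* x) := (x :* y) :* (b :- a))
                                                       refl a b (inv a) (inv b) ⟩
    (inv a * inv b) * (b - a) ∎
    where open ≡-Reasoning

  inv-antimono : ∀ {a b} → 0ℚ < a → a ≤ b → inv b ≤ inv a
  inv-antimono {a} {b} 0<a a≤b = ≤-by (inv-diff a b 0<a 0<b)
    (*≥0 (*≥0 (<⇒≤ (proj₁ (inv-spec a 0<a))) (<⇒≤ (proj₁ (inv-spec b 0<b)))) (diff≥0 a≤b))
    where 0<b = <-≤-trans 0<a a≤b

  inv-bound : ∀ {δ η} a b → 0ℚ < δ → 0ℚ < η → δ ≤ a → η ≤ b →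
              ∣ inv a - inv b ∣ ≤ (inv δ * inv η) * ∣ a - b ∣
  inv-bound {δ} {η} a b 0<δ 0<η p q = begin
    ∣ inv a - inv b ∣                ≡⟨ cong ∣_∣ (inv-diff a b 0<a 0<b) ⟩
    ∣ (inv a * inv b) * (b - a) ∣    ≡⟨ ∣p*q∣≡∣p∣*∣q∣ (inv a * inv b) (b - a) ⟩
    ∣ inv a * inv b ∣ * ∣ b - a ∣    ≡⟨ cong₂ _*_ (0≤p⇒∣p∣≡p (*≥0 ia ib)) (∣-∣-sym b a) ⟩
    (inv a * inv b) * ∣ a - b ∣      ≤⟨ *-mono (*≥0 ia ib) (*-mono ia (inv-antimono 0<δ p) ib (inv-antimono 0<η q))
                                          (0≤∣p∣ (a - b)) ≤-refl ⟩
    (inv δ * inv η) * ∣ a - b ∣ ∎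
    where
    open ≤-Reasoning
    0<a = <-≤-trans 0<δ p
    0<b = <-≤-trans 0<η q
    ia = <⇒≤ (proj₁ (inv-spec a 0<a))
    ib = <⇒≤ (proj₁ (inv-spec b 0<b))

  EventuallyPositive : (ℕ → ℚ) → Set
  EventuallyPositive f = Σ ℚ λ δ → 0ℚ < δ × Eventually λ n → δ ≤ f n

  ~-inv : ∀ {f g} → EventuallyPositive f → EventuallyPositive g → f ~ g → (λ n → inv (f n)) ~ (λ n → inv (g n))
  ~-inv {f} {g} (δ , 0<δ , evf) (η , 0<η , evg) v =
    let N , ev = both evf evg
    in mk~ (van-dom
         (N , λ m n lm ln →
           inv-bound (f m) (g n) 0<δ 0<η (proj₁ (ev m n lm ln)) (proj₂ (ev m n lm ln)))
         (van-scale (inv δ * inv η)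
           (*>0 (proj₁ (inv-spec δ 0<δ)) (proj₁ (inv-spec η 0<η))) (van-abs (difference v))))

module ExpSeries where

  open Rationals
  open Sequences
  open +-*-Solver

  -- sum f n = f 0 + … + f n
  sum : (ℕ → ℚ) → ℕ → ℚ
  sum f zero    = f zero
  sum f (suc n) = sum f n + f (suc n)

  -- term q k = qᵏ / k!
  term : ℚ → ℕ → ℚ
  term q zero    = 1ℚ
  term q (suc k) = term q k * (q * recip k)

  expSum : ℚ → ℕ → ℚ
  expSum q = sum (term q)

  term≥0 : ∀ {q} → 0ℚ ≤ q → ∀ k → 0ℚ ≤ term q k
  term≥0 0≤q zero    = 0≤1
  term≥0 0≤q (suc k) = *≥0 (term≥0 0≤q k) (*≥0 0≤q (<⇒≤ (0<recip k)))

  term-mono : ∀ {a b} → 0ℚ ≤ a → a ≤ b → ∀ k → term a k ≤ term b k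
  term-mono 0≤a a≤b zero    = ≤-refl
  term-mono 0≤a a≤b (suc k) = *-mono (term≥0 0≤a k) (term-mono 0≤a a≤b k)
    (*≥0 0≤a 0≤r) (*-mono 0≤a a≤b 0≤r ≤-refl)
    where 0≤r = <⇒≤ (0<recip k)

  ∣term∣ : ∀ q k → ∣ term q k ∣ ≡ term ∣ q ∣ k
  ∣term∣ q zero    = refl
  ∣term∣ q (suc k) = trans (∣p*q∣≡∣p∣*∣q∣ (term q k) (q * recip k)) (cong₂ _*_ (∣term∣ q k)
    (trans (∣p*q∣≡∣p∣*∣q∣ q (recip k)) (cong (∣ q ∣ *_) (0≤p⇒∣p∣≡p (<⇒≤ (0<recip k))))))

  ∣term∣≤ : ∀ {q B} → ∣ q ∣ ≤ B → ∀ k → ∣ term q k ∣ ≤ term B k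
  ∣term∣≤ {q} h k = subst (_≤ _) (sym (∣term∣ q k)) (term-mono (0≤∣p∣ q) h k)

  sum≥0 : ∀ {f} → (∀ k → 0ℚ ≤ f k) → ∀ n → 0ℚ ≤ sum f n
  sum≥0 h zero    = h 0
  sum≥0 h (suc n) = +≥0 (sum≥0 h n) (h (suc n))

  expSum≥1 : ∀ {q} → 0ℚ ≤ q → ∀ n → 1ℚ ≤ expSum q n
  expSum≥1 0≤q zero    = ≤-refl
  expSum≥1 {q} 0≤q (suc n) = ≤-trans (expSum≥1 0≤q n)
    (≤-by (solve 2 (λ x y → (x :+ y) :- x := y) refl (expSum q n) (term q (suc n))) (term≥0 0≤q (suc n)))

  expSum-mono : ∀ {q} → 0ℚ ≤ q → ∀ {m n} → m ℕ.≤′ n → expSum q m ≤ expSum q n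
  expSum-mono 0≤q ℕ.≤′-refl = ≤-refl
  expSum-mono {q} 0≤q {m} {suc n} (ℕ.≤′-step h) = ≤-trans (expSum-mono 0≤q h)
    (≤-by (solve 2 (λ x y → (x :+ y) :- x := y) refl (expSum q n) (term q (suc n))) (term≥0 0≤q (suc n)))

  -- The tails of the series for q are dominated by those of the series for B.
  tail-≤′ : ∀ {q B} → ∣ q ∣ ≤ B → ∀ {m n} → m ℕ.≤′ n →
            ∣ expSum q n - expSum q m ∣ ≤ expSum B n - expSum B m
  tail-≤′ {q} {B} h {m} ℕ.≤′-refl = subst₂ _≤_
    (sym (cong ∣_∣ (+-inverseʳ (expSum q m)))) (sym (+-inverseʳ (expSum B m))) ≤-refl
  tail-≤′ {q} {B} h {m} {suc n} (ℕ.≤′-step l) = subst₂ _≤_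
    (cong ∣_∣ (e (expSum q n) (term q (suc n)) (expSum q m)))
    (e (expSum B n) (term B (suc n)) (expSum B m))
    (≤-trans (∣p+q∣≤∣p∣+∣q∣ (expSum q n - expSum q m) (term q (suc n)))
      (+-mono-≤ (tail-≤′ h l) (∣term∣≤ h (suc n))))
    where
    e : ∀ x t y → (x - y) + t ≡ (x + t) - y
    e = solve 3 (λ x t y → (x :- y) :+ t := (x :+ t) :- y) refl

  tail-≤ : ∀ {q B} → ∣ q ∣ ≤ B → ∀ m n →
           ∣ expSum q m - expSum q n ∣ ≤ ∣ expSum B m - expSum B n ∣
  tail-≤ {q} {B} h m n = case (ℕ.≤-total m n)
    where
    case : m ℕ.≤ n ⊎ n ℕ.≤ m → ∣ expSum q m - expSum q n ∣ ≤ ∣ expSum B m - expSum B n ∣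
    case (inj₁ l) = subst₂ _≤_ (∣-∣-sym (expSum q n) (expSum q m)) (∣-∣-sym (expSum B n) (expSum B m))
      (≤-trans (tail-≤′ h (ℕ.≤⇒≤′ l)) (≤∣∣ (expSum B n - expSum B m)))
    case (inj₂ l) = ≤-trans (tail-≤′ h (ℕ.≤⇒≤′ l)) (≤∣∣ (expSum B m - expSum B n))

  recip-vanishing : Vanishing λ m _ → recip m
  recip-vanishing ε 0<ε = let k , h = recip-small ε 0<ε in k , λ m n lm ln →
    subst (_< ε) (sym (0≤p⇒∣p∣≡p (<⇒≤ (0<recip m)))) (≤-<-trans (recip-antimono lm) h)

  van-suc : ∀ {f : ℕ → ℚ} → Vanishing (λ m _ → f (suc m)) → Vanishing λ m _ → f m
  van-suc v ε 0<ε = let N , h = v ε 0<ε in suc N , λ { (suc m) n (s≤s lm) ln → h m (suc m) lm (ℕ.≤-trans lm (ℕ.n≤1+n m)) }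

  module _ (B : ℚ) (0≤B : 0ℚ ≤ B) where

    private
      k₀ : ℕ
      k₀ = proj₁ (archimedean (B + B))

      upper : ℕ → ℚ
      upper n = expSum B n + term B n

      half : ∀ {n} → k₀ ℕ.≤ n → term B (suc n) + term B (suc n) ≤ term B n
      half {n} l = ≤-by {r = term B n * (recip n * (ℕ→ℚ (suc n) - (B + B)))}
        (trans
          (cong (_- (t * (B * recip n) + t * (B * recip n))) (trans (sym (*-identityʳ t)) (cong (t *_) (sym (recip-inv n)))))
          (solve 4 (λ t b r s → t :* (r :* s) :- (t :* (b :* r) :+ t :* (b :* r)) := t :* (r :* (s :- (b :+ b))))
            refl t B (recip n) (ℕ→ℚ (suc n))))
        (*≥0 (term≥0 0≤B n) (*≥0 (<⇒≤ (0<recip n))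
          (diff≥0 (≤-trans (proj₂ (archimedean (B + B))) (ℕ→ℚ-mono (ℕ.m≤n⇒m≤1+n l))))))
        where t = term B n

      upper-step : ∀ {n} → k₀ ℕ.≤ n → upper (suc n) ≤ upper n
      upper-step {n} l = subst (_≤ upper n)
        (sym (+-assoc (expSum B n) (term B (suc n)) (term B (suc n))))
        (+-monoʳ-≤ (expSum B n) (half l))

      upper-anti : ∀ {m n} → k₀ ℕ.≤ m → m ℕ.≤′ n → upper n ≤ upper m
      upper-anti l ℕ.≤′-refl = ≤-refl
      upper-anti l (ℕ.≤′-step h) =
        ≤-trans (upper-step (ℕ.≤-trans l (ℕ.≤′⇒≤ h))) (upper-anti l h)

      expSum≤upper : ∀ n → expSum B n ≤ upper n
      expSum≤upper n = ≤-by (solve 2 (λ x y → (x :+ y) :- x := y) refl (expSum B n) (term B n)) (term≥0 0≤B n)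

      0≤expSum : ∀ n → 0ℚ ≤ expSum B n
      0≤expSum = sum≥0 (term≥0 0≤B)

      term≤ : ∀ {n} → k₀ ℕ.≤ n → term B n ≤ upper k₀
      term≤ {n} l = ≤-trans
        (≤-by (solve 2 (λ x y → (x :+ y) :- y := x) refl (expSum B n) (term B n)) (0≤expSum n))
        (upper-anti ℕ.≤-refl (ℕ.≤⇒≤′ l))

      C : ℚ
      C = 1ℚ + upper k₀ * B

      0<C : 0ℚ < C
      0<C = +-mono-<-≤ 0<1 (*≥0 (+≥0 (0≤expSum k₀) (term≥0 0≤B k₀)) 0≤B)

      term-suc-≤ : ∀ n → k₀ ℕ.≤ n → ∣ term B (suc n) ∣ ≤ C * recip n
      term-suc-≤ n l = subst (_≤ C * recip n) (sym (0≤p⇒∣p∣≡p (term≥0 0≤B (suc n))))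
        (subst (_≤ C * recip n) (*-assoc (term B n) B (recip n))
          (*-mono {q = C} (*≥0 (term≥0 0≤B n) 0≤B)
            (≤-trans (*-mono (term≥0 0≤B n) (term≤ l) 0≤B ≤-refl)
              (≤-by (solve 1 (λ x → (con 1ℚ :+ x) :- x := con 1ℚ) refl (upper k₀ * B)) 0≤1))
            (<⇒≤ (0<recip n)) ≤-refl))

    term-vanishing : Vanishing λ m _ → term B m
    term-vanishing = van-suc (van-dom (k₀ , λ m n lm ln → term-suc-≤ m lm)
      (van-scale C 0<C recip-vanishing))

    private
      gap : ∀ {m n} → k₀ ℕ.≤ m → m ℕ.≤′ n → expSum B n - expSum B m ≤ term B m
      gap {m} {n} l h = ≤-by
        (solve 3 (λ x y t → t :- (y :- x) := (x :+ t) :- y) refl (expSum B m) (expSum B n) (term B m))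
        (diff≥0 (≤-trans (expSum≤upper n) (upper-anti l h)))

      ∣gap∣ : ∀ {m n} → k₀ ℕ.≤ m → m ℕ.≤ n → ∣ expSum B n - expSum B m ∣ ≤ term B m
      ∣gap∣ l h = subst (_≤ _) (sym (0≤p⇒∣p∣≡p (diff≥0 (expSum-mono 0≤B (ℕ.≤⇒≤′ h))))) (gap l (ℕ.≤⇒≤′ h))

      bound : ∀ m n → k₀ ℕ.≤ m → k₀ ℕ.≤ n → ∣ expSum B m - expSum B n ∣ ≤ term B m + term B n
      bound m n lm ln = case (ℕ.≤-total m n)
        where
        case : m ℕ.≤ n ⊎ n ℕ.≤ m → ∣ expSum B m - expSum B n ∣ ≤ term B m + term B n
        case (inj₁ h) = ≤-trans (subst (_≤ term B m) (∣-∣-sym (expSum B n) (expSum B m)) (∣gap∣ lm h))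
          (≤-by (solve 2 (λ x y → (x :+ y) :- x := y) refl (term B m) (term B n)) (term≥0 0≤B n))
        case (inj₂ h) = ≤-trans (∣gap∣ ln h)
          (≤-by (solve 2 (λ x y → (x :+ y) :- y := x) refl (term B m) (term B n)) (term≥0 0≤B m))

    expSum-cauchy : expSum B ~ expSum B
    expSum-cauchy = mk~ (van-dom (k₀ , bound) (van-+ term-vanishing (van-swap term-vanishing)))

  -- k-th term of the derivative of the series
  dterm : ℚ → ℕ → ℚ
  dterm B zero    = 0ℚ
  dterm B (suc k) = term B k

  dterm-rec : ∀ B k → dterm B k * B ≡ ℕ→ℚ k * term B k
  dterm-rec B zero    = trans (*-zeroˡ B) (sym (*-zeroˡ 1ℚ))
  dterm-rec B (suc k) = begin
    t * B                                ≡⟨ cong (t *_) (sym (*-identityʳ B)) ⟩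
    t * (B * 1ℚ)                         ≡⟨ cong (λ z → t * (B * z)) (sym (recip-inv k)) ⟩
    t * (B * (recip k * ℕ→ℚ (suc k)))    ≡⟨ solve 4 (λ t b r s → t :* (b :* (r :* s)) := s :* (t :* (b :* r)))
                                              refl t B (recip k) (ℕ→ℚ (suc k)) ⟩
    ℕ→ℚ (suc k) * (t * (B * recip k)) ∎
    where
    open ≡-Reasoning
    t = term B k

  term-lipschitz : ∀ {a b B} → ∣ a ∣ ≤ B → ∣ b ∣ ≤ B → ∀ k →
                   ∣ term a k - term b k ∣ ≤ ∣ a - b ∣ * dterm B k
  term-lipschitz {a} {b} ha hb zero = ≤-reflexive (sym (*-zeroʳ ∣ a - b ∣))
  term-lipschitz {a} {b} {B} ha hb (suc k) = begin
    ∣ x * (a * r) - y * (b * r) ∣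
      ≡⟨ cong ∣_∣ (solve 5 (λ x y a b r → x :* (a :* r) :- y :* (b :* r) := (y :* (a :- b) :+ (x :- y) :* a) :* r)
           refl x y a b r) ⟩
    ∣ (y * (a - b) + (x - y) * a) * r ∣
      ≡⟨ trans (∣p*q∣≡∣p∣*∣q∣ (y * (a - b) + (x - y) * a) r) (cong (∣ y * (a - b) + (x - y) * a ∣ *_) (0≤p⇒∣p∣≡p 0≤r)) ⟩
    ∣ y * (a - b) + (x - y) * a ∣ * r
      ≤⟨ *-mono (0≤∣p∣ (y * (a - b) + (x - y) * a)) (∣p+q∣≤∣p∣+∣q∣ (y * (a - b)) ((x - y) * a)) 0≤r ≤-refl ⟩
    (∣ y * (a - b) ∣ + ∣ (x - y) * a ∣) * r
      ≡⟨ cong (_* r) (cong₂ _+_ (∣p*q∣≡∣p∣*∣q∣ y (a - b)) (∣p*q∣≡∣p∣*∣q∣ (x - y) a)) ⟩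
    (∣ y ∣ * d + ∣ x - y ∣ * ∣ a ∣) * r
      ≤⟨ *-mono (+≥0 (*≥0 (0≤∣p∣ y) (0≤∣p∣ (a - b))) (*≥0 (0≤∣p∣ (x - y)) (0≤∣p∣ a)))
           (+-mono-≤ (*-mono (0≤∣p∣ y) (∣term∣≤ hb k) (0≤∣p∣ (a - b)) ≤-refl)
                     (*-mono (0≤∣p∣ (x - y)) (term-lipschitz ha hb k) (0≤∣p∣ a) ha))
           0≤r ≤-refl ⟩
    (term B k * d + (d * dterm B k) * B) * r
      ≡⟨ cong (λ z → (term B k * d + z) * r) (trans (*-assoc d (dterm B k) B) (cong (d *_) (dterm-rec B k))) ⟩
    (term B k * d + d * (ℕ→ℚ k * term B k)) * r
      ≡⟨ solve 4 (λ t d n r → (t :* d :+ d :* (n :* t)) :* r := (d :* t) :* (r :* (con 1ℚ :+ n)))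
           refl (term B k) d (ℕ→ℚ k) r ⟩
    (d * term B k) * (r * (1ℚ + ℕ→ℚ k))
      ≡⟨ cong ((d * term B k) *_) (trans (cong (r *_) (sym (ℕ→ℚ-suc k))) (recip-inv k)) ⟩
    (d * term B k) * 1ℚ
      ≡⟨ *-identityʳ (d * term B k) ⟩
    d * term B k ∎
    where
    open ≤-Reasoning
    r = recip k
    0≤r = <⇒≤ (0<recip k)
    x = term a k
    y = term b k
    d = ∣ a - b ∣

  sum-dterm : ∀ B n → sum (dterm B) (suc n) ≡ expSum B n
  sum-dterm B zero    = +-identityˡ 1ℚ
  sum-dterm B (suc n) = cong (_+ term B (suc n)) (sum-dterm B n)

  sum-lipschitz : ∀ {a b B} → ∣ a ∣ ≤ B → ∣ b ∣ ≤ B → ∀ n →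
                  ∣ expSum a n - expSum b n ∣ ≤ ∣ a - b ∣ * sum (dterm B) n
  sum-lipschitz ha hb zero = term-lipschitz ha hb zero
  sum-lipschitz {a} {b} {B} ha hb (suc n) = subst₂ _≤_
    (cong ∣_∣ (solve 4 (λ x y s t → (x :- y) :+ (s :- t) := (x :+ s) :- (y :+ t)) refl
       (expSum a n) (expSum b n) (term a (suc n)) (term b (suc n))))
    (sym (*-distribˡ-+ ∣ a - b ∣ (sum (dterm B) n) (term B n)))
    (≤-trans (∣p+q∣≤∣p∣+∣q∣ (expSum a n - expSum b n) (term a (suc n) - term b (suc n)))
      (+-mono-≤ (sum-lipschitz ha hb n) (term-lipschitz ha hb (suc n))))

  expSum-lipschitz : ∀ {a b B} → 0ℚ ≤ B → ∣ a ∣ ≤ B → ∣ b ∣ ≤ B → ∀ n →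
                     ∣ expSum a n - expSum b n ∣ ≤ ∣ a - b ∣ * expSum B n
  expSum-lipschitz {a} {b} {B} 0≤B ha hb n = ≤-trans (sum-lipschitz ha hb n)
    (*-monoˡ-≤-nonNeg ∣ a - b ∣ {{nonNegative (0≤∣p∣ (a - b))}} (h n))
    where
    h : ∀ n → sum (dterm B) n ≤ expSum B n
    h zero    = 0≤1
    h (suc n) = subst (_≤ expSum B (suc n)) (sym (sum-dterm B n)) (expSum-mono 0≤B {n} (ℕ.≤′-step ℕ.≤′-refl))

  ~-exp : ∀ {f g} → f ~ g → (λ n → expSum (f n) n) ~ (λ n → expSum (g n) n)
  ~-exp {f} {g} v =
    let B₁ , 0<B₁ , ev₁ = ~-bounded v
        B₂ , 0<B₂ , ev₂ = ~-bounded (~-sym v)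
        B = B₁ + B₂
        0<B = +-mono-< 0<B₁ 0<B₂
        0≤B = <⇒≤ 0<B
        K , 0<K , evK = ~-bounded (expSum-cauchy B 0≤B)
        N , ev = both ev₁ ev₂
        N′ , evK = evK
    in mk~ (van-dom {e = λ m n → K * ∣ f m - g n ∣ + ∣ expSum B m - expSum B n ∣}
         (N ℕ.⊔ N′ , λ m n lm ln →
           let lm₁ = ℕ.≤-trans (ℕ.m≤m⊔n N N′) lm
               ln₁ = ℕ.≤-trans (ℕ.m≤m⊔n N N′) ln
               lm₂ = ℕ.≤-trans (ℕ.m≤n⊔m N N′) lm
           in bound m n 0≤B
                (≤-trans (proj₁ (ev m n lm₁ ln₁)) (≤-by (solve 2 (λ x y → (x :+ y) :- x := y) refl B₁ B₂) (<⇒≤ 0<B₂)))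
                (≤-trans (proj₂ (ev m n lm₁ ln₁)) (≤-by (solve 2 (λ x y → (x :+ y) :- y := x) refl B₁ B₂) (<⇒≤ 0<B₁)))
                (evK m lm₂))
         (van-+ (van-scale K 0<K (van-abs (difference v))) (van-abs (difference (expSum-cauchy B 0≤B)))))
    where
    bound : ∀ {B K} m n → 0ℚ ≤ B → ∣ f m ∣ ≤ B → ∣ g n ∣ ≤ B → ∣ expSum B m ∣ ≤ K →
            ∣ expSum (f m) m - expSum (g n) n ∣ ≤ K * ∣ f m - g n ∣ + ∣ expSum B m - expSum B n ∣
    bound {B} {K} m n 0≤B hf hg hK = subst (λ z → ∣ z ∣ ≤ K * ∣ f m - g n ∣ + ∣ expSum B m - expSum B n ∣)
      (solve 3 (λ x y z → (x :- y) :+ (y :- z) := x :- z) refl (expSum (f m) m) (expSum (g n) m) (expSum (g n) n))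
      (≤-trans (∣p+q∣≤∣p∣+∣q∣ (expSum (f m) m - expSum (g n) m) (expSum (g n) m - expSum (g n) n))
        (+-mono-≤
          (≤-trans (expSum-lipschitz 0≤B hf hg m)
            (subst (_≤ K * ∣ f m - g n ∣) (*-comm (expSum B m) ∣ f m - g n ∣)
              (*-mono (sum≥0 (term≥0 0≤B) m) (≤-trans (≤∣∣ (expSum B m)) hK) (0≤∣p∣ (f m - g n)) ≤-refl)))
          (tail-≤ hg m n)))

  -- The Cauchy product: conv f g n = f 0 · g n + f 1 · g (n − 1) + … + f n · g 0
  conv : (ℕ → ℚ) → (ℕ → ℚ) → ℕ → ℚ
  conv f g zero    = f 0 * g 0
  conv f g (suc n) = f 0 * g (suc n) + conv (f ∘ suc) g n

  conv-congˡ : ∀ {f f′ g} → (∀ k → f k ≡ f′ k) → ∀ n → conv f g n ≡ conv f′ g n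
  conv-congˡ {g = g} h zero    = cong (_* g 0) (h 0)
  conv-congˡ {g = g} h (suc n) = cong₂ _+_ (cong (_* g (suc n)) (h 0)) (conv-congˡ (h ∘ suc) n)

  conv-congʳ : ∀ {f g g′} → (∀ k → g k ≡ g′ k) → ∀ n → conv f g n ≡ conv f g′ n
  conv-congʳ {f} h zero    = cong (f 0 *_) (h 0)
  conv-congʳ {f} h (suc n) = cong₂ _+_ (cong (f 0 *_) (h (suc n))) (conv-congʳ h n)

  conv-+ˡ : ∀ f f′ g n → conv (λ k → f k + f′ k) g n ≡ conv f g n + conv f′ g n
  conv-+ˡ f f′ g zero    = *-distribʳ-+ (g 0) (f 0) (f′ 0)
  conv-+ˡ f f′ g (suc n) = trans
    (cong ((f 0 + f′ 0) * g (suc n) +_) (conv-+ˡ (f ∘ suc) (f′ ∘ suc) g n))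
    (solve 5 (λ a b c x y → (a :+ b) :* c :+ (x :+ y) := (a :* c :+ x) :+ (b :* c :+ y)) refl
      (f 0) (f′ 0) (g (suc n)) (conv (f ∘ suc) g n) (conv (f′ ∘ suc) g n))

  conv-*ˡ : ∀ c f g n → conv (λ k → c * f k) g n ≡ c * conv f g n
  conv-*ˡ c f g zero    = *-assoc c (f 0) (g 0)
  conv-*ˡ c f g (suc n) = trans
    (cong ((c * f 0) * g (suc n) +_) (conv-*ˡ c (f ∘ suc) g n))
    (solve 4 (λ c a b x → (c :* a) :* b :+ c :* x := c :* (a :* b :+ x)) refl
      c (f 0) (g (suc n)) (conv (f ∘ suc) g n))

  conv-*ʳ : ∀ c f g n → conv f (λ k → c * g k) n ≡ c * conv f g n
  conv-*ʳ c f g zero    = solve 3 (λ c a b → a :* (c :* b) := c :* (a :* b)) refl c (f 0) (g 0)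
  conv-*ʳ c f g (suc n) = trans
    (cong (f 0 * (c * g (suc n)) +_) (conv-*ʳ c (f ∘ suc) g n))
    (solve 4 (λ c a b x → a :* (c :* b) :+ c :* x := c :* (a :* b :+ x)) refl
      c (f 0) (g (suc n)) (conv (f ∘ suc) g n))

  conv-sum : ∀ f g n → conv f (sum g) n ≡ sum (conv f g) n
  conv-sum f g zero = refl
  conv-sum f g (suc zero) =
    solve 4 (λ a b x y → a :* (x :+ y) :+ b :* x := a :* x :+ (a :* y :+ b :* x)) refl (f 0) (f 1) (g 0) (g 1)
  conv-sum f g (suc (suc n)) = begin
    f 0 * (sum g (suc n) + g (suc (suc n))) + conv f′ (sum g) (suc n)
      ≡⟨ cong (f 0 * (sum g (suc n) + g (suc (suc n))) +_)
           (trans (conv-sum f′ g (suc n)) (cong (_+ conv f′ g (suc n)) (sym (conv-sum f′ g n)))) ⟩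
    f 0 * (sum g (suc n) + g (suc (suc n))) + (conv f′ (sum g) n + conv f′ g (suc n))
      ≡⟨ solve 5 (λ a x y z w → a :* (x :+ y) :+ (z :+ w) := (a :* x :+ z) :+ (a :* y :+ w)) refl
           (f 0) (sum g (suc n)) (g (suc (suc n))) (conv f′ (sum g) n) (conv f′ g (suc n)) ⟩
    conv f (sum g) (suc n) + conv f g (suc (suc n))
      ≡⟨ cong (_+ conv f g (suc (suc n))) (conv-sum f g (suc n)) ⟩
    sum (conv f g) (suc n) + conv f g (suc (suc n)) ∎
    where
    open ≡-Reasoning
    f′ = f ∘ suc

  conv-const : ∀ f c n → conv f (λ _ → c) n ≡ sum f n * c
  conv-const f c zero    = refl
  conv-const f c (suc n) = trans (cong (f 0 * c +_) (conv-const (f ∘ suc) c n))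
    (trans (sym (*-distribʳ-+ c (f 0) (sum (f ∘ suc) n))) (cong (_* c) (shift f n)))
    where
    shift : ∀ f n → f 0 + sum (f ∘ suc) n ≡ sum f (suc n)
    shift f zero    = refl
    shift f (suc n) = trans (sym (+-assoc (f 0) (sum (f ∘ suc) n) (f (suc (suc n)))))
      (cong (_+ f (suc (suc n))) (shift f n))

  deriv : (ℕ → ℚ) → ℕ → ℚ
  deriv f n = ℕ→ℚ (suc n) * f (suc n)

  leibniz : ∀ f g n → deriv (conv f g) n ≡ conv (deriv f) g n + conv f (deriv g) n
  leibniz f g zero = solve 4
    (λ a b x y → con 1ℚ :* (a :* y :+ b :* x) := (con 1ℚ :* b) :* x :+ a :* (con 1ℚ :* y)) refl
    (f 0) (f 1) (g 0) (g 1)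
  leibniz f g (suc n) = begin
    ℕ→ℚ (suc (suc n)) * (f 0 * g₂ + c′)
      ≡⟨ cong (_* (f 0 * g₂ + c′)) (ℕ→ℚ-suc (suc n)) ⟩
    (1ℚ + ν) * (f 0 * g₂ + c′)
      ≡⟨ solve 4 (λ ν a g c → (con 1ℚ :+ ν) :* (a :* g :+ c) := a :* ((con 1ℚ :+ ν) :* g) :+ (c :+ ν :* c)) refl
           ν (f 0) g₂ c′ ⟩
    f 0 * ((1ℚ + ν) * g₂) + (c′ + ν * c′)
      ≡⟨ cong₂ (λ s t → f 0 * (s * g₂) + (c′ + t)) (sym (ℕ→ℚ-suc (suc n))) (leibniz f′ g n) ⟩
    f 0 * deriv g (suc n) + ((f 1 * g₁ + conv f″ g n) + (conv (deriv f′) g n + conv f′ (deriv g) n))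
      ≡⟨ solve 6 (λ p a b x y z → p :+ ((a :* b :+ x) :+ (y :+ z)) := ((con 1ℚ :* a) :* b :+ (y :+ x)) :+ (p :+ z)) refl
           (f 0 * deriv g (suc n)) (f 1) g₁ (conv f″ g n) (conv (deriv f′) g n) (conv f′ (deriv g) n) ⟩
    ((1ℚ * f 1) * g₁ + (conv (deriv f′) g n + conv f″ g n)) + (f 0 * deriv g (suc n) + conv f′ (deriv g) n)
      ≡⟨ cong (λ z → ((1ℚ * f 1) * g₁ + z) + (f 0 * deriv g (suc n) + conv f′ (deriv g) n))
           (trans (sym (conv-+ˡ (deriv f′) f″ g n)) (conv-congˡ step n)) ⟩
    conv (deriv f) g (suc n) + conv f (deriv g) (suc n) ∎
    where
    open ≡-Reasoning
    f′ = f ∘ suc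
    f″ = f′ ∘ suc
    ν  = ℕ→ℚ (suc n)
    g₁ = g (suc n)
    g₂ = g (suc (suc n))
    c′ = conv f′ g (suc n)
    step : ∀ k → deriv f′ k + f″ k ≡ deriv f (suc k)
    step k = trans
      (solve 2 (λ s x → s :* x :+ x := (con 1ℚ :+ s) :* x) refl (ℕ→ℚ (suc k)) (f″ k))
      (cong (_* f″ k) (sym (ℕ→ℚ-suc (suc k))))

  deriv-term : ∀ q k → deriv (term q) k ≡ q * term q k
  deriv-term q k = trans (sym (dterm-rec q (suc k))) (*-comm (term q k) q)

  -- The binomial theorem: (a + b)ᵏ/k! = Σ aⁱ/i! · bᵏ⁻ⁱ/(k−i)!
  conv-term : ∀ a b k → conv (term a) (term b) k ≡ term (a + b) k
  conv-term a b zero    = refl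
  conv-term a b (suc k) = begin
    c                                    ≡⟨ sym (*-identityˡ c) ⟩
    1ℚ * c                               ≡⟨ cong (_* c) (sym (recip-inv k)) ⟩
    (recip k * ℕ→ℚ (suc k)) * c          ≡⟨ *-assoc (recip k) (ℕ→ℚ (suc k)) c ⟩
    recip k * deriv (conv (term a) (term b)) k
      ≡⟨ cong (recip k *_) (leibniz (term a) (term b) k) ⟩
    recip k * (conv (deriv (term a)) (term b) k + conv (term a) (deriv (term b)) k)
      ≡⟨ cong (recip k *_) (cong₂ _+_
           (trans (conv-congˡ (deriv-term a) k) (conv-*ˡ a (term a) (term b) k))
           (trans (conv-congʳ (deriv-term b) k) (conv-*ʳ b (term a) (term b) k))) ⟩
    recip k * (a * c₀ + b * c₀)
      ≡⟨ solve 4 (λ r a b c → r :* (a :* c :+ b :* c) := c :* ((a :+ b) :* r)) refl (recip k) a b c₀ ⟩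
    c₀ * ((a + b) * recip k)             ≡⟨ cong (_* ((a + b) * recip k)) (conv-term a b k) ⟩
    term (a + b) k * ((a + b) * recip k) ∎
    where
    open ≡-Reasoning
    c  = conv (term a) (term b) (suc k)
    c₀ = conv (term a) (term b) k

  sum-cong : ∀ {f g} → (∀ k → f k ≡ g k) → ∀ n → sum f n ≡ sum g n
  sum-cong h zero    = h 0
  sum-cong h (suc n) = cong₂ _+_ (sum-cong h n) (h (suc n))

  conv-expSum : ∀ a b n → conv (term a) (expSum b) n ≡ expSum (a + b) n
  conv-expSum a b n = trans (conv-sum (term a) (term b) n) (sum-cong (conv-term a b) n)

  conv-minus : ∀ f c h n → conv f (λ j → c - h j) n ≡ sum f n * c - conv f h n
  conv-minus f c h zero    = solve 3 (λ a c x → a :* (c :- x) := a :* c :- a :* x) refl (f 0) c (h 0)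
  conv-minus f c h (suc n) = begin
    f 0 * (c - h (suc n)) + conv f′ (λ j → c - h j) n
      ≡⟨ cong (f 0 * (c - h (suc n)) +_) (conv-minus f′ c h n) ⟩
    f 0 * (c - h (suc n)) + (sum f′ n * c - conv f′ h n)
      ≡⟨ solve 5 (λ a c x s y → a :* (c :- x) :+ (s :* c :- y) := (a :* c :+ s :* c) :- (a :* x :+ y)) refl
           (f 0) c (h (suc n)) (sum f′ n) (conv f′ h n) ⟩
    (f 0 * c + sum f′ n * c) - (f 0 * h (suc n) + conv f′ h n)
      ≡⟨ cong (_- (f 0 * h (suc n) + conv f′ h n))
           (trans (cong (f 0 * c +_) (sym (conv-const f′ c n))) (conv-const f c (suc n))) ⟩
    sum f (suc n) * c - conv f h (suc n) ∎
    where
    open ≡-Reasoning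
    f′ = f ∘ suc

  conv-dominated : ∀ {f F g G} → (∀ k → ∣ f k ∣ ≤ F k) → ∀ n → (∀ j → j ℕ.≤ n → ∣ g j ∣ ≤ G j) →
                   ∣ conv f g n ∣ ≤ conv F G n
  conv-dominated {f} {F} {g} {G} hf zero hg = subst (_≤ F 0 * G 0) (sym (∣p*q∣≡∣p∣*∣q∣ (f 0) (g 0)))
    (*-mono (0≤∣p∣ (f 0)) (hf 0) (0≤∣p∣ (g 0)) (hg 0 z≤n))
  conv-dominated {f} {F} {g} {G} hf (suc n) hg =
    ≤-trans (∣p+q∣≤∣p∣+∣q∣ (f 0 * g (suc n)) (conv (f ∘ suc) g n))
      (+-mono-≤
        (subst (_≤ F 0 * G (suc n)) (sym (∣p*q∣≡∣p∣*∣q∣ (f 0) (g (suc n))))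
          (*-mono (0≤∣p∣ (f 0)) (hf 0) (0≤∣p∣ (g (suc n))) (hg (suc n) ℕ.≤-refl)))
        (conv-dominated (hf ∘ suc) n (λ j l → hg j (ℕ.m≤n⇒m≤1+n l))))

  conv≥0 : ∀ {f g} → (∀ k → 0ℚ ≤ f k) → (∀ k → 0ℚ ≤ g k) → ∀ n → 0ℚ ≤ conv f g n
  conv≥0 hf hg zero    = *≥0 (hf 0) (hg 0)
  conv≥0 hf hg (suc n) = +≥0 (*≥0 (hf 0) (hg (suc n))) (conv≥0 (hf ∘ suc) hg n)

  conv-truncate : ∀ f h → (∀ k → 0ℚ ≤ f k) → (∀ k → 0ℚ ≤ h k) → (∀ {i j} → i ℕ.≤ j → h i ≤ h j) →
                  ∀ n m → conv f (λ _ → h m) n ≤ conv f h (n ℕ.+ m)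
  conv-truncate f h hf hh mono zero zero = ≤-refl
  conv-truncate f h hf hh mono zero (suc m) = ≤-by
    (solve 2 (λ x y → (x :+ y) :- x := y) refl (f 0 * h (suc m)) (conv (f ∘ suc) h m))
    (conv≥0 (hf ∘ suc) hh m)
  conv-truncate f h hf hh mono (suc n) m = +-mono-≤
    (*-mono (hf 0) ≤-refl (hh m) (mono (ℕ.≤-trans (ℕ.m≤n+m m n) (ℕ.n≤1+n (n ℕ.+ m)))))
    (conv-truncate (f ∘ suc) h (hf ∘ suc) hh mono n m)

  expSum-+-bound : ∀ {a b A B} → ∣ a ∣ ≤ A → ∣ b ∣ ≤ B → 0ℚ ≤ A → 0ℚ ≤ B → ∀ n →
                   ∣ expSum a n * expSum b n - expSum (a + b) n ∣ ≤
                   ∣ expSum (A + B) (n ℕ.+ n) - expSum (A + B) n ∣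
  expSum-+-bound {a} {b} {A} {B} ha hb 0≤A 0≤B n = begin
    ∣ expSum a n * expSum b n - expSum (a + b) n ∣
      ≡⟨ cong ∣_∣ (rewriteᶜ a b) ⟩
    ∣ conv (term a) (λ j → expSum b n - expSum b j) n ∣
      ≤⟨ conv-dominated (∣term∣≤ ha) n (λ j l → tail-≤′ hb (ℕ.≤⇒≤′ l)) ⟩
    conv (term A) (λ j → expSum B n - expSum B j) n
      ≡⟨ sym (rewriteᶜ A B) ⟩
    expSum A n * expSum B n - expSum (A + B) n
      ≤⟨ +-monoˡ-≤ (- expSum (A + B) n) (subst₂ _≤_
           (conv-const (term A) (expSum B n) n) (conv-expSum A B (n ℕ.+ n))
           (conv-truncate (term A) (expSum B) (term≥0 0≤A) (sum≥0 (term≥0 0≤B))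
             (λ l → expSum-mono 0≤B (ℕ.≤⇒≤′ l)) n n)) ⟩
    expSum (A + B) (n ℕ.+ n) - expSum (A + B) n
      ≤⟨ ≤∣∣ (expSum (A + B) (n ℕ.+ n) - expSum (A + B) n) ⟩
    ∣ expSum (A + B) (n ℕ.+ n) - expSum (A + B) n ∣ ∎
    where
    open ≤-Reasoning
    rewriteᶜ : ∀ a b → expSum a n * expSum b n - expSum (a + b) n ≡
                       conv (term a) (λ j → expSum b n - expSum b j) n
    rewriteᶜ a b = trans (cong (λ z → expSum a n * expSum b n - z) (sym (conv-expSum a b n)))
      (sym (conv-minus (term a) (expSum b n) (expSum b) n))

  expSum-+ : ∀ {f g} → Bounded f → Bounded g →
             Vanishing λ n _ → expSum (f n) n * expSum (g n) n - expSum (f n + g n) n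
  expSum-+ {f} {g} (A , 0<A , N₁ , evA) (B , 0<B , N₂ , evB) = van-dom
    (N₁ ℕ.⊔ N₂ , λ m n lm ln → expSum-+-bound
      (evA m (ℕ.≤-trans (ℕ.m≤m⊔n N₁ N₂) lm)) (evB m (ℕ.≤-trans (ℕ.m≤n⊔m N₁ N₂) lm)) 0≤A 0≤B m)
    (van-abs double)
    where
    0≤A = <⇒≤ 0<A
    0≤B = <⇒≤ 0<B
    double : Vanishing λ m _ → expSum (A + B) (m ℕ.+ m) - expSum (A + B) m
    double ε 0<ε =
      let N , h = difference (expSum-cauchy (A + B) (+≥0 0≤A 0≤B)) ε 0<ε
      in N , λ m n lm ln → h (m ℕ.+ m) m (ℕ.≤-trans lm (ℕ.m≤m+n m m)) lm

module LogSeries where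

  open Rationals
  open Sequences
  open ExpSeries
  open +-*-Solver

  record Grid (f : ℚ → ℚ) (y h : ℚ) : Set where
    field
      root   : ℚ
      root≥0 : 0ℚ ≤ root
      below  : f root ≤ y
      above  : y < f (root + h)

  open Grid

  grid : ∀ f y h → 0ℚ ≤ h → f 0ℚ ≤ y → ∀ j → y < f (ℕ→ℚ j * h) → Grid f y h
  grid f y h 0≤h f0≤y zero    top =
    contradiction (<-≤-trans (subst (λ z → y < f z) (*-zeroˡ h) top) f0≤y) (<-irrefl refl)
  grid f y h 0≤h f0≤y (suc j) top = go (f (ℕ→ℚ j * h) ≤? y)
    where
    go : Dec (f (ℕ→ℚ j * h) ≤ y) → Grid f y h
    go (yes l) = record
      { root = ℕ→ℚ j * h ; root≥0 = *≥0 (0≤ℕ→ℚ j) 0≤h ; below = l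
      ; above = subst (λ z → y < f z)
          (trans (cong (_* h) (ℕ→ℚ-suc j))
            (solve 2 (λ n h → (con 1ℚ :+ n) :* h := n :* h :+ h) refl (ℕ→ℚ j) h)) top }
    go (no ¬l) = grid f y h 0≤h f0≤y j (≰⇒> ¬l)

  expSum-gap : ∀ {a b} → 0ℚ ≤ b → b ≤ a → ∀ n → a - b ≤ expSum a (suc n) - expSum b (suc n)
  expSum-gap {a} {b} 0≤b b≤a zero = ≤-reflexive
    (solve 2 (λ a b → a :- b := (con 1ℚ :+ con 1ℚ :* (a :* con 1ℚ)) :- (con 1ℚ :+ con 1ℚ :* (b :* con 1ℚ))) refl a b)
  expSum-gap {a} {b} 0≤b b≤a (suc n) = ≤-trans (expSum-gap 0≤b b≤a n)
    (≤-by (solve 4 (λ x s y t → ((x :+ s) :- (y :+ t)) :- (x :- y) := s :- t) refl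
        (expSum a (suc n)) (term a (suc (suc n))) (expSum b (suc n)) (term b (suc (suc n))))
      (diff≥0 (term-mono 0≤b b≤a (suc (suc n)))))

  expSum-expand : ∀ {a b} → 0ℚ ≤ a → 0ℚ ≤ b → ∀ n →
                  ∣ a - b ∣ ≤ ∣ expSum a (suc n) - expSum b (suc n) ∣
  expSum-expand {a} {b} 0≤a 0≤b n = case (≤-total a b)
    where
    case : a ≤ b ⊎ b ≤ a → ∣ a - b ∣ ≤ ∣ expSum a (suc n) - expSum b (suc n) ∣
    case (inj₁ a≤b) = subst₂ _≤_
      (trans (sym (0≤p⇒∣p∣≡p (diff≥0 a≤b))) (∣-∣-sym b a))
      (∣-∣-sym (expSum b (suc n)) (expSum a (suc n)))
      (≤-trans (expSum-gap 0≤a a≤b n) (≤∣∣ (expSum b (suc n) - expSum a (suc n))))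
    case (inj₂ b≤a) = subst (_≤ ∣ expSum a (suc n) - expSum b (suc n) ∣)
      (sym (0≤p⇒∣p∣≡p (diff≥0 b≤a)))
      (≤-trans (expSum-gap 0≤b b≤a n) (≤∣∣ (expSum a (suc n) - expSum b (suc n))))

  expSum-0 : ∀ n → expSum 0ℚ n ≡ 1ℚ
  expSum-0 zero    = refl
  expSum-0 (suc n) = trans
    (cong₂ _+_ (expSum-0 n) (trans (cong (term 0ℚ n *_) (*-zeroˡ (recip n))) (*-zeroʳ (term 0ℚ n))))
    (+-identityʳ 1ℚ)

  expSum> : ∀ {y} → 0ℚ ≤ y → ∀ n → y < expSum y (suc n)
  expSum> {y} 0≤y n = <-≤-trans {y} {y + 1ℚ}
    (<-by (solve 1 (λ y → (y :+ con 1ℚ) :- y := con 1ℚ) refl y) 0<1)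
    (≤-by (solve 2 (λ y e → e :- (y :+ con 1ℚ) := (e :- con 1ℚ) :- (y :- con 0ℚ)) refl y (expSum y (suc n)))
      (diff≥0 (subst (λ z → y - 0ℚ ≤ expSum y (suc n) - z) (expSum-0 (suc n)) (expSum-gap ≤-refl 0≤y n))))

  module LogSeq (y : ℕ → ℚ) (y-cauchy : y ~ y) (y≥1 : ∀ n → 1ℚ ≤ y n) where

    private
      y≥0 : ∀ n → 0ℚ ≤ y n
      y≥0 n = ≤-trans 0≤1 (y≥1 n)

      step : ℕ → ℚ
      step n = y (suc n) * recip n

      step≥0 : ∀ n → 0ℚ ≤ step n
      step≥0 n = *≥0 (y≥0 (suc n)) (<⇒≤ (0<recip n))

      g : ∀ n → Grid (λ t → expSum t (suc n)) (y (suc n)) (step n)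
      g n = grid (λ t → expSum t (suc n)) (y (suc n)) (step n) (step≥0 n)
        (subst (_≤ y (suc n)) (sym (expSum-0 (suc n))) (y≥1 (suc n)))
        (suc n)
        (subst (λ z → y (suc n) < expSum z (suc n))
          (sym (trans
            (solve 3 (λ s y r → s :* (y :* r) := y :* (r :* s)) refl (ℕ→ℚ (suc n)) (y (suc n)) (recip n))
            (trans (cong (y (suc n) *_) (recip-inv n)) (*-identityʳ (y (suc n))))))
          (expSum> (y≥0 (suc n)) n))

    logSeq : ℕ → ℚ
    logSeq zero    = 0ℚ
    logSeq (suc n) = root (g n)

    private
      e : ℕ → ℚ
      e n = expSum (logSeq n) n

      root≤y : ∀ n → root (g n) ≤ y (suc n)
      root≤y n = ≤-trans (<⇒≤ (expSum> (root≥0 (g n)) n)) (below (g n))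

      Y : ℚ
      Y = proj₁ (~-bounded y-cauchy)

      0<Y : 0ℚ < Y
      0<Y = proj₁ (proj₂ (~-bounded y-cauchy))

      0≤Y+Y : 0ℚ ≤ Y + Y
      0≤Y+Y = +≥0 (<⇒≤ 0<Y) (<⇒≤ 0<Y)

      N : ℕ
      N = proj₁ (proj₂ (proj₂ (~-bounded y-cauchy)))

      y≤Y : ∀ n → N ℕ.≤ n → y n ≤ Y
      y≤Y n l = ≤-trans (≤∣∣ (y n)) (proj₂ (proj₂ (proj₂ (~-bounded y-cauchy))) n l)

      recip≤1 : ∀ n → recip n ≤ 1ℚ
      recip≤1 n = recip-antimono {0} {n} z≤n

      step≤ : ∀ n → N ℕ.≤ n → step n ≤ Y * recip n
      step≤ n l = *-mono (y≥0 (suc n)) (y≤Y (suc n) (ℕ.m≤n⇒m≤1+n l)) (<⇒≤ (0<recip n)) ≤-refl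

      root≤Y : ∀ n → N ℕ.≤ n → root (g n) ≤ Y
      root≤Y n l = ≤-trans (root≤y n) (y≤Y (suc n) (ℕ.m≤n⇒m≤1+n l))

      Y≤Y+Y : Y ≤ Y + Y
      Y≤Y+Y = ≤-by (solve 1 (λ x → (x :+ x) :- x := x) refl Y) (<⇒≤ 0<Y)

      step≤Y : ∀ n → N ℕ.≤ n → step n ≤ Y
      step≤Y n l = ≤-trans (step≤ n l)
        (subst (Y * recip n ≤_) (*-identityʳ Y) (*-mono (<⇒≤ 0<Y) ≤-refl (<⇒≤ (0<recip n)) (recip≤1 n)))

      error : ∀ {K} n → N ℕ.≤ n → expSum (Y + Y) (suc n) ≤ K →
              ∣ y (suc n) - expSum (root (g n)) (suc n) ∣ ≤ (K * Y) * recip n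
      error {K} n l hK = begin
        ∣ y (suc n) - expSum r (suc n) ∣
          ≡⟨ 0≤p⇒∣p∣≡p (diff≥0 (below (g n))) ⟩
        y (suc n) - expSum r (suc n)
          ≤⟨ +-monoˡ-≤ (- expSum r (suc n)) (<⇒≤ (above (g n))) ⟩
        expSum (r + h) (suc n) - expSum r (suc n)
          ≤⟨ ≤∣∣ (expSum (r + h) (suc n) - expSum r (suc n)) ⟩
        ∣ expSum (r + h) (suc n) - expSum r (suc n) ∣
          ≤⟨ expSum-lipschitz 0≤Y+Y
               (subst (_≤ Y + Y) (sym (0≤p⇒∣p∣≡p (+≥0 (root≥0 (g n)) (step≥0 n))))
                 (+-mono-≤ (root≤Y n l) (step≤Y n l)))
               (subst (_≤ Y + Y) (sym (0≤p⇒∣p∣≡p (root≥0 (g n)))) (≤-trans (root≤Y n l) Y≤Y+Y))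
               (suc n) ⟩
        ∣ (r + h) - r ∣ * expSum (Y + Y) (suc n)
          ≡⟨ cong (_* expSum (Y + Y) (suc n))
               (trans (cong ∣_∣ (solve 2 (λ r h → (r :+ h) :- r := h) refl r h)) (0≤p⇒∣p∣≡p (step≥0 n))) ⟩
        h * expSum (Y + Y) (suc n)
          ≤⟨ *-mono (step≥0 n) (step≤ n l) (sum≥0 (term≥0 0≤Y+Y) (suc n)) hK ⟩
        (Y * recip n) * K
          ≡⟨ solve 3 (λ y r k → (y :* r) :* k := (k :* y) :* r) refl Y (recip n) K ⟩
        (K * Y) * recip n ∎
        where
        open ≤-Reasoning
        r = root (g n)
        h = step n

      error-vanishing : Vanishing λ n _ → y n - e n
      error-vanishing =
        let K , 0<K , N′ , hK = ~-bounded (expSum-cauchy (Y + Y) 0≤Y+Y)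
        in van-suc {λ n → y n - e n} (van-dom
             (N ℕ.⊔ N′ , λ m n lm ln → error m (ℕ.≤-trans (ℕ.m≤m⊔n N N′) lm)
               (≤-trans (≤∣∣ (expSum (Y + Y) (suc m)))
                 (hK (suc m) (ℕ.m≤n⇒m≤1+n (ℕ.≤-trans (ℕ.m≤n⊔m N N′) lm)))))
             (van-scale (K * Y) (*>0 0<K 0<Y) recip-vanishing))

    exp-logSeq : (λ n → expSum (logSeq n) n) ~ y
    exp-logSeq = ~-null
      (van-cong (λ m n → solve 2 (λ x y → x :- y := :- (y :- x)) refl (e m) (y m)) (van-neg error-vanishing))
      y-cauchy

    private
      expand : ∀ m n → suc N ℕ.≤ m → suc N ℕ.≤ n →
               ∣ logSeq m - logSeq n ∣ ≤ ∣ e m - e n ∣ + ∣ expSum Y n - expSum Y m ∣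
      expand (suc m) (suc n) (s≤s lm) (s≤s ln) = begin
        ∣ a - b ∣
          ≤⟨ expSum-expand (root≥0 (g m)) (root≥0 (g n)) m ⟩
        ∣ expSum a (suc m) - expSum b (suc m) ∣
          ≡⟨ cong ∣_∣ (solve 3 (λ x y z → x :- y := (x :- z) :+ (z :- y)) refl
               (expSum a (suc m)) (expSum b (suc m)) (expSum b (suc n))) ⟩
        ∣ (expSum a (suc m) - expSum b (suc n)) + (expSum b (suc n) - expSum b (suc m)) ∣
          ≤⟨ ∣p+q∣≤∣p∣+∣q∣ (expSum a (suc m) - expSum b (suc n)) (expSum b (suc n) - expSum b (suc m)) ⟩
        ∣ expSum a (suc m) - expSum b (suc n) ∣ + ∣ expSum b (suc n) - expSum b (suc m) ∣
          ≤⟨ +-monoʳ-≤ ∣ expSum a (suc m) - expSum b (suc n) ∣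
               (tail-≤ (subst (_≤ Y) (sym (0≤p⇒∣p∣≡p (root≥0 (g n)))) (root≤Y n ln)) (suc n) (suc m)) ⟩
        ∣ expSum a (suc m) - expSum b (suc n) ∣ + ∣ expSum Y (suc n) - expSum Y (suc m) ∣ ∎
        where
        open ≤-Reasoning
        a = root (g m)
        b = root (g n)

    logSeq-cauchy : logSeq ~ logSeq
    logSeq-cauchy = mk~ (van-dom (suc N , expand)
      (van-+ (van-abs (difference (~-trans exp-logSeq (~-sym exp-logSeq))))
             (van-abs (van-swap (difference (expSum-cauchy Y (<⇒≤ 0<Y)))))))

open Rationals
open Sequences
open ExpSeries
open LogSeries
open +-*-Solver

record ℝ : Set where
  constructor mkℝ
  field
    seq    : ℕ → ℚ
    cauchy : seq ~ seq

open ℝ public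

infix 4 _≃ʳ_ _<ʳ_

_≃ʳ_ : ℝ → ℝ → Set
x ≃ʳ y = seq x ~ seq y

_<ʳ_ : ℝ → ℝ → Set
x <ʳ y = EventuallyPositive λ n → seq y n - seq x n

fromℚ : ℚ → ℝ
fromℚ q = mkℝ (λ _ → q) (~-const q)

0ʳ 1ʳ : ℝ
0ʳ = fromℚ 0ℚ
1ʳ = fromℚ 1ℚ

infixl 6 _+ʳ_ _-ʳ_
infixl 7 _*ʳ_
infix  8 -ʳ_

_+ʳ_ : ℝ → ℝ → ℝ
x +ʳ y = mkℝ (λ n → seq x n + seq y n) (~-+ (cauchy x) (cauchy y))

-ʳ_ : ℝ → ℝ
-ʳ x = mkℝ (λ n → - seq x n) (~-neg (cauchy x))

_-ʳ_ : ℝ → ℝ → ℝ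
x -ʳ y = x +ʳ (-ʳ y)

_*ʳ_ : ℝ → ℝ → ℝ
x *ʳ y = mkℝ (λ n → seq x n * seq y n) (~-* (cauchy x) (cauchy y))

eventuallyPositive : ∀ x → 0ʳ <ʳ x → EventuallyPositive (seq x)
eventuallyPositive x (δ , 0<δ , N , h) = δ , 0<δ , N , λ n l → subst (δ ≤_) (+-identityʳ (seq x n)) (h n l)

quotient : ℝ → (y : ℝ) → 0ʳ <ʳ y → ℝ
quotient x y 0<y = x *ʳ
  mkℝ (λ n → inv (seq y n)) (~-inv (eventuallyPositive y 0<y) (eventuallyPositive y 0<y) (cauchy y))

exp : ℝ → ℝ
exp x = mkℝ (λ n → expSum (seq x n) n) (~-exp (cauchy x))

exp-positive : ∀ x → 0ʳ <ʳ exp x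
exp-positive x =
  let M , 0<M , N₁ , hM = ~-bounded (cauchy x)
      0≤M = <⇒≤ 0<M
      K , 0<K , N₂ , hK = ~-bounded (expSum-cauchy M 0≤M)
      0<invK , K*invK≡1 = inv-spec K 0<K
      N₃ , hv = expSum-+ (~-bounded (cauchy x)) (~-bounded (~-const M)) ½ (positive⁻¹ ½)
      N₁₂ = N₁ ℕ.⊔ N₂
  in ½ * inv K , *>0 (positive⁻¹ ½) 0<invK , N₁₂ ℕ.⊔ N₃ , λ n l →
     let l₁₂ = ℕ.≤-trans (ℕ.m≤m⊔n N₁₂ N₃) l
         l₁ = ℕ.≤-trans (ℕ.m≤m⊔n N₁ N₂) l₁₂
         l₂ = ℕ.≤-trans (ℕ.m≤n⊔m N₁ N₂) l₁₂
         l₃ = ℕ.≤-trans (ℕ.m≤n⊔m N₁₂ N₃) l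
     in subst (½ * inv K ≤_) (sym (+-identityʳ (expSum (seq x n) n)))
          (lower {expSum (seq x n) n} {expSum M n} {K} {inv K} {expSum (seq x n + M) n}
            (expSum≥1 0≤M n) (≤-trans (≤∣∣ (expSum M n)) (hK n l₂)) 0<invK K*invK≡1
            (expSum≥1 (shift≥0 (hM n l₁)) n)
            (hv n n l₃ l₃))
  where
  shift≥0 : ∀ {q M} → ∣ q ∣ ≤ M → 0ℚ ≤ q + M
  shift≥0 {q} {M} h = subst (0ℚ ≤_) (solve 2 (λ q m → m :- :- q := q :+ m) refl q M)
    (diff≥0 (≤-trans (-≤∣∣ q) h))

  lower : ∀ {e w K k s} → 1ℚ ≤ w → w ≤ K → 0ℚ < k → K * k ≡ 1ℚ → 1ℚ ≤ s →
          ∣ e * w - s ∣ < ½ → ½ * k ≤ e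
  lower {e} {w} {K} {k} {s} 1≤w w≤K 0<k Kk≡1 1≤s close = ≮⇒≥ λ e<½k →
    <-irrefl refl (begin-strict
      ½             ≡⟨ refl ⟩
      1ℚ - ½        ≤⟨ +-monoˡ-≤ (- ½) 1≤s ⟩
      s - ½         <⟨ +-monoʳ-< s (neg-antimono-< (≤-<-trans (-≤∣∣ (e * w - s)) close)) ⟩
      s - - (e * w - s)  ≡⟨ solve 2 (λ s p → s :- :- (p :- s) := p) refl s (e * w) ⟩
      e * w         ≤⟨ *-monoʳ-≤-nonNeg w {{nonNegative (≤-trans 0≤1 1≤w)}} (<⇒≤ e<½k) ⟩
      (½ * k) * w   ≤⟨ *-mono (*≥0 (<⇒≤ (positive⁻¹ ½)) (<⇒≤ 0<k)) ≤-refl (≤-trans 0≤1 1≤w) w≤K ⟩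
      (½ * k) * K   ≡⟨ solve 3 (λ h k K → (h :* k) :* K := h :* (K :* k)) refl ½ k K ⟩
      ½ * (K * k)   ≡⟨ trans (cong (½ *_) Kk≡1) (*-identityʳ ½) ⟩
      ½ ∎)
    where open ≤-Reasoning

abstract

  -- Scaling by M and shifting by N moves x into [1, ∞), where LogSeries inverts exp;
  -- then log x = log (M x) − log M.
  logarithm : ∀ x → 0ʳ <ʳ x → Σ ℝ λ ℓ → exp ℓ ≃ʳ x
  logarithm x 0<x = ℓ , ~-trans u~uMk (~-trans main Mfk~f)
    where
    f : ℕ → ℚ
    f = seq x
    δ : ℚ
    δ = proj₁ (eventuallyPositive x 0<x)
    0<δ : 0ℚ < δ
    0<δ = proj₁ (proj₂ (eventuallyPositive x 0<x))
    N : ℕ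
    N = proj₁ (proj₂ (proj₂ (eventuallyPositive x 0<x)))
    f≥δ : ∀ n → N ℕ.≤ n → δ ≤ f n
    f≥δ = proj₂ (proj₂ (proj₂ (eventuallyPositive x 0<x)))
    0<invδ : 0ℚ < inv δ
    0<invδ = proj₁ (inv-spec δ 0<δ)
    M : ℚ
    M = 1ℚ + inv δ
    1≤M : 1ℚ ≤ M
    1≤M = ≤-by (solve 1 (λ r → (con 1ℚ :+ r) :- con 1ℚ := r) refl (inv δ)) (<⇒≤ 0<invδ)
    0<M : 0ℚ < M
    0<M = <-≤-trans 0<1 1≤M
    k : ℚ
    k = inv M
    M*k≡1 : M * k ≡ 1ℚ
    M*k≡1 = proj₂ (inv-spec M 0<M)

    y : ℕ → ℚ
    y n = M * f (N ℕ.+ n)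
    shift : (λ n → f (N ℕ.+ n)) ~ f
    shift = mk~ λ ε 0<ε → let N′ , h = difference (cauchy x) ε 0<ε in N′ , λ m n lm ln →
      h (N ℕ.+ m) n (ℕ.≤-trans lm (ℕ.m≤n+m m N)) ln
    y~Mf : y ~ (λ n → M * f n)
    y~Mf = ~-* (~-const M) shift
    y≥1 : ∀ n → 1ℚ ≤ y n
    y≥1 n = subst (_≤ y n) (trans (*-comm (inv δ) δ) (proj₂ (inv-spec δ 0<δ)))
      (*-mono {q = M} (<⇒≤ 0<invδ)
        (≤-by (solve 1 (λ r → (con 1ℚ :+ r) :- r := con 1ℚ) refl (inv δ)) 0≤1)
        (<⇒≤ 0<δ) (f≥δ (N ℕ.+ n) (ℕ.m≤m+n N n)))

    y-cauchy : y ~ y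
    y-cauchy = ~-trans y~Mf (~-sym y~Mf)

    module A = LogSeq y y-cauchy y≥1
    module B = LogSeq (λ _ → M) (~-const M) (λ _ → 1≤M)

    a b : ℝ
    a = mkℝ A.logSeq A.logSeq-cauchy
    b = mkℝ B.logSeq B.logSeq-cauchy

    ℓ : ℝ
    ℓ = a -ʳ b

    u : ℕ → ℚ
    u = seq (exp ℓ)

    uv~ea : (λ n → u n * seq (exp b) n) ~ seq (exp a)
    uv~ea = ~-null
      (van-cong
        (λ m n → cong (λ z → u m * seq (exp b) m - expSum z m)
          (solve 2 (λ a b → a := (a :- b) :+ b) refl (seq a m) (seq b m)))
        (expSum-+ (~-bounded (cauchy ℓ)) (~-bounded (cauchy b))))
      (cauchy (exp a))

    uM~Mf : (λ n → u n * M) ~ (λ n → M * f n)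
    uM~Mf = ~-trans
      (~-* (cauchy (exp ℓ)) (~-sym B.exp-logSeq))
      (~-trans uv~ea (~-trans A.exp-logSeq y~Mf))

    main : (λ n → (u n * M) * k) ~ (λ n → (M * f n) * k)
    main = ~-* uM~Mf (~-const k)

    ~-pointwise : ∀ {g h} → (∀ n → g n ≡ h n) → h ~ h → g ~ h
    ~-pointwise {g} {h} e c = ~-null (van-cong (λ m n → trans (cong (_- h m) (e m)) (+-inverseʳ (h m))) van-0) c

    u~uMk : u ~ (λ n → (u n * M) * k)
    u~uMk = ~-sym (~-pointwise
      (λ n → trans (*-assoc (u n) M k) (trans (cong (u n *_) M*k≡1) (*-identityʳ (u n)))) (cauchy (exp ℓ)))

    Mfk~f : (λ n → (M * f n) * k) ~ f
    Mfk~f = ~-pointwise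
      (λ n → trans (solve 3 (λ m f k → (m :* f) :* k := f :* (m :* k)) refl M (f n) k)
        (trans (cong (f n *_) M*k≡1) (*-identityʳ (f n)))) (cauchy x)

log : (x : ℝ) → 0ʳ <ʳ x → ℝ
log x 0<x = proj₁ (logarithm x 0<x)

exp-log : ∀ x 0<x → exp (log x 0<x) ≃ʳ x
exp-log x 0<x = proj₂ (logarithm x 0<x)

-- x ^ y = exp (y · log x)
pow : (x : ℝ) → 0ʳ <ʳ x → ℝ → ℝ
pow x 0<x y = exp (y *ʳ log x 0<x)

pow-positive : ∀ x 0<x y → 0ʳ <ʳ pow x 0<x y
pow-positive x 0<x y = exp-positive (y *ʳ log x 0<x)

fromℕ : ℕ → ℝ
fromℕ n = fromℚ (ℕ→ℚ n)

fromℕ-positive : ∀ n → .{{ℕ.NonZero n}} → 0ʳ <ʳ fromℕ n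
fromℕ-positive n@(suc k) = ℕ→ℚ n , 0<ℕ→ℚ-suc k , 0 , λ _ _ → ≤-reflexive (sym (+-identityʳ (ℕ→ℚ n)))

euler : ℝ
euler = exp 1ʳ

-- 1 − ½ e log 2
α : ℝ
α = 1ʳ -ʳ fromℚ ½ *ʳ euler *ʳ log (fromℕ 2) (fromℕ-positive 2)

{-# OPTIONS --safe #-}

-- Let n be the product of p^c over the primes p < y, with c = y². For a residue s let Ω(s) be the number
-- of prime factors of gcd(s, n), counted with multiplicity. The set { s : k ≤ Ω(s) < 2k } is product-free,
-- because Ω(ab) ≥ min(c, Ω(a) + Ω(b)). Its complement is estimated with Chernoff's bound: the mean of
-- z^Ω is a product over the primes and is O(exp((z − 1) μ)), where μ = Σ 1/p. The two tails balance for
-- k ≈ e μ / 4, where z = k/μ and z = 2k/μ give O(4ᵏ exp(−μ)) = O(exp(−(1 − ½ e log 2) μ)). Sieving the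
-- harmonic sum by the primes shows Σ_{m<y} 1/m ≤ exp(μ + 2), so that log log n = O(exp μ).
module Submission where

-- Chernoff's bound makes the lower tail at most (μ/k)ᵏ exp(k - μ) and the upper tail at most
-- (μ/2k)²ᵏ exp(2k - μ + 3). At k = eμ/4 the ratios μ/k and μ/2k are 4/e and 2/e, so the powers of e
-- cancel and both tails become 4ᵏ exp(-μ) up to a constant. The bound applies on both sides because
-- 2 < e < 4 puts k/μ below 1 and 2k/μ above 1. Exponents are capped because a residue modulo n
-- determines the power of p only up to pᶜ; the cap is harmless once c ≥ 2k, and k ≤ μ ≤ y makes y²
-- ample. The tails are governed by μ, the theorem by n. The link is log log log n ≤ μ + 5, which
-- passes to the power because 1 - ½ e log 2 is non-negative, a numerical fact about e and log 2.
-- The additive constants in the exponents end up in C. The reals are Cauchy sequences without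
-- decidable order or computable ceiling, and a logarithm is known only through its exponential.
-- Hence logarithms are compared by exponentiating, and the estimates rest on 1 + x ≤ exp x, ring
-- identities with non-negative remainders, and a few rational evaluations of the exponential
-- series.

import Data.Nat as ℕ
open import Data.Nat using (ℕ; NonZero)
open import Defs

-- Order on the reals and the inequality 1 + x ≤ exp x.

module RealOrder where

  import Data.Nat.Properties as ℕ
  open import Data.Nat using (zero; suc)
  open import Data.Product using (∃-syntax; _,_)
  open import Data.Rational
  open import Data.Rational.Properties
  open import Data.Rational.Solver using (module +-*-Solver)
  open import Data.Sum using (inj₁; inj₂)
  open import Relation.Binary.PropositionalEquality
  open Rationals
  open Sequences
  open ExpSeries
  open +-*-Solver

  infix 4 _≤ʳ_

  -- The slack ε makes the relation independent of the representing sequences; a termwise inequality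
  -- would not respect `_≃ʳ_`.
  record _≤ʳ_ (x y : ℝ) : Set where
    constructor mk≤ʳ
    field
      within : ∀ ε → 0ℚ < ε → Eventually λ n → seq x n ≤ seq y n + ε

  open _≤ʳ_ public

  ev-map₂ : ∀ {P Q R : ℕ → Set} → (∀ n → P n → Q n → R n) → Eventually P → Eventually Q → Eventually R
  ev-map₂ h (M , p) (N , q) = M ℕ.⊔ N , λ n l →
    h n (p n (ℕ.≤-trans (ℕ.m≤m⊔n M N) l)) (q n (ℕ.≤-trans (ℕ.m≤n⊔m M N) l))

  0<half : ∀ {ε} → 0ℚ < ε → 0ℚ < ε * ½
  0<half h = *>0 h (positive⁻¹ ½)

  ≤ʳ-pointwise : ∀ {x y} → (∀ n → seq x n ≤ seq y n) → x ≤ʳ y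
  ≤ʳ-pointwise {x} {y} h = mk≤ʳ λ ε 0<ε → 0 , λ n _ → ≤-trans (h n)
    (≤-by (solve 2 (λ y e → (y :+ e) :- y := e) refl (seq y n) ε) (<⇒≤ 0<ε))

  ≃⇒≤ʳ : ∀ {x y} → x ≃ʳ y → x ≤ʳ y
  ≃⇒≤ʳ {x} {y} x≃y = mk≤ʳ λ ε 0<ε → let N , h = difference x≃y ε 0<ε in N , λ n l →
    ≤-by (solve 3 (λ x y e → (y :+ e) :- x := e :- (x :- y)) refl (seq x n) (seq y n) ε)
      (diff≥0 (≤-trans (≤∣∣ (seq x n - seq y n)) (<⇒≤ (h n n l l))))

  ≃-pointwise : ∀ {x y} → (∀ n → seq x n ≡ seq y n) → x ≃ʳ y
  ≃-pointwise {x} {y} e = ~-null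
    (van-cong (λ m n → trans (cong (_- seq y m) (e m)) (+-inverseʳ (seq y m))) van-0) (cauchy y)

  ≤ʳ-refl : ∀ {x} → x ≤ʳ x
  ≤ʳ-refl {x} = ≤ʳ-pointwise {x} {x} λ _ → ≤-refl

  ≤ʳ-trans : ∀ {x y z} → x ≤ʳ y → y ≤ʳ z → x ≤ʳ z
  ≤ʳ-trans {x} {y} {z} (mk≤ʳ p) (mk≤ʳ q) = mk≤ʳ λ ε 0<ε →
    ev-map₂ (λ n x≤y y≤z → ≤-trans x≤y (≤-trans (+-monoˡ-≤ (ε * ½) y≤z) (≤-reflexive
        (solve 2 (λ z e → (z :+ e :* con ½) :+ e :* con ½ := z :+ e) refl (seq z n) ε))))
      (p (ε * ½) (0<half 0<ε)) (q (ε * ½) (0<half 0<ε))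

  fromℚ-mono : ∀ {p q} → p ≤ q → fromℚ p ≤ʳ fromℚ q
  fromℚ-mono p≤q = ≤ʳ-pointwise λ _ → p≤q

  fromℚ-cancel : ∀ {p q} → fromℚ p ≤ʳ fromℚ q → p ≤ q
  fromℚ-cancel {p} {q} (mk≤ʳ h) = ≮⇒≥ λ q<p →
    let 0<δ = 0<half (diff>0 q<p)
        N , l = h ((p - q) * ½) 0<δ
    in <-irrefl refl (<-≤-trans
      (<-by (solve 2 (λ p q → p :- (q :+ (p :- q) :* con ½) := (p :- q) :* con ½) refl p q) 0<δ)
      (l N ℕ.≤-refl))

  +ʳ-mono-≤ : ∀ {x y u v} → x ≤ʳ y → u ≤ʳ v → x +ʳ u ≤ʳ y +ʳ v
  +ʳ-mono-≤ {x} {y} {u} {v} (mk≤ʳ p) (mk≤ʳ q) = mk≤ʳ λ ε 0<ε →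
    ev-map₂ (λ n x≤y u≤v → ≤-trans (+-mono-≤ x≤y u≤v) (≤-reflexive
        (solve 3 (λ y v e → (y :+ e :* con ½) :+ (v :+ e :* con ½) := (y :+ v) :+ e) refl (seq y n) (seq v n) ε)))
      (p (ε * ½) (0<half 0<ε)) (q (ε * ½) (0<half 0<ε))

  -- With c ≥ −ε and d ≥ −ε, expanding (c + ε)(d + ε) ≥ 0 bounds c d from below.
  *ʳ-nonNeg : ∀ {x y} → 0ʳ ≤ʳ x → 0ʳ ≤ʳ y → 0ʳ ≤ʳ x *ʳ y
  *ʳ-nonNeg {x} {y} (mk≤ʳ p) (mk≤ʳ q) = mk≤ʳ λ ε 0<ε →
    let A , 0<A , N₁ , hA = ~-bounded (cauchy x)
        B , 0<B , N₂ , hB = ~-bounded (cauchy y)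
        M = (A + B) + 1ℚ
        0<M = +-mono-<-≤ (+-mono-< 0<A 0<B) 0≤1
        r , 0<r , Mr≡1 = reciprocal M 0<M
        -- The expansion costs δ(c + d) + δ². Since c ≤ A, d ≤ B and δ ≤ 1, this is at most δM = ε ⊓
        -- 1.
        δ = (ε ⊓ 1ℚ) * r
        0<ε⊓1 = ⊓-pos ε 0<ε
        0<δ = *>0 0<ε⊓1 0<r
        N₃ , hp = p δ 0<δ
        N₄ , hq = q δ 0<δ
        r≤1 : r ≤ 1ℚ
        r≤1 = subst₂ _≤_ (*-identityˡ r) Mr≡1 (*-mono {q = M} 0≤1
          (≤-by (solve 2 (λ a b → ((a :+ b) :+ con 1ℚ) :- con 1ℚ := a :+ b) refl A B) (+≥0 (<⇒≤ 0<A) (<⇒≤ 0<B)))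
          (<⇒≤ 0<r) ≤-refl)
        δ≤1 = *-mono (<⇒≤ 0<ε⊓1) (p⊓q≤q ε 1ℚ) (<⇒≤ 0<r) r≤1
    in (N₁ ℕ.⊔ N₂) ℕ.⊔ (N₃ ℕ.⊔ N₄) , λ n l →
      let l₁₂ = ℕ.≤-trans (ℕ.m≤m⊔n (N₁ ℕ.⊔ N₂) (N₃ ℕ.⊔ N₄)) l
          l₃₄ = ℕ.≤-trans (ℕ.m≤n⊔m (N₁ ℕ.⊔ N₂) (N₃ ℕ.⊔ N₄)) l
          c = seq x n
          d = seq y n
          hc = hp n (ℕ.≤-trans (ℕ.m≤m⊔n N₃ N₄) l₃₄)
          hd = hq n (ℕ.≤-trans (ℕ.m≤n⊔m N₃ N₄) l₃₄)
          bc = ≤-trans (≤∣∣ c) (hA n (ℕ.≤-trans (ℕ.m≤m⊔n N₁ N₂) l₁₂))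
          bd = ≤-trans (≤∣∣ d) (hB n (ℕ.≤-trans (ℕ.m≤n⊔m N₁ N₂) l₁₂))
      in ≤-trans (*≥0 hc hd) (≤-trans
        (≤-by {q = c * d + δ * M}
          (solve 5 (λ c d e a b → (c :* d :+ e :* ((a :+ b) :+ con 1ℚ)) :- (c :+ e) :* (d :+ e) :=
              e :* (((a :- c) :+ (b :- d)) :+ (con 1ℚ :- e))) refl c d δ A B)
          (*≥0 (<⇒≤ 0<δ) (+≥0 (+≥0 (diff≥0 bc) (diff≥0 bd)) (diff≥0 δ≤1))))
        (+-monoʳ-≤ (c * d) (≤-trans (≤-reflexive
            (trans (solve 3 (λ e r m → (e :* r) :* m := e :* (m :* r)) refl (ε ⊓ 1ℚ) r M)
              (trans (cong ((ε ⊓ 1ℚ) *_) Mr≡1) (*-identityʳ (ε ⊓ 1ℚ)))))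
          (p⊓q≤p ε 1ℚ))))
    where
    ⊓-pos : ∀ ε → 0ℚ < ε → 0ℚ < ε ⊓ 1ℚ
    ⊓-pos ε 0<ε with ⊓-sel ε 1ℚ
    ... | inj₁ e = subst (0ℚ <_) (sym e) 0<ε
    ... | inj₂ e = subst (0ℚ <_) (sym e) 0<1

  <ʳ⇒≤ʳ : ∀ {x y} → x <ʳ y → x ≤ʳ y
  <ʳ⇒≤ʳ {x} {y} (δ , 0<δ , N , h) = mk≤ʳ λ ε 0<ε → N , λ n l →
    ≤-by (solve 3 (λ x y e → (y :+ e) :- x := (y :- x) :+ e) refl (seq x n) (seq y n) ε)
      (+≥0 (≤-trans (<⇒≤ 0<δ) (h n l)) (<⇒≤ 0<ε))

  ≤ʳ⇒<ʳ : ∀ {x q} → 0ℚ < q → fromℚ q ≤ʳ x → 0ʳ <ʳ x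
  ≤ʳ⇒<ʳ {x} {q} 0<q (mk≤ʳ p) = let N , h = p (q * ½) (0<half 0<q) in
    q * ½ , 0<half 0<q , N , λ n l → ≤-by
      (solve 2 (λ x q → (x :- con 0ℚ) :- q :* con ½ := (x :+ q :* con ½) :- q) refl (seq x n) q) (diff≥0 (h n l))

  ≤fromℕ : ∀ x → ∃[ k ] x ≤ʳ fromℕ k
  ≤fromℕ x =
    let B , 0<B , N , h = ~-bounded (cauchy x)
        k , B≤k = archimedean B
    in k , mk≤ʳ λ ε 0<ε → N , λ n l → ≤-trans (≤-trans (≤∣∣ (seq x n)) (≤-trans (h n l) B≤k))
      (≤-by (solve 2 (λ y e → (y :+ e) :- y := e) refl (ℕ→ℚ k) ε) (<⇒≤ 0<ε))

  exp-+ : ∀ x y → exp (x +ʳ y) ≃ʳ exp x *ʳ exp y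
  exp-+ x y = ~-sym (~-null (expSum-+ (~-bounded (cauchy x)) (~-bounded (cauchy y))) (cauchy (exp (x +ʳ y))))

  exp≥0 : ∀ x → 0ʳ ≤ʳ exp x
  exp≥0 x = <ʳ⇒≤ʳ {0ʳ} {exp x} (exp-positive x)

  1+≤expSum : ∀ {q} → 0ℚ ≤ q → ∀ n → 1ℚ + q ≤ expSum q (suc n)
  1+≤expSum {q} 0≤q zero = ≤-reflexive
    (solve 1 (λ q → con 1ℚ :+ q := con 1ℚ :+ con 1ℚ :* (q :* con 1ℚ)) refl q)
  1+≤expSum {q} 0≤q (suc n) = ≤-trans (1+≤expSum 0≤q n) (expSum-mono 0≤q {suc n} (ℕ.≤′-step ℕ.≤′-refl))

  -- The terms satisfy tₖ₊₁ ≤ q tₖ, so (1 − q) Σ tₖ telescopes.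
  expSum*[1-q]≤1 : ∀ {q} → 0ℚ ≤ q → ∀ n → expSum q n * (1ℚ - q) ≤ 1ℚ
  expSum*[1-q]≤1 {q} 0≤q n = ≤-by
    (solve 2 (λ a b → con 1ℚ :- a := (con 1ℚ :- (a :+ b)) :+ b) refl (expSum q n * (1ℚ - q)) (term q n * q))
    (+≥0 (diff≥0 (h n)) (*≥0 (term≥0 0≤q n) 0≤q))
    where
    h : ∀ n → expSum q n * (1ℚ - q) + term q n * q ≤ 1ℚ
    h zero = ≤-reflexive (solve 1 (λ q → con 1ℚ :* (con 1ℚ :- q) :+ con 1ℚ :* q := con 1ℚ) refl q)
    h (suc n) = ≤-trans
      (≤-by
        (solve 4 (λ s t q r →
            (s :* (con 1ℚ :- q) :+ t :* q) :- ((s :+ t :* (q :* r)) :* (con 1ℚ :- q) :+ t :* (q :* r) :* q) :=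
            (t :* q) :* (con 1ℚ :- r)) refl (expSum q n) (term q n) q (recip n))
        (*≥0 (*≥0 (term≥0 0≤q n) 0≤q) (diff≥0 (recip-antimono {0} {n} ℕ.z≤n))))
      (h n)

  -- The sign is decided for each rational approximation q. If q ≥ 0, the partial sum contains 1 +
  -- q. If q ≤ 0, its terms alternate, so the bound comes from exp(q) exp(-q) ≈ 1 and exp(-q)(1 + q)
  -- ≤ 1: were exp(q) + ε < 1 + q, the product would be at most 1 - ε.
  1+≤exp : ∀ x → 1ʳ +ʳ x ≤ʳ exp x
  1+≤exp x = mk≤ʳ λ ε 0<ε →
    let N , h = expSum-+ (~-bounded (cauchy x)) (~-bounded (cauchy (-ʳ x))) ε 0<ε
    -- A successor index ensures that the partial sum reaches the linear term.
    in suc N , λ { (suc n) l → case (suc n) n refl 0<ε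
      (h (suc n) (suc n) (ℕ.≤-trans (ℕ.n≤1+n N) l) (ℕ.≤-trans (ℕ.n≤1+n N) l)) }
    where
    case : ∀ {ε} m n → m ≡ suc n → 0ℚ < ε →
           ∣ expSum (seq x m) m * expSum (- seq x m) m - expSum (seq x m - seq x m) m ∣ < ε →
           1ℚ + seq x m ≤ expSum (seq x m) m + ε
    case {ε} m n refl 0<ε h with ≤-total 0ℚ (seq x m)
    ... | inj₁ 0≤q = ≤-trans (1+≤expSum 0≤q n)
      (≤-by (solve 2 (λ y e → (y :+ e) :- y := e) refl (expSum (seq x m) m) ε) (<⇒≤ 0<ε))
    ... | inj₂ q≤0 = ≮⇒≥ λ P+ε<1+q → <-irrefl refl (begin-strict
        1ℚ - ε
          <⟨ <-by {q = P * Q} {r = ε + (P * Q - 1ℚ)} (solve 2 (λ e p → p :- (con 1ℚ :- e) := e :+ (p :- con 1ℚ)) refl ε (P * Q))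
             (subst (0ℚ <_) (solve 2 (λ e p → e :- (con 1ℚ :- p) := e :+ (p :- con 1ℚ)) refl ε (P * Q))
               (diff>0 1-PQ<ε)) ⟩
        P * Q
          ≤⟨ *-monoʳ-≤-nonNeg Q {{nonNegative 0≤Q}} {P} {(1ℚ + q) - ε} (≤-by
               (solve 3 (λ p q e → ((con 1ℚ :+ q) :- e) :- p := (con 1ℚ :+ q) :- (p :+ e)) refl P q ε)
               (diff≥0 (<⇒≤ P+ε<1+q))) ⟩
        ((1ℚ + q) - ε) * Q
          ≡⟨ solve 3 (λ q e z → ((con 1ℚ :+ q) :- e) :* z := z :* (con 1ℚ :- (:- q)) :- e :* z) refl q ε Q ⟩
        Q * (1ℚ - (- q)) - ε * Q
          ≤⟨ +-mono-≤ (expSum*[1-q]≤1 0≤-q m) (neg-antimono-≤ (subst (_≤ ε * Q) (*-identityʳ ε)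
               (*-mono (<⇒≤ 0<ε) ≤-refl 0≤1 (expSum≥1 0≤-q m)))) ⟩
        1ℚ - ε ∎)
      where
      open ≤-Reasoning
      q = seq x m
      P = expSum q m
      Q = expSum (- q) m
      0≤-q : 0ℚ ≤ - q
      0≤-q = neg-antimono-≤ q≤0
      0≤Q : 0ℚ ≤ Q
      0≤Q = ≤-trans 0≤1 (expSum≥1 0≤-q m)
      1-PQ<ε : 1ℚ - P * Q < ε
      1-PQ<ε = ≤-<-trans
        (≤-reflexive (trans
          (cong (_- P * Q) (sym (trans (cong (λ z → expSum z m) (+-inverseʳ q)) (LogSeries.expSum-0 m))))
          (solve 2 (λ a b → a :- b := :- (b :- a)) refl (expSum (q - q) m) (P * Q))))
        (≤-<-trans (-≤∣∣ (P * Q - expSum (q - q) m)) h)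

  exp-0 : exp 0ʳ ≃ʳ 1ʳ
  exp-0 = ≃-pointwise {exp 0ʳ} {1ʳ} LogSeries.expSum-0

-- The ordered ring of reals, its ring solver, and the order laws of exp.

module RealField where

  open import Algebra.Bundles using (CommutativeRing)
  import Algebra.Solver.Ring as Ring
  import Algebra.Solver.Ring.AlmostCommutativeRing as ACR
  open import Data.Maybe using (just; nothing)
  open import Data.Product using (∃-syntax; _,_)
  open import Data.Rational
  open import Data.Rational.Properties
  open import Level using (0ℓ)
  open import Relation.Binary.PropositionalEquality using (_≡_; refl)
  open import Relation.Binary.Definitions using (WeaklyDecidable)
  open import Relation.Nullary using (yes; no)
  open Rationals
  open Sequences
  open ExpSeries using (~-exp)
  open RealOrder hiding (ev-map₂) public

  infix 4 _≈_

  -- The wrapper lets unification recover both reals; `_≃ʳ_` unfolds to a relation between bare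
  -- sequences and forgets the Cauchy proofs.
  record _≈_ (x y : ℝ) : Set where
    constructor mk≈
    field
      un≈ : x ≃ʳ y

  open _≈_ public

  -- Opaque copies: unfolding the operations makes unification compare Cauchy proofs.
  opaque

    infixl 6 _⊕_
    infixl 7 _⊗_
    infix  8 ⊝_

    _⊕_ _⊗_ : ℝ → ℝ → ℝ
    _⊕_ = _+ʳ_
    _⊗_ = _*ʳ_

    ⊝_ : ℝ → ℝ
    ⊝_ = -ʳ_

    ⟨_⟩ : ℚ → ℝ
    ⟨_⟩ = fromℚ

    E : ℝ → ℝ
    E = exp

  pointwise : ∀ x y → (∀ n → seq x n ≡ seq y n) → x ≈ y
  pointwise x y e = mk≈ (≃-pointwise {x} {y} e)

  opaque
    unfolding _⊕_

    ⊕-cong : ∀ {x y u v} → x ≈ y → u ≈ v → x ⊕ u ≈ y ⊕ v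
    ⊕-cong (mk≈ p) (mk≈ q) = mk≈ (~-+ p q)

    ⊗-cong : ∀ {x y u v} → x ≈ y → u ≈ v → x ⊗ u ≈ y ⊗ v
    ⊗-cong (mk≈ p) (mk≈ q) = mk≈ (~-* p q)

    ⊝-cong : ∀ {x y} → x ≈ y → ⊝ x ≈ ⊝ y
    ⊝-cong (mk≈ p) = mk≈ (~-neg p)

    E-cong : ∀ {x y} → x ≈ y → E x ≈ E y
    E-cong (mk≈ p) = mk≈ (~-exp p)

    ⊕-assoc : ∀ x y z → (x ⊕ y) ⊕ z ≈ x ⊕ (y ⊕ z)
    ⊕-assoc x y z = pointwise ((x ⊕ y) ⊕ z) (x ⊕ (y ⊕ z)) λ n → +-assoc (seq x n) (seq y n) (seq z n)

    ⊕-comm : ∀ x y → x ⊕ y ≈ y ⊕ x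
    ⊕-comm x y = pointwise (x ⊕ y) (y ⊕ x) λ n → +-comm (seq x n) (seq y n)

    ⊕-identityˡ : ∀ x → ⟨ 0ℚ ⟩ ⊕ x ≈ x
    ⊕-identityˡ x = pointwise (⟨ 0ℚ ⟩ ⊕ x) x λ n → +-identityˡ (seq x n)

    ⊕-identityʳ : ∀ x → x ⊕ ⟨ 0ℚ ⟩ ≈ x
    ⊕-identityʳ x = pointwise (x ⊕ ⟨ 0ℚ ⟩) x λ n → +-identityʳ (seq x n)

    ⊕-inverseˡ : ∀ x → ⊝ x ⊕ x ≈ ⟨ 0ℚ ⟩
    ⊕-inverseˡ x = pointwise (⊝ x ⊕ x) ⟨ 0ℚ ⟩ λ n → +-inverseˡ (seq x n)

    ⊕-inverseʳ : ∀ x → x ⊕ ⊝ x ≈ ⟨ 0ℚ ⟩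
    ⊕-inverseʳ x = pointwise (x ⊕ ⊝ x) ⟨ 0ℚ ⟩ λ n → +-inverseʳ (seq x n)

    ⊗-assoc : ∀ x y z → (x ⊗ y) ⊗ z ≈ x ⊗ (y ⊗ z)
    ⊗-assoc x y z = pointwise ((x ⊗ y) ⊗ z) (x ⊗ (y ⊗ z)) λ n → *-assoc (seq x n) (seq y n) (seq z n)

    ⊗-comm : ∀ x y → x ⊗ y ≈ y ⊗ x
    ⊗-comm x y = pointwise (x ⊗ y) (y ⊗ x) λ n → *-comm (seq x n) (seq y n)

    ⊗-identityˡ : ∀ x → ⟨ 1ℚ ⟩ ⊗ x ≈ x
    ⊗-identityˡ x = pointwise (⟨ 1ℚ ⟩ ⊗ x) x λ n → *-identityˡ (seq x n)

    ⊗-identityʳ : ∀ x → x ⊗ ⟨ 1ℚ ⟩ ≈ x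
    ⊗-identityʳ x = pointwise (x ⊗ ⟨ 1ℚ ⟩) x λ n → *-identityʳ (seq x n)

    ⊗-distribˡ-⊕ : ∀ x y z → x ⊗ (y ⊕ z) ≈ (x ⊗ y) ⊕ (x ⊗ z)
    ⊗-distribˡ-⊕ x y z = pointwise (x ⊗ (y ⊕ z)) ((x ⊗ y) ⊕ (x ⊗ z)) λ n → *-distribˡ-+ (seq x n) (seq y n) (seq z n)

    ⊗-distribʳ-⊕ : ∀ x y z → (y ⊕ z) ⊗ x ≈ (y ⊗ x) ⊕ (z ⊗ x)
    ⊗-distribʳ-⊕ x y z = pointwise ((y ⊕ z) ⊗ x) ((y ⊗ x) ⊕ (z ⊗ x)) λ n → *-distribʳ-+ (seq x n) (seq y n) (seq z n)

    ⟨+⟩ : ∀ p q → ⟨ p + q ⟩ ≈ ⟨ p ⟩ ⊕ ⟨ q ⟩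
    ⟨+⟩ p q = pointwise ⟨ p + q ⟩ (⟨ p ⟩ ⊕ ⟨ q ⟩) λ _ → refl

    ⟨*⟩ : ∀ p q → ⟨ p * q ⟩ ≈ ⟨ p ⟩ ⊗ ⟨ q ⟩
    ⟨*⟩ p q = pointwise ⟨ p * q ⟩ (⟨ p ⟩ ⊗ ⟨ q ⟩) λ _ → refl

    ⟨-⟩ : ∀ p → ⟨ - p ⟩ ≈ ⊝ ⟨ p ⟩
    ⟨-⟩ p = pointwise ⟨ - p ⟩ (⊝ ⟨ p ⟩) λ _ → refl

    E-⊕ : ∀ x y → E (x ⊕ y) ≈ E x ⊗ E y
    E-⊕ x y = mk≈ (exp-+ x y)

    E-0 : E ⟨ 0ℚ ⟩ ≈ ⟨ 1ℚ ⟩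
    E-0 = mk≈ exp-0

    E≥0 : ∀ x → ⟨ 0ℚ ⟩ ≤ʳ E x
    E≥0 = exp≥0

    1⊕≤E : ∀ x → ⟨ 1ℚ ⟩ ⊕ x ≤ʳ E x
    1⊕≤E = 1+≤exp

    ⟨⟩-mono : ∀ {p q} → p ≤ q → ⟨ p ⟩ ≤ʳ ⟨ q ⟩
    ⟨⟩-mono = fromℚ-mono

    ⟨⟩-cancel : ∀ {p q} → ⟨ p ⟩ ≤ʳ ⟨ q ⟩ → p ≤ q
    ⟨⟩-cancel = fromℚ-cancel

    ⊕-mono-≤ : ∀ {x y u v} → x ≤ʳ y → u ≤ʳ v → x ⊕ u ≤ʳ y ⊕ v
    ⊕-mono-≤ {x} {y} {u} {v} = +ʳ-mono-≤ {x} {y} {u} {v}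

    ⊗≥0 : ∀ {x y} → ⟨ 0ℚ ⟩ ≤ʳ x → ⟨ 0ℚ ⟩ ≤ʳ y → ⟨ 0ℚ ⟩ ≤ʳ x ⊗ y
    ⊗≥0 {x} {y} = *ʳ-nonNeg {x} {y}

    ≤⟨ℕ⟩ : ∀ x → ∃[ k ] x ≤ʳ ⟨ ℕ→ℚ k ⟩
    ≤⟨ℕ⟩ = ≤fromℕ

  ≈-refl : ∀ {x} → x ≈ x
  ≈-refl {x} = mk≈ (cauchy x)

  ≈-sym : ∀ {x y} → x ≈ y → y ≈ x
  ≈-sym (mk≈ p) = mk≈ (~-sym p)

  ≈-trans : ∀ {x y z} → x ≈ y → y ≈ z → x ≈ z
  ≈-trans (mk≈ p) (mk≈ q) = mk≈ (~-trans p q)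

  ≈⇒≤ : ∀ {x y} → x ≈ y → x ≤ʳ y
  ≈⇒≤ {x} {y} (mk≈ p) = ≃⇒≤ʳ {x} {y} p

  ring : CommutativeRing 0ℓ 0ℓ
  ring = record
    { Carrier = ℝ ; _≈_ = _≈_ ; _+_ = _⊕_ ; _*_ = _⊗_ ; -_ = ⊝_ ; 0# = ⟨ 0ℚ ⟩ ; 1# = ⟨ 1ℚ ⟩
    ; isCommutativeRing = record
      { *-comm = ⊗-comm
      ; isRing = record
        { *-cong = ⊗-cong ; *-assoc = ⊗-assoc ; *-identity = ⊗-identityˡ , ⊗-identityʳ
        ; distrib = ⊗-distribˡ-⊕ , ⊗-distribʳ-⊕
        ; +-isAbelianGroup = record
          { comm = ⊕-comm
          ; isGroup = record
            { inverse = ⊕-inverseˡ , ⊕-inverseʳ ; ⁻¹-cong = ⊝-cong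
            ; isMonoid = record
              { identity = ⊕-identityˡ , ⊕-identityʳ
              ; isSemigroup = record
                { assoc = ⊕-assoc
                ; isMagma = record
                  { ∙-cong = ⊕-cong
                  ; isEquivalence = record { refl = ≈-refl ; sym = ≈-sym ; trans = ≈-trans } } } } } } } } }

  ℚ⟶ℝ : CommutativeRing.rawRing +-*-commutativeRing ACR.-Raw-AlmostCommutative⟶ ACR.fromCommutativeRing ring
  ℚ⟶ℝ = record
    { ⟦_⟧ = ⟨_⟩ ; +-homo = ⟨+⟩ ; *-homo = ⟨*⟩ ; -‿homo = ⟨-⟩ ; 0-homo = ≈-refl ; 1-homo = ≈-refl }

  coefficient≟ : WeaklyDecidable (ACR.Induced-equivalence ℚ⟶ℝ)
  coefficient≟ p q with p ≟ q
  ... | yes refl = just ≈-refl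
  ... | no  _    = nothing

  module Solver = Ring (CommutativeRing.rawRing +-*-commutativeRing) (ACR.fromCommutativeRing ring) ℚ⟶ℝ coefficient≟
  open Solver

  -- Reduces an inequality between reals to a ring identity that names a non-negative remainder `r`.
  ≤-add : ∀ {x y r} → x ⊕ r ≈ y → ⟨ 0ℚ ⟩ ≤ʳ r → x ≤ʳ y
  ≤-add {x} {y} {r} e h = ≤ʳ-trans (≈⇒≤ (≈-sym (⊕-identityʳ x))) (≤ʳ-trans (⊕-mono-≤ (≤ʳ-refl {x}) h) (≈⇒≤ e))

  gap≥0 : ∀ {x y} → x ≤ʳ y → ⟨ 0ℚ ⟩ ≤ʳ y ⊕ ⊝ x
  gap≥0 {x} {y} h = ≤ʳ-trans (≈⇒≤ (≈-sym (⊕-inverseʳ x))) (⊕-mono-≤ h ≤ʳ-refl)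

  ⊕≥0 : ∀ {x y} → ⟨ 0ℚ ⟩ ≤ʳ x → ⟨ 0ℚ ⟩ ≤ʳ y → ⟨ 0ℚ ⟩ ≤ʳ x ⊕ y
  ⊕≥0 p q = ≤ʳ-trans (≈⇒≤ (≈-sym (⊕-identityˡ ⟨ 0ℚ ⟩))) (⊕-mono-≤ p q)

  ⊗-mono-≤ : ∀ {x y u v} → ⟨ 0ℚ ⟩ ≤ʳ x → x ≤ʳ y → ⟨ 0ℚ ⟩ ≤ʳ u → u ≤ʳ v → x ⊗ u ≤ʳ y ⊗ v
  ⊗-mono-≤ {x} {y} {u} {v} 0≤x x≤y 0≤u u≤v = ≤-add
    (solve 4 (λ x y u v → x :* u :+ ((y :- x) :* v :+ x :* (v :- u)) := y :* v) ≈-refl x y u v)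
    (⊕≥0 (⊗≥0 (gap≥0 x≤y) (≤ʳ-trans 0≤u u≤v)) (⊗≥0 0≤x (gap≥0 u≤v)))

  -- exp y = exp x · exp(y - x), and the second factor is at least 1 + (y - x) ≥ 1.
  E-mono : ∀ {x y} → x ≤ʳ y → E x ≤ʳ E y
  E-mono {x} {y} x≤y = ≤ʳ-trans (≈⇒≤ (≈-sym (⊗-identityʳ (E x))))
    (≤ʳ-trans
      (⊗-mono-≤ (E≥0 x) ≤ʳ-refl (⟨⟩-mono 0≤1)
        (≤ʳ-trans (≤-add ≈-refl (gap≥0 x≤y)) (1⊕≤E (y ⊕ ⊝ x))))
      (≈⇒≤ (≈-trans (≈-sym (E-⊕ x (y ⊕ ⊝ x)))
        (E-cong (solve 2 (λ x y → x :+ (y :- x) := y) ≈-refl x y)))))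

  -- 1 + (x - y) ≤ exp(x - y) = exp x · exp(-y) ≤ exp y · exp(-y) = 1. This does the work of
  -- monotonicity of the logarithm.
  E-cancel : ∀ {x y} → E x ≤ʳ E y → x ≤ʳ y
  E-cancel {x} {y} h = ≤-add {r = ⟨ 1ℚ ⟩ ⊕ ⊝ (⟨ 1ℚ ⟩ ⊕ (x ⊕ ⊝ y))}
    (solve 2 (λ x y → x :+ (con 1ℚ :- (con 1ℚ :+ (x :- y))) := y) ≈-refl x y)
    (gap≥0 (≤ʳ-trans (1⊕≤E (x ⊕ ⊝ y)) (≤ʳ-trans (≈⇒≤ (E-⊕ x (⊝ y)))
      (≤ʳ-trans (⊗-mono-≤ (E≥0 x) h (E≥0 (⊝ y)) ≤ʳ-refl)
        (≈⇒≤ (≈-trans (≈-sym (E-⊕ y (⊝ y))) (≈-trans (E-cong (⊕-inverseʳ y)) E-0)))))))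

-- Exponential bounds for products; numerical bounds for e and log 2; rounding.

module RealBounds where

  import Data.Integer as ℤ
  open import Data.List using (List; []; _∷_)
  open import Data.List.Relation.Unary.All using (All; []; _∷_)
  import Data.Nat.Properties as ℕ
  open import Data.Nat using (zero; suc; s≤s; z≤n)
  open import Data.Product using (∃-syntax; _×_; _,_; proj₁; proj₂)
  open import Data.Rational
  open import Data.Rational.Properties
  open import Data.Rational.Solver using (module +-*-Solver)
  open import Data.Sum using (_⊎_; inj₁; inj₂)
  open import Relation.Binary.PropositionalEquality using (_≡_; refl; subst; subst₂; sym)
  open import Relation.Nullary using (yes; no)
  open import Relation.Nullary.Decidable using (toWitness)
  open Rationals
  open Sequences
  open ExpSeries
  open RealField

  infixr 8 _^_

  _^_ : ℚ → ℕ → ℚ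
  q ^ zero  = 1ℚ
  q ^ suc n = q * q ^ n

  ^≥0 : ∀ {q} → 0ℚ ≤ q → ∀ n → 0ℚ ≤ q ^ n
  ^≥0 0≤q zero    = 0≤1
  ^≥0 0≤q (suc n) = *≥0 0≤q (^≥0 0≤q n)

  Σ[_] : List ℕ → (ℕ → ℚ) → ℚ
  Σ[ []     ] f = 0ℚ
  Σ[ p ∷ ps ] f = f p + Σ[ ps ] f

  Π[_] : List ℕ → (ℕ → ℚ) → ℚ
  Π[ []     ] f = 1ℚ
  Π[ p ∷ ps ] f = f p * Π[ ps ] f

  Π≥0 : ∀ {f ps} → All (λ p → 0ℚ ≤ f p) ps → 0ℚ ≤ Π[ ps ] f
  Π≥0 []       = 0≤1
  Π≥0 (h ∷ hs) = *≥0 h (Π≥0 hs)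

  ≤E* : ∀ {p q x y} → 0ℚ ≤ p → 0ℚ ≤ q → ⟨ p ⟩ ≤ʳ E x → ⟨ q ⟩ ≤ʳ E y → ⟨ p * q ⟩ ≤ʳ E (x ⊕ y)
  ≤E* {p} {q} {x} {y} 0≤p 0≤q hp hq = ≤ʳ-trans (≈⇒≤ (⟨*⟩ p q))
    (≤ʳ-trans (⊗-mono-≤ (⟨⟩-mono 0≤p) hp (⟨⟩-mono 0≤q) hq) (≈⇒≤ (≈-sym (E-⊕ x y))))

  1≤E0 : ⟨ 1ℚ ⟩ ≤ʳ E ⟨ 0ℚ ⟩
  1≤E0 = ≈⇒≤ (≈-sym E-0)

  ≤E-Π : ∀ {f y ps} → All (λ p → 0ℚ ≤ f p) ps → All (λ p → f p ≤ 1ℚ + y p) ps →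
         ⟨ Π[ ps ] f ⟩ ≤ʳ E ⟨ Σ[ ps ] y ⟩
  ≤E-Π [] [] = 1≤E0
  ≤E-Π {f} {y} {p ∷ ps} (0≤f ∷ 0≤fs) (h ∷ hs) = ≤ʳ-trans
    (≤E* 0≤f (Π≥0 0≤fs)
      (≤ʳ-trans (⟨⟩-mono h) (≤ʳ-trans (≈⇒≤ (⟨+⟩ 1ℚ (y p))) (1⊕≤E ⟨ y p ⟩))) (≤E-Π 0≤fs hs))
    (≈⇒≤ (E-cong (≈-sym (⟨+⟩ (y p) (Σ[ ps ] y)))))

  ≤E-^ : ∀ {q x} → 0ℚ ≤ q → ⟨ q ⟩ ≤ʳ E x → ∀ n → ⟨ q ^ n ⟩ ≤ʳ E (⟨ ℕ→ℚ n ⟩ ⊗ x)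
  ≤E-^ {q} {x} 0≤q h zero = ≤ʳ-trans 1≤E0 (≈⇒≤ (E-cong (solve 1 (λ x → con 0ℚ := con 0ℚ :* x) ≈-refl x)))
    where open Solver
  ≤E-^ {q} {x} 0≤q h (suc n) = ≤ʳ-trans (≤E* 0≤q (^≥0 0≤q n) h (≤E-^ 0≤q h n))
    (≈⇒≤ (E-cong (≈-trans (solve 2 (λ x k → x :+ k :* x := (con 1ℚ :+ k) :* x) ≈-refl x ⟨ ℕ→ℚ n ⟩)
      (⊗-cong (≈-trans (≈-sym (⟨+⟩ 1ℚ (ℕ→ℚ n))) (subst (λ z → ⟨ 1ℚ + ℕ→ℚ n ⟩ ≈ ⟨ z ⟩) (sym (ℕ→ℚ-suc n)) ≈-refl)) ≈-refl))))
    where open Solver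

  opaque
    unfolding _⊕_

    expSum≤E : ∀ {q} → 0ℚ ≤ q → ∀ m → ⟨ expSum q m ⟩ ≤ʳ E ⟨ q ⟩
    expSum≤E {q} 0≤q m = mk≤ʳ λ ε 0<ε → m , λ n l → ≤-trans (expSum-mono 0≤q (ℕ.≤⇒≤′ l))
      (≤-by (solve 2 (λ y e → (y :+ e) :- y := e) refl (expSum q n) ε) (<⇒≤ 0<ε))
      where open +-*-Solver

    E≤⟨⟩ : ∀ {q B} → Eventually (λ n → expSum q n ≤ B) → E ⟨ q ⟩ ≤ʳ ⟨ B ⟩
    E≤⟨⟩ {q} {B} (N , h) = mk≤ʳ λ ε 0<ε → N , λ n l → ≤-trans (h n l)
      (≤-by (solve 2 (λ y e → (y :+ e) :- y := e) refl B ε) (<⇒≤ 0<ε))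
      where open +-*-Solver

  e : ℝ
  e = E ⟨ 1ℚ ⟩

  -- From index 4 on, the partial sum plus its last term decreases.
  e≤11/4 : e ≤ʳ ⟨ ℤ.+ 11 / 4 ⟩
  e≤11/4 = E≤⟨⟩ (4 , λ n l → ≤-trans
      (≤-by (solve 2 (λ s t → (s :+ t) :- s := t) refl (expSum 1ℚ n) (term 1ℚ n)) (term≥0 0≤1 n)) (h (ℕ.≤⇒≤′ l)))
    where
    open +-*-Solver
    h : ∀ {n} → 4 ℕ.≤′ n → expSum 1ℚ n + term 1ℚ n ≤ ℤ.+ 11 / 4
    -- At index 4 the value is 65/24 + 1/24, which is exactly 11/4.
    h ℕ.≤′-refl = ≤-refl
    h {suc n} (ℕ.≤′-step l) = ≤-trans
      (≤-by
        (solve 3 (λ s t r → (s :+ t) :- ((s :+ t :* (con 1ℚ :* r)) :+ t :* (con 1ℚ :* r)) := t :* (con 1ℚ :- (r :+ r))) refl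
          (expSum 1ℚ n) (term 1ℚ n) (recip n))
        (*≥0 (term≥0 0≤1 n) (diff≥0 (+-mono-≤ r≤½ r≤½))))
      (h l)
      where
      r≤½ : recip n ≤ ½
      r≤½ = recip-antimono {1} (ℕ.≤-trans (s≤s z≤n) (ℕ.≤′⇒≤ l))

  2≤e : ⟨ ℤ.+ 2 / 1 ⟩ ≤ʳ e
  2≤e = ≤ʳ-trans (≈⇒≤ (⟨+⟩ 1ℚ 1ℚ)) (1⊕≤E ⟨ 1ℚ ⟩)

  -- Since exp(-½) ≥ 1 - ½, multiplying by exp ½ gives ½ exp ½ ≤ 1.
  E½≤2 : E ⟨ ½ ⟩ ≤ʳ ⟨ ℤ.+ 2 / 1 ⟩
  E½≤2 = ≤-add {r = ⟨ ℤ.+ 2 / 1 ⟩ ⊗ (⟨ 1ℚ ⟩ ⊕ ⊝ (E ⟨ ½ ⟩ ⊗ ⟨ ½ ⟩))}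
    (solve 1 (λ x → x :+ con (ℤ.+ 2 / 1) :* (con 1ℚ :- x :* con ½) := con (ℤ.+ 2 / 1)) ≈-refl (E ⟨ ½ ⟩))
    (⊗≥0 (⟨⟩-mono (nonNegative⁻¹ (ℤ.+ 2 / 1))) (gap≥0
      (≤ʳ-trans (⊗-mono-≤ (E≥0 ⟨ ½ ⟩) ≤ʳ-refl (⟨⟩-mono (nonNegative⁻¹ ½))
          (≤ʳ-trans (≈⇒≤ (⟨+⟩ 1ℚ -½)) (1⊕≤E ⟨ -½ ⟩)))
        (≈⇒≤ (≈-trans (≈-sym (E-⊕ ⟨ ½ ⟩ ⟨ -½ ⟩)) (≈-trans (E-cong (≈-sym (⟨+⟩ ½ -½))) E-0))))))
    where open Solver

  E2≤16 : E ⟨ ℤ.+ 2 / 1 ⟩ ≤ʳ ⟨ ℤ.+ 16 / 1 ⟩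
  E2≤16 = ≤ʳ-trans (≈⇒≤ (double 1ℚ)) (≤ʳ-trans (square E1≤4) (≈⇒≤ (≈-sym (⟨*⟩ (ℤ.+ 4 / 1) (ℤ.+ 4 / 1)))))
    where
    double : ∀ q → E ⟨ q + q ⟩ ≈ E ⟨ q ⟩ ⊗ E ⟨ q ⟩
    double q = ≈-trans (E-cong (⟨+⟩ q q)) (E-⊕ ⟨ q ⟩ ⟨ q ⟩)
    square : ∀ {q b} → E ⟨ q ⟩ ≤ʳ b → E ⟨ q ⟩ ⊗ E ⟨ q ⟩ ≤ʳ b ⊗ b
    square {q} h = ⊗-mono-≤ (E≥0 ⟨ q ⟩) h (E≥0 ⟨ q ⟩) h
    E1≤4 : E ⟨ 1ℚ ⟩ ≤ʳ ⟨ ℤ.+ 4 / 1 ⟩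
    E1≤4 = ≤ʳ-trans (≈⇒≤ (double ½)) (≤ʳ-trans (square E½≤2) (≈⇒≤ (≈-sym (⟨*⟩ (ℤ.+ 2 / 1) (ℤ.+ 2 / 1)))))

  log2 : ℝ
  log2 = log (fromℕ 2) (fromℕ-positive 2)

  opaque
    unfolding _⊕_

    E-log : ∀ x 0<x → E (log x 0<x) ≈ x
    E-log x 0<x = mk≈ (exp-log x 0<x)

    fromℕ≡ : ∀ k → fromℕ k ≡ ⟨ ℕ→ℚ k ⟩
    fromℕ≡ k = refl

  E-log2 : E log2 ≈ ⟨ ℕ→ℚ 2 ⟩
  E-log2 = subst (E log2 ≈_) (fromℕ≡ 2) (E-log (fromℕ 2) (fromℕ-positive 2))

  α′ : ℝ
  α′ = ⟨ 1ℚ ⟩ ⊕ ⊝ ((⟨ ½ ⟩ ⊗ e) ⊗ log2)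

  opaque
    unfolding _⊕_

    α≈ : α ≈ α′
    α≈ = pointwise α α′ λ _ → refl

  0≤log2 : ⟨ 0ℚ ⟩ ≤ʳ log2
  0≤log2 = E-cancel (≤ʳ-trans (≈⇒≤ E-0) (≤ʳ-trans (⟨⟩-mono (toWitness {a? = 1ℚ ≤? ℤ.+ 2 / 1} _)) (≈⇒≤ (≈-sym E-log2))))

  -- 8/11 is 2 divided by 11/4, just what e log 2 ≤ 2 requires beside `e≤11/4`. The cubic partial
  -- sum of exp(8/11) already exceeds 2.
  log2≤8/11 : log2 ≤ʳ ⟨ ℤ.+ 8 / 11 ⟩
  log2≤8/11 = E-cancel (≤ʳ-trans (≈⇒≤ E-log2) (≤ʳ-trans
    (⟨⟩-mono (toWitness {a? = ℤ.+ 2 / 1 ≤? expSum (ℤ.+ 8 / 11) 3} _))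
    (expSum≤E (nonNegative⁻¹ (ℤ.+ 8 / 11)) 3)))

  e·log2≤2 : e ⊗ log2 ≤ʳ ⟨ ℤ.+ 2 / 1 ⟩
  e·log2≤2 = ≤ʳ-trans (⊗-mono-≤ (E≥0 ⟨ 1ℚ ⟩) e≤11/4 0≤log2 log2≤8/11)
    (≈⇒≤ (≈-sym (⟨*⟩ (ℤ.+ 11 / 4) (ℤ.+ 8 / 11))))

  -- The sign of the exponent is what turns an upper bound for log log log n into an upper bound for
  -- the power of log log n.
  0≤α′ : ⟨ 0ℚ ⟩ ≤ʳ α′
  0≤α′ = ≤-add {r = ⟨ ½ ⟩ ⊗ (⟨ ℤ.+ 2 / 1 ⟩ ⊕ ⊝ (e ⊗ log2))}
    (solve 2 (λ e l → con 0ℚ :+ con ½ :* (con (ℤ.+ 2 / 1) :- e :* l) := con 1ℚ :- (con ½ :* e) :* l) ≈-refl e log2)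
    (⊗≥0 (⟨⟩-mono (nonNegative⁻¹ ½)) (gap≥0 e·log2≤2))
    where open Solver

  α′≤1 : α′ ≤ʳ ⟨ 1ℚ ⟩
  α′≤1 = ≤-add {r = (⟨ ½ ⟩ ⊗ e) ⊗ log2}
    (solve 2 (λ e l → (con 1ℚ :- (con ½ :* e) :* l) :+ (con ½ :* e) :* l := con 1ℚ) ≈-refl e log2)
    (⊗≥0 (⊗≥0 (⟨⟩-mono (nonNegative⁻¹ ½)) (E≥0 ⟨ 1ℚ ⟩)) 0≤log2)
    where open Solver

  ceiling-ℕ : ∀ q → ∃[ k ] q ≤ ℕ→ℚ k × (k ≡ 0 ⊎ ℕ→ℚ k ≤ q + 1ℚ)
  ceiling-ℕ q = descend (proj₁ (archimedean q)) (proj₂ (archimedean q))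
    where
    descend : ∀ j → q ≤ ℕ→ℚ j → ∃[ k ] q ≤ ℕ→ℚ k × (k ≡ 0 ⊎ ℕ→ℚ k ≤ q + 1ℚ)
    descend zero    h = 0 , h , inj₁ refl
    descend (suc j) h with q ≤? ℕ→ℚ j
    ... | yes l = descend j l
    ... | no ¬l = suc j , h , inj₂ (subst₂ _≤_ (sym (ℕ→ℚ-suc j)) (+-comm 1ℚ q) (+-monoʳ-≤ 1ℚ (<⇒≤ (≰⇒> ¬l))))

  opaque
    unfolding _⊕_

    -- For want of a computable ceiling, q + ½ is rounded up for a rational q within ½ of x. The two
    -- halves and the rounding add up to 2; if the result is 0, the upper bound holds because x ≥ 0.
    ≤ceiling≤ : ∀ x → ⟨ 0ℚ ⟩ ≤ʳ x → ∃[ k ] x ≤ʳ ⟨ ℕ→ℚ k ⟩ × ⟨ ℕ→ℚ k ⟩ ≤ʳ x ⊕ ⟨ ℤ.+ 2 / 1 ⟩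
    ≤ceiling≤ x 0≤x =
      let N , close = difference (cauchy x) ½ (positive⁻¹ ½)
          q = seq x N
          k , q+½≤k , upper = ceiling-ℕ (q + ½)
          x≤k : x ≤ʳ ⟨ ℕ→ℚ k ⟩
          x≤k = mk≤ʳ λ ε 0<ε → N , λ n l → ≤-trans
            (≤-trans (≤-by {r = ½ - (seq x n - q)} (solve 2 (λ x q → (q :+ con ½) :- x := con ½ :- (x :- q)) refl (seq x n) q)
                (diff≥0 (≤-trans (≤∣∣ (seq x n - q)) (<⇒≤ (close n N l ℕ.≤-refl))))) q+½≤k)
            (≤-by (solve 2 (λ y e → (y :+ e) :- y := e) refl (ℕ→ℚ k) ε) (<⇒≤ 0<ε))
          k≤x+2 : k ≡ 0 ⊎ ℕ→ℚ k ≤ (q + ½) + 1ℚ → ⟨ ℕ→ℚ k ⟩ ≤ʳ x ⊕ ⟨ ℤ.+ 2 / 1 ⟩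
          k≤x+2 = λ
            { (inj₁ k≡0) → subst (λ z → ⟨ ℕ→ℚ z ⟩ ≤ʳ x ⊕ ⟨ ℤ.+ 2 / 1 ⟩) (sym k≡0)
                (≤ʳ-trans {y = x} 0≤x (≤ʳ-pointwise {x} λ n → ≤-by {r = ℤ.+ 2 / 1}
                  (solve 1 (λ x → (x :+ con (ℤ.+ 2 / 1)) :- x := con (ℤ.+ 2 / 1)) refl (seq x n)) (nonNegative⁻¹ (ℤ.+ 2 / 1))))
            ; (inj₂ k≤) → mk≤ʳ λ ε 0<ε → N , λ n l → ≤-trans k≤ (≤-by
                (solve 3 (λ x q e → ((x :+ con (ℤ.+ 2 / 1)) :+ e) :- ((q :+ con ½) :+ con 1ℚ) := (con ½ :- (q :- x)) :+ e) refl (seq x n) q ε)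
                (+≥0 (diff≥0 (≤-trans (≤∣∣ (q - seq x n)) (<⇒≤ (close N n ℕ.≤-refl l)))) (<⇒≤ 0<ε))) }
      in k , x≤k , k≤x+2 upper
      where
      open +-*-Solver
      open RealOrder

-- Balancing the two tails; log log log n against μ; the passage to a strict bound.

module Estimates where

  import Data.Integer as ℤ
  import Data.Nat.Properties as ℕ
  open import Data.Product using (_,_; proj₁)
  open import Data.Rational
  open import Data.Rational.Properties
  open import Data.Rational.Solver using (module +-*-Solver)
  open import Relation.Binary.PropositionalEquality using (_≡_; refl; cong; subst; trans)
  open import Relation.Nullary.Decidable using (toWitness)
  open Rationals
  open Sequences
  open RealOrder using (0<half; ≤ʳ⇒<ʳ)
  open RealField
  open RealBounds

  ¼ : ℚ
  ¼ = ℤ.+ 1 / 4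

  module _ {μ iκ : ℚ} (k : ℕ)
    (0≤μ : 0ℚ ≤ μ) (0≤iκ : 0ℚ ≤ iκ) (iκ-inv : ℕ→ℚ k * iκ ≡ 1ℚ)
    (lower : ⟨ μ * ¼ ⟩ ⊗ e ≤ʳ ⟨ ℕ→ℚ k ⟩) where

    private
      κ z⁻¹ : ℚ
      κ = ℕ→ℚ k
      z⁻¹ = μ * iκ

      0≤z⁻¹ : 0ℚ ≤ z⁻¹
      0≤z⁻¹ = *≥0 0≤μ 0≤iκ

      X₁ X₂ : ℝ
      X₁ = (log2 ⊕ log2) ⊕ ⟨ - 1ℚ ⟩
      X₂ = log2 ⊕ ⟨ - 1ℚ ⟩

    -- `lower` says μe ≤ 4k, so μ/k ≤ 4/e = exp(2 log 2 - 1). In exponential form the k-th power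
    -- merely multiplies the exponent by k.
    z⁻¹≤ : ⟨ z⁻¹ ⟩ ≤ʳ E X₁
    z⁻¹≤ = ≤ʳ-trans (≈⇒≤ split) (≤ʳ-trans
      (⊗-mono-≤ (⊗≥0 (⟨⟩-mono (*≥0 (nonNegative⁻¹ (ℤ.+ 4 / 1)) 0≤iκ)) (⊗≥0 (⟨⟩-mono (*≥0 0≤μ (nonNegative⁻¹ ¼))) (E≥0 ⟨ 1ℚ ⟩)))
        (⊗-mono-≤ (⟨⟩-mono 0≤4iκ) ≤ʳ-refl (⊗≥0 (⟨⟩-mono (*≥0 0≤μ (nonNegative⁻¹ ¼))) (E≥0 ⟨ 1ℚ ⟩)) lower)
        (E≥0 ⟨ - 1ℚ ⟩) ≤ʳ-refl)
      (≈⇒≤ (≈-trans (⊗-cong four ≈-refl) (≈-sym (≈-trans (E-⊕ (log2 ⊕ log2) ⟨ - 1ℚ ⟩) (⊗-cong (E-⊕ log2 log2) ≈-refl))))))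
      where
      open Solver
      0≤4iκ : 0ℚ ≤ ℤ.+ 4 / 1 * iκ
      0≤4iκ = *≥0 (nonNegative⁻¹ (ℤ.+ 4 / 1)) 0≤iκ
      e-inv : e ⊗ E ⟨ - 1ℚ ⟩ ≈ ⟨ 1ℚ ⟩
      e-inv = ≈-trans (≈-sym (E-⊕ ⟨ 1ℚ ⟩ ⟨ - 1ℚ ⟩)) (≈-trans (E-cong (≈-sym (⟨+⟩ 1ℚ (- 1ℚ)))) E-0)
      split : ⟨ z⁻¹ ⟩ ≈ (⟨ ℤ.+ 4 / 1 * iκ ⟩ ⊗ (⟨ μ * ¼ ⟩ ⊗ e)) ⊗ E ⟨ - 1ℚ ⟩
      split = ≈-trans
        (subst (λ q → ⟨ z⁻¹ ⟩ ≈ ⟨ q ⟩) (rational μ iκ) ≈-refl)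
        (≈-trans (⟨*⟩ (ℤ.+ 4 / 1 * iκ) (μ * ¼)) (≈-trans (≈-sym (⊗-identityʳ (⟨ ℤ.+ 4 / 1 * iκ ⟩ ⊗ ⟨ μ * ¼ ⟩)))
          (≈-trans (⊗-cong ≈-refl (≈-sym e-inv))
            (solve 4 (λ a b c d → (a :* b) :* (c :* d) := (a :* (b :* c)) :* d) ≈-refl ⟨ ℤ.+ 4 / 1 * iκ ⟩ ⟨ μ * ¼ ⟩ e (E ⟨ - 1ℚ ⟩)))))
        where
        rational : ∀ m i → m * i ≡ (ℤ.+ 4 / 1 * i) * (m * ¼)
        rational = +-*-Solver.solve 2 (λ m i → m +-*-Solver.:* i +-*-Solver.:=
          (+-*-Solver.con (ℤ.+ 4 / 1) +-*-Solver.:* i) +-*-Solver.:* (m +-*-Solver.:* +-*-Solver.con ¼)) refl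
      four : ⟨ ℤ.+ 4 / 1 * iκ ⟩ ⊗ ⟨ κ ⟩ ≈ E log2 ⊗ E log2
      four = ≈-trans (≈-sym (⟨*⟩ (ℤ.+ 4 / 1 * iκ) κ))
        (≈-trans (subst (λ q → ⟨ ℤ.+ 4 / 1 * iκ * κ ⟩ ≈ ⟨ q ⟩)
            (trans (*-assoc (ℤ.+ 4 / 1) iκ κ) (cong (ℤ.+ 4 / 1 *_) (trans (*-comm iκ κ) iκ-inv))) ≈-refl)
          (≈-trans (⟨*⟩ (ℤ.+ 2 / 1) (ℤ.+ 2 / 1)) (⊗-cong (≈-sym E-log2) (≈-sym E-log2))))

    ½z⁻¹≤ : ⟨ ½ * z⁻¹ ⟩ ≤ʳ E X₂
    ½z⁻¹≤ = ≤ʳ-trans (≈⇒≤ (⟨*⟩ ½ z⁻¹)) (≤ʳ-trans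
      (⊗-mono-≤ (⟨⟩-mono (nonNegative⁻¹ ½)) ≤ʳ-refl (⟨⟩-mono 0≤z⁻¹) z⁻¹≤)
      (≈⇒≤ (≈-trans (⊗-cong (≈-refl {⟨ ½ ⟩}) (≈-trans
          (E-cong (solve 2 (λ l m → (l :+ l) :+ m := l :+ (l :+ m)) ≈-refl log2 ⟨ - 1ℚ ⟩))
          (≈-trans (E-⊕ log2 X₂) (⊗-cong E-log2 ≈-refl))))
        (solve 1 (λ x → con ½ :* (con (ℤ.+ 2 / 1) :* x) := x) ≈-refl (E X₂)))))
      where open Solver

    module _ {Λ} (upper : ⟨ κ ⟩ ≤ʳ ⟨ μ * ¼ ⟩ ⊗ e ⊕ ⟨ ℤ.+ 2 / 1 ⟩) (Λ≤ : Λ ≤ʳ ⟨ μ + ℤ.+ 5 / 1 ⟩) where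

      private
        M K Y : ℝ
        M = ⟨ μ ⟩
        K = ⟨ κ ⟩
        Y = ((K ⊗ log2 ⊕ K ⊗ log2) ⊕ ⊝ M) ⊕ ⟨ ℤ.+ 3 / 1 ⟩

      -- Inserting k ≤ μe/4 + 2 turns 2k log 2 - μ into at most -αμ + 4 log 2, and αΛ is at most αμ
      -- + 5α. The terms in μ cancel, leaving 4 log 2 + 3 + 5α ≤ 4 + 3 + 5.
      exponent≤ : Y ⊕ α′ ⊗ Λ ≤ʳ ⟨ ℤ.+ 12 / 1 ⟩
      exponent≤ = ≤-add
        (solve 5 (λ e l K M L →
            let a = con 1ℚ :- (con ½ :* e) :* l in
            ((((K :* l :+ K :* l) :- M) :+ con (ℤ.+ 3 / 1)) :+ a :* L) :+
              ((((con (ℤ.+ 2 / 1) :* l) :* (((M :* con ¼) :* e :+ con (ℤ.+ 2 / 1)) :- K) :+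
                con (ℤ.+ 4 / 1) :* (con 1ℚ :- l)) :+
                con (ℤ.+ 5 / 1) :* (con 1ℚ :- a)) :+
                a :* ((M :+ con (ℤ.+ 5 / 1)) :- L))
            := con (ℤ.+ 12 / 1)) ≈-refl e log2 K M Λ)
        (⊕≥0 (⊕≥0 (⊕≥0
          (⊗≥0 (⊗≥0 (⟨⟩-mono (nonNegative⁻¹ (ℤ.+ 2 / 1))) 0≤log2)
            (gap≥0 (≤ʳ-trans upper (≈⇒≤ (⊕-cong (⊗-cong (⟨*⟩ μ ¼) ≈-refl) ≈-refl)))))
          (⊗≥0 (⟨⟩-mono (nonNegative⁻¹ (ℤ.+ 4 / 1)))
            (gap≥0 (≤ʳ-trans log2≤8/11 (⟨⟩-mono (toWitness {a? = ℤ.+ 8 / 11 ≤? 1ℚ} _))))))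
          (⊗≥0 (⟨⟩-mono (nonNegative⁻¹ (ℤ.+ 5 / 1))) (gap≥0 α′≤1)))
          (⊗≥0 0≤α′ (gap≥0 (≤ʳ-trans Λ≤ (≈⇒≤ (⟨+⟩ μ (ℤ.+ 5 / 1)))))))
        where open Solver

      -- The balance: k(2 log 2 - 1) + (k - μ) and 2k(log 2 - 1) + (2k - μ) both equal 2k log 2 - μ,
      -- so one exponent serves both tails. With Λ = log log log n the factor E(α′ ⊗ Λ) is the power
      -- of log log n in the theorem.
      tails≤ : ∀ {d A₁ A₂} → 0ℚ ≤ A₁ → ⟨ A₁ ⟩ ≤ʳ E ⟨ κ - μ ⟩ → 0ℚ ≤ A₂ → ⟨ A₂ ⟩ ≤ʳ E ⟨ ((κ + κ) - μ) + ℤ.+ 3 / 1 ⟩ →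
               d ≤ z⁻¹ ^ k * A₁ + ((½ * z⁻¹) ^ k * (½ * z⁻¹) ^ k) * A₂ →
               ⟨ d ⟩ ⊗ E (α′ ⊗ Λ) ≤ʳ ⟨ ℤ.+ 2 / 1 ⟩ ⊗ E ⟨ ℤ.+ 12 / 1 ⟩
      tails≤ {d} {A₁} {A₂} 0≤A₁ hA₁ 0≤A₂ hA₂ hd = ≤ʳ-trans
        (≤-add {r = (⟨ q₁ + q₂ ⟩ ⊕ ⊝ ⟨ d ⟩) ⊗ E (α′ ⊗ Λ)}
          (≈-trans (⊕-cong ≈-refl (⊗-cong (⊕-cong (⟨+⟩ q₁ q₂) ≈-refl) ≈-refl))
            (solve 4 (λ d p q E → d :* E :+ ((p :+ q) :- d) :* E := p :* E :+ q :* E) ≈-refl ⟨ d ⟩ ⟨ q₁ ⟩ ⟨ q₂ ⟩ (E (α′ ⊗ Λ))))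
          (⊗≥0 (gap≥0 (⟨⟩-mono hd)) (E≥0 (α′ ⊗ Λ))))
        (≤ʳ-trans (⊕-mono-≤ (weigh Y₁≤Y hq₁) (weigh Y₂≤Y hq₂))
          (≈⇒≤ (solve 1 (λ x → x :+ x := con (ℤ.+ 2 / 1) :* x) ≈-refl (E ⟨ ℤ.+ 12 / 1 ⟩))))
        where
        open Solver
        q₁ q₂ : ℚ
        q₁ = z⁻¹ ^ k * A₁
        q₂ = ((½ * z⁻¹) ^ k * (½ * z⁻¹) ^ k) * A₂
        0≤½z⁻¹ : 0ℚ ≤ ½ * z⁻¹
        0≤½z⁻¹ = *≥0 (nonNegative⁻¹ ½) 0≤z⁻¹
        Y₁ Y₂ : ℝ
        Y₁ = K ⊗ X₁ ⊕ ⟨ κ - μ ⟩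
        Y₂ = (K ⊗ X₂ ⊕ K ⊗ X₂) ⊕ ⟨ ((κ + κ) - μ) + ℤ.+ 3 / 1 ⟩
        hq₁ : ⟨ q₁ ⟩ ≤ʳ E Y₁
        hq₁ = ≤E* (^≥0 0≤z⁻¹ k) 0≤A₁ (≤E-^ 0≤z⁻¹ z⁻¹≤ k) hA₁
        hq₂ : ⟨ q₂ ⟩ ≤ʳ E Y₂
        hq₂ = ≤E* (*≥0 (^≥0 0≤½z⁻¹ k) (^≥0 0≤½z⁻¹ k)) 0≤A₂
          (≤E* (^≥0 0≤½z⁻¹ k) (^≥0 0≤½z⁻¹ k) (≤E-^ 0≤½z⁻¹ ½z⁻¹≤ k) (≤E-^ 0≤½z⁻¹ ½z⁻¹≤ k)) hA₂
        κ-μ : ⟨ κ - μ ⟩ ≈ K ⊕ ⊝ M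
        κ-μ = ≈-trans (⟨+⟩ κ (- μ)) (⊕-cong ≈-refl (⟨-⟩ μ))
        Y₁≤Y : Y₁ ≤ʳ Y
        Y₁≤Y = ≤-add {r = ⟨ ℤ.+ 3 / 1 ⟩}
          (≈-trans (⊕-cong (⊕-cong ≈-refl κ-μ) ≈-refl)
            (solve 3 (λ K M l → ((K :* ((l :+ l) :+ con (- 1ℚ))) :+ (K :- M)) :+ con (ℤ.+ 3 / 1)
                := ((K :* l :+ K :* l) :- M) :+ con (ℤ.+ 3 / 1)) ≈-refl K M log2))
          (⟨⟩-mono (nonNegative⁻¹ (ℤ.+ 3 / 1)))
        Y₂≤Y : Y₂ ≤ʳ Y
        Y₂≤Y = ≈⇒≤ (≈-trans
          (⊕-cong ≈-refl (≈-trans (⟨+⟩ ((κ + κ) - μ) (ℤ.+ 3 / 1))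
            (⊕-cong (≈-trans (⟨+⟩ (κ + κ) (- μ)) (⊕-cong (⟨+⟩ κ κ) (⟨-⟩ μ))) ≈-refl)))
          (solve 3 (λ K M l → (K :* (l :+ con (- 1ℚ)) :+ K :* (l :+ con (- 1ℚ))) :+ (((K :+ K) :- M) :+ con (ℤ.+ 3 / 1))
              := ((K :* l :+ K :* l) :- M) :+ con (ℤ.+ 3 / 1)) ≈-refl K M log2))
        weigh : ∀ {q X} → X ≤ʳ Y → ⟨ q ⟩ ≤ʳ E X → ⟨ q ⟩ ⊗ E (α′ ⊗ Λ) ≤ʳ E ⟨ ℤ.+ 12 / 1 ⟩
        weigh {q} {X} X≤Y h = ≤ʳ-trans
          (≤-add {r = (E X ⊕ ⊝ ⟨ q ⟩) ⊗ E (α′ ⊗ Λ)}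
            (solve 3 (λ q X E → q :* E :+ (X :- q) :* E := X :* E) ≈-refl ⟨ q ⟩ (E X) (E (α′ ⊗ Λ)))
            (⊗≥0 (gap≥0 h) (E≥0 (α′ ⊗ Λ))))
          (≤ʳ-trans (≈⇒≤ (≈-sym (E-⊕ X (α′ ⊗ Λ)))) (E-mono (≤ʳ-trans (⊕-mono-≤ X≤Y ≤ʳ-refl) exponent≤)))

  -- log n ≤ y⁴, hence log log n ≤ 4 log y ≤ 4H. The factor 4 is absorbed by exp 3 ≥ 1 + 3, and with
  -- exp(μ + 2) ≥ H this makes the 5.
  logloglog≤ : ∀ {n y H μ L₁ L₂ L₃} → 0ℚ ≤ y → 0ℚ ≤ H →
               ⟨ n ⟩ ≤ʳ E ⟨ (y * y) * (y * y) ⟩ → ⟨ y ⟩ ≤ʳ E ⟨ H ⟩ → ⟨ H ⟩ ≤ʳ E ⟨ μ + ℤ.+ 2 / 1 ⟩ →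
               E L₁ ≈ ⟨ n ⟩ → E L₂ ≈ L₁ → E L₃ ≈ L₂ → L₃ ≤ʳ ⟨ μ + ℤ.+ 5 / 1 ⟩
  logloglog≤ {n} {y} {H} {μ} {L₁} {L₂} {L₃} 0≤y 0≤H hn hy hH e₁ e₂ e₃ = E-cancel
    (≤ʳ-trans (≈⇒≤ e₃) (≤ʳ-trans L₂≤ (≤ʳ-trans 4H≤
      (≈⇒≤ (E-cong (≈-trans (≈-sym (⟨+⟩ (ℤ.+ 3 / 1) (μ + ℤ.+ 2 / 1)))
        (subst (λ q → ⟨ ℤ.+ 3 / 1 + (μ + ℤ.+ 2 / 1) ⟩ ≈ ⟨ q ⟩) (shift μ) ≈-refl)))))))
    where
    open +-*-Solver
    shift : ∀ μ → ℤ.+ 3 / 1 + (μ + ℤ.+ 2 / 1) ≡ μ + ℤ.+ 5 / 1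
    shift = solve 1 (λ m → con (ℤ.+ 3 / 1) :+ (m :+ con (ℤ.+ 2 / 1)) := m :+ con (ℤ.+ 5 / 1)) refl
    L₁≤ : L₁ ≤ʳ ⟨ (y * y) * (y * y) ⟩
    L₁≤ = E-cancel (≤ʳ-trans (≈⇒≤ e₁) hn)
    y²≤ : ⟨ y * y ⟩ ≤ʳ E (⟨ H ⟩ ⊕ ⟨ H ⟩)
    y²≤ = ≤E* 0≤y 0≤y hy hy
    L₂≤ : L₂ ≤ʳ ⟨ ℤ.+ 4 / 1 * H ⟩
    L₂≤ = E-cancel (≤ʳ-trans (≈⇒≤ e₂) (≤ʳ-trans L₁≤ (≤ʳ-trans (≤E* (*≥0 0≤y 0≤y) (*≥0 0≤y 0≤y) y²≤ y²≤)
      (≈⇒≤ (E-cong (≈-trans (Solver.solve 1 (λ h → (h Solver.:+ h) Solver.:+ (h Solver.:+ h) Solver.:= Solver.con (ℤ.+ 4 / 1) Solver.:* h) ≈-refl ⟨ H ⟩)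
        (≈-sym (⟨*⟩ (ℤ.+ 4 / 1) H))))))))
    4H≤ : ⟨ ℤ.+ 4 / 1 * H ⟩ ≤ʳ E (⟨ ℤ.+ 3 / 1 ⟩ ⊕ ⟨ μ + ℤ.+ 2 / 1 ⟩)
    4H≤ = ≤E* (nonNegative⁻¹ (ℤ.+ 4 / 1)) 0≤H (≤ʳ-trans (≈⇒≤ (⟨+⟩ 1ℚ (ℤ.+ 3 / 1))) (1⊕≤E ⟨ ℤ.+ 3 / 1 ⟩)) hH

  -- Strictness: replacing K by K + 1 gains 1/P, which is bounded away from 0 since P is bounded.
  conclude : ∀ {D K} P 0<P → fromℚ (1ℚ - D) *ʳ P ≤ʳ fromℚ K →
             1ʳ -ʳ quotient (fromℚ (K + 1ℚ)) P 0<P <ʳ fromℚ D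
  conclude {D} {K} P 0<P (mk≤ʳ h) =
    let B , 0<B , N₁ , hB = ~-bounded (cauchy P)
        δ , 0<δ , N₂ , hδ = eventuallyPositive P 0<P
        N₃ , hK = h ½ (positive⁻¹ ½)
    -- Of the 1 gained in the numerator, ½ pays for the slack of `_≤ʳ_`; the other ½, divided by the
    -- bound B on P, is the margin.
    in inv B * ½ , 0<half (proj₁ (inv-spec B 0<B)) , (N₁ ℕ.⊔ N₂) ℕ.⊔ N₃ , λ n l →
      let l₁₂ = ℕ.≤-trans (ℕ.m≤m⊔n (N₁ ℕ.⊔ N₂) N₃) l
          p = seq P n
          0<p = <-≤-trans 0<δ (hδ n (ℕ.≤-trans (ℕ.m≤n⊔m N₁ N₂) l₁₂))
          0<i , pi≡1 = inv-spec p 0<p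
      in ≤-trans
        (*-mono (<⇒≤ (proj₁ (inv-spec B 0<B))) (inv-antimono 0<p (≤-trans (≤∣∣ p) (hB n (ℕ.≤-trans (ℕ.m≤m⊔n N₁ N₂) l₁₂))))
          (nonNegative⁻¹ ½)
          (≤-by {q = (K + 1ℚ) - (1ℚ - D) * p}
            (solve 3 (λ k d p → ((k :+ con 1ℚ) :- (con 1ℚ :- d) :* p) :- con ½ := (k :+ con ½) :- (con 1ℚ :- d) :* p) refl K D p)
            (diff≥0 (hK n (ℕ.≤-trans (ℕ.m≤n⊔m (N₁ ℕ.⊔ N₂) N₃) l)))))
        (≤-reflexive (trans
          (solve 4 (λ i k d p → i :* ((k :+ con 1ℚ) :- (con 1ℚ :- d) :* p) := (k :+ con 1ℚ) :* i :- (con 1ℚ :- d) :* (p :* i)) refl (inv p) K D p)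
          (trans (cong (λ z → (K + 1ℚ) * inv p - (1ℚ - D) * z) pi≡1)
            (solve 3 (λ i k d → (k :+ con 1ℚ) :* i :- (con 1ℚ :- d) :* con 1ℚ := d :- (con 1ℚ :- (k :+ con 1ℚ) :* i)) refl (inv p) K D))))
    where open +-*-Solver

  opaque
    unfolding _⊕_

    conclude-pow : ∀ {D K} x 0<x a → ⟨ 1ℚ - D ⟩ ⊗ E (a ⊗ log x 0<x) ≤ʳ ⟨ K ⟩ →
                   1ʳ -ʳ quotient (fromℚ (K + 1ℚ)) (pow x 0<x a) (pow-positive x 0<x a) <ʳ fromℚ D
    conclude-pow {D} {K} x 0<x a h = conclude {D} {K} (pow x 0<x a) (pow-positive x 0<x a)
      (≤ʳ-trans (≈⇒≤ (pointwise (fromℚ (1ℚ - D) *ʳ pow x 0<x a) (⟨ 1ℚ - D ⟩ ⊗ E (a ⊗ log x 0<x)) λ _ → refl)) h)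

    ⟨⟩≤⇒0< : ∀ {q x} → 0ℚ < q → ⟨ q ⟩ ≤ʳ x → 0ʳ <ʳ x
    ⟨⟩≤⇒0< {q} {x} = ≤ʳ⇒<ʳ {x} {q}

  -- 16 ≥ exp 2, and 2 ≥ exp ½ in the next lemma: beyond this threshold log n and log log n are
  -- visibly positive, so the iterated logarithms and the power are defined.
  2≤log : ∀ n .{{_ : ℕ.NonZero n}} → 16 ℕ.≤ n → ⟨ ℤ.+ 2 / 1 ⟩ ≤ʳ log (fromℕ n) (fromℕ-positive n)
  2≤log n 16≤n = E-cancel (≤ʳ-trans E2≤16 (≤ʳ-trans (⟨⟩-mono (ℕ→ℚ-mono 16≤n))
    (≤ʳ-trans (≈⇒≤ (subst (_≈ fromℕ n) (fromℕ≡ n) ≈-refl)) (≈⇒≤ (≈-sym (E-log (fromℕ n) (fromℕ-positive n)))))))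

  ½≤log : ∀ x 0<x → ⟨ ℤ.+ 2 / 1 ⟩ ≤ʳ x → ⟨ ½ ⟩ ≤ʳ log x 0<x
  ½≤log x 0<x 2≤x = E-cancel (≤ʳ-trans E½≤2 (≤ʳ-trans 2≤x (≈⇒≤ (≈-sym (E-log x 0<x)))))

-- Capped prime exponents of residues modulo n.

module Valuation where

  open import Data.List using (List; []; _∷_)
  open import Data.List.Relation.Unary.All as All using (All; []; _∷_)
  open import Data.Nat hiding (NonZero)
  open import Data.Nat.Divisibility
  open import Data.Nat.DivMod using (_%_)
  open import Data.Nat.Primality using (Prime; euclidsLemma; prime⇒nonZero; prime⇒irreducible; ¬prime[1])
  open import Data.Nat.Properties
  open import Data.Sum using (inj₁; inj₂)
  open import Relation.Binary.PropositionalEquality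
  open import Relation.Nullary using (¬_; yes; no; contradiction)

  -- The exponent of p in s, capped at e.
  v : ℕ → ℕ → ℕ → ℕ
  v p zero    s = 0
  v p (suc e) s with p ∣? s
  ... | yes p∣s = suc (v p e (_∣_.quotient p∣s))
  ... | no  _   = 0

  v≤e : ∀ p e s → v p e s ≤ e
  v≤e p zero    s = z≤n
  v≤e p (suc e) s with p ∣? s
  ... | yes p∣s = s≤s (v≤e p e (_∣_.quotient p∣s))
  ... | no  _   = z≤n

  v-nonmultiple : ∀ p e {s} → ¬ p ∣ s → v p (suc e) s ≡ 0
  v-nonmultiple p e {s} p∤s with p ∣? s
  ... | yes p∣s = contradiction p∣s p∤s
  ... | no  _   = refl

  v-multiple : ∀ p .{{_ : NonZero p}} e t → v p (suc e) (t * p) ≡ suc (v p e t)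
  v-multiple p e t with p ∣? t * p
  ... | yes (divides q tp≡qp) = cong (λ r → suc (v p e r)) (*-cancelʳ-≡ q t p (sym tp≡qp))
  ... | no  p∤tp              = contradiction (n∣m*n t) p∤tp

  v-divides : ∀ p e s → p ^ v p e s ∣ s
  v-divides p zero    s = 1∣ s
  v-divides p (suc e) s with p ∣? s
  ... | yes (divides q refl) = subst (p * p ^ v p e q ∣_) (*-comm p q) (*-monoʳ-∣ p (v-divides p e q))
  ... | no  _                = 1∣ s

  -- With `v≤e` and `v-divides` this characterises the capped exponent as the largest i ≤ e with pⁱ
  -- ∣ s, so that later comparisons can be made through divisibility.
  v-greatest : ∀ p .{{_ : NonZero p}} {e i s} → i ≤ e → p ^ i ∣ s → i ≤ v p e s
  v-greatest p {i = zero} _ _ = z≤n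
  v-greatest p {suc e} {suc i} {s} (s≤s i≤e) pⁱ⁺¹∣s with p ∣? s
  ... | no  p∤s              = contradiction (m*n∣⇒m∣ p (p ^ i) pⁱ⁺¹∣s) p∤s
  ... | yes (divides q refl) = s≤s (v-greatest p i≤e (*-cancelˡ-∣ p (subst (p * p ^ i ∣_) (*-comm q p) pⁱ⁺¹∣s)))

  ^-monoʳ-∣ : ∀ p {i j} → i ≤ j → p ^ i ∣ p ^ j
  ^-monoʳ-∣ p {i} {j} i≤j = subst (p ^ i ∣_) (trans (sym (^-distribˡ-+-* p i (j ∸ i))) (cong (p ^_) (m+[n∸m]≡n i≤j)))
    (m∣m*n (p ^ (j ∸ i)))

  v-mono-∣ : ∀ p .{{_ : NonZero p}} e {s t} → (∀ i → i ≤ e → p ^ i ∣ s → p ^ i ∣ t) → v p e s ≤ v p e t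
  v-mono-∣ p e {s} {t} h = v-greatest p (v≤e p e s) (h (v p e s) (v≤e p e s) (v-divides p e s))

  -- The powers of p up to the cap divide n, so the capped exponent is a function of the residue
  -- class; an uncapped one would not be.
  v-+-modulus : ∀ p .{{_ : NonZero p}} e {n} t → p ^ e ∣ n → v p e (n + t) ≡ v p e t
  v-+-modulus p e {n} t pᵉ∣n = ≤-antisym
    (v-mono-∣ p e λ i i≤e pⁱ∣n+t → ∣m+n∣m⇒∣n pⁱ∣n+t (∣-trans (^-monoʳ-∣ p i≤e) pᵉ∣n))
    (v-mono-∣ p e λ i i≤e pⁱ∣t → ∣m∣n⇒∣m+n (∣-trans (^-monoʳ-∣ p i≤e) pᵉ∣n) pⁱ∣t)

  v-% : ∀ p .{{_ : NonZero p}} e {n} .{{_ : NonZero n}} t → p ^ e ∣ n → v p e (t % n) ≡ v p e t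
  v-% p e {n} t pᵉ∣n = ≤-antisym
    (v-mono-∣ p e λ i i≤e → ∣n∣m%n⇒∣m (∣-trans (^-monoʳ-∣ p i≤e) pᵉ∣n))
    (v-mono-∣ p e λ i i≤e pⁱ∣t → %-presˡ-∣ pⁱ∣t (∣-trans (^-monoʳ-∣ p i≤e) pᵉ∣n))

  v-* : ∀ p .{{_ : NonZero p}} e a b → e ⊓ (v p e a + v p e b) ≤ v p e (a * b)
  v-* p e a b = v-greatest p (m⊓n≤m e (v p e a + v p e b))
    (∣-trans (^-monoʳ-∣ p (m⊓n≤n e (v p e a + v p e b)))
      (subst (_∣ a * b) (sym (^-distribˡ-+-* p (v p e a) (v p e b))) (*-pres-∣ (v-divides p e a) (v-divides p e b))))

  prime-∣-prime : ∀ {p q} → Prime p → Prime q → p ∣ q → p ≡ q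
  prime-∣-prime pp pq p∣q with prime⇒irreducible pq p∣q
  ... | inj₁ refl = contradiction pp ¬prime[1]
  ... | inj₂ p≡q  = p≡q

  -- Euclid's lemma moves one factor p at a time out of q and into t.
  ^-∣-cancel-prime : ∀ {p q} → Prime p → Prime q → p ≢ q → ∀ i t → p ^ i ∣ t * q → p ^ i ∣ t
  ^-∣-cancel-prime pp pq p≢q zero    t _ = 1∣ t
  ^-∣-cancel-prime {p} {q} pp pq p≢q (suc i) t h with euclidsLemma t q pp (m*n∣⇒m∣ p (p ^ i) h)
  ... | inj₂ p∣q              = contradiction (prime-∣-prime pp pq p∣q) p≢q
  ... | inj₁ (divides r refl) = subst (p * p ^ i ∣_) (*-comm p r) (*-monoʳ-∣ p
    (^-∣-cancel-prime pp pq p≢q i r (*-cancelˡ-∣ p {{prime⇒nonZero pp}} (subst (p * p ^ i ∣_)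
      (trans (cong (_* q) (*-comm r p)) (*-assoc p r q)) h))))

  v-*-prime : ∀ {p q} → Prime p → Prime q → p ≢ q → ∀ e t → v p e (t * q) ≡ v p e t
  v-*-prime {p} {q} pp pq p≢q e t = ≤-antisym
    (v-mono-∣ p e λ i _ → ^-∣-cancel-prime pp pq p≢q i t)
    (v-mono-∣ p e λ i _ → ∣m⇒∣m*n q)
    where instance _ = prime⇒nonZero pp

  Ω : List ℕ → ℕ → ℕ → ℕ
  Ω []       e s = 0
  Ω (p ∷ ps) e s = v p e s + Ω ps e s

  modulus : List ℕ → ℕ → ℕ
  modulus []       e = 1
  modulus (p ∷ ps) e = p ^ e * modulus ps e

  modulus≢0 : ∀ {ps} → All Prime ps → ∀ e → NonZero (modulus ps e)
  modulus≢0 []                e = _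
  modulus≢0 {p ∷ ps} (pp ∷ pps) e = m*n≢0 (p ^ e) (modulus ps e) {{m^n≢0 p e {{prime⇒nonZero pp}}}} {{modulus≢0 pps e}}

  ^∣modulus : ∀ ps e → All (λ p → p ^ e ∣ modulus ps e) ps
  ^∣modulus []       e = []
  ^∣modulus (p ∷ ps) e = m∣m*n (modulus ps e) ∷ All.map (∣n⇒∣m*n (p ^ e)) (^∣modulus ps e)

  Ω-+-modulus : ∀ {ps} e {n} t → All Prime ps → All (λ p → p ^ e ∣ n) ps → Ω ps e (n + t) ≡ Ω ps e t
  Ω-+-modulus e t []         []       = refl
  Ω-+-modulus e t (pp ∷ pps) (h ∷ hs) = cong₂ _+_ (v-+-modulus _ {{prime⇒nonZero pp}} e t h) (Ω-+-modulus e t pps hs)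

  Ω-% : ∀ {ps} e {n} .{{_ : NonZero n}} t → All Prime ps → All (λ p → p ^ e ∣ n) ps → Ω ps e (t % n) ≡ Ω ps e t
  Ω-% e t []         []       = refl
  Ω-% e t (pp ∷ pps) (h ∷ hs) = cong₂ _+_ (v-% _ {{prime⇒nonZero pp}} e t h) (Ω-% e t pps hs)

  Ω-*-prime : ∀ {ps q} e t → Prime q → All Prime ps → All (q ≢_) ps → Ω ps e (t * q) ≡ Ω ps e t
  Ω-*-prime e t pq []         []       = refl
  Ω-*-prime e t pq (pp ∷ pps) (h ∷ hs) = cong₂ _+_ (v-*-prime pp pq (≢-sym h) e t) (Ω-*-prime e t pq pps hs)

  ⊓-subadditive : ∀ e a b → e ⊓ (a + b) ≤ e ⊓ a + e ⊓ b
  ⊓-subadditive e a b with ≤-total e a | ≤-total e b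
  ... | inj₁ e≤a | _ = ≤-trans (m⊓n≤m e (a + b)) (≤-trans (≤-reflexive (sym (m≤n⇒m⊓n≡m e≤a))) (m≤m+n (e ⊓ a) (e ⊓ b)))
  ... | inj₂ _ | inj₁ e≤b = ≤-trans (m⊓n≤m e (a + b)) (≤-trans (≤-reflexive (sym (m≤n⇒m⊓n≡m e≤b))) (m≤n+m (e ⊓ b) (e ⊓ a)))
  ... | inj₂ a≤e | inj₂ b≤e = ≤-trans (m⊓n≤n e (a + b)) (≤-reflexive (sym (cong₂ _+_ (m≥n⇒m⊓n≡n a≤e) (m≥n⇒m⊓n≡n b≤e))))

  -- The cap moves from the total to the single primes: min(e, Σ xₚ) ≤ Σ min(e, xₚ), applied with xₚ
  -- the sum of the two exponents of p.
  Ω-* : ∀ {ps} e a b → All Prime ps → e ⊓ (Ω ps e a + Ω ps e b) ≤ Ω ps e (a * b)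
  Ω-* e a b [] = m⊓n≤n e 0
  Ω-* {p ∷ ps} e a b (pp ∷ pps) = begin
    e ⊓ ((v p e a + Ω ps e a) + (v p e b + Ω ps e b))   ≡⟨ cong (e ⊓_) (+-interchange (v p e a) (Ω ps e a) (v p e b) (Ω ps e b)) ⟩
    e ⊓ ((v p e a + v p e b) + (Ω ps e a + Ω ps e b))   ≤⟨ ⊓-subadditive e (v p e a + v p e b) (Ω ps e a + Ω ps e b) ⟩
    e ⊓ (v p e a + v p e b) + e ⊓ (Ω ps e a + Ω ps e b) ≤⟨ +-mono-≤ (v-* p {{prime⇒nonZero pp}} e a b) (Ω-* e a b pps) ⟩
    v p e (a * b) + Ω ps e (a * b) ∎
    where
    open ≤-Reasoning
    open import Algebra.Properties.CommutativeSemigroup +-commutativeSemigroup using () renaming (interchange to +-interchange)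

-- Finite sums of rationals, by blocks and over periods.

module Summation where

  open import Data.Nat using (zero; suc)
  import Data.Nat.Properties as ℕ
  open import Data.Rational
  open import Data.Rational.Properties
  open import Data.Rational.Solver using (module +-*-Solver)
  open import Relation.Binary.PropositionalEquality
  open Rationals
  open +-*-Solver

  -- S n f = f 0 + … + f (n − 1)
  S : ℕ → (ℕ → ℚ) → ℚ
  S zero    f = 0ℚ
  S (suc n) f = S n f + f n

  S-cong : ∀ n {f g} → (∀ i → f i ≡ g i) → S n f ≡ S n g
  S-cong zero    h = refl
  S-cong (suc n) h = cong₂ _+_ (S-cong n h) (h n)

  S-mono : ∀ n {f g} → (∀ i → i ℕ.< n → f i ≤ g i) → S n f ≤ S n g
  S-mono zero    h = ≤-refl
  S-mono (suc n) h = +-mono-≤ (S-mono n λ i i<n → h i (ℕ.m<n⇒m<1+n i<n)) (h n ℕ.≤-refl)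

  S-0 : ∀ n → S n (λ _ → 0ℚ) ≡ 0ℚ
  S-0 zero    = refl
  S-0 (suc n) = trans (+-identityʳ (S n (λ _ → 0ℚ))) (S-0 n)

  S-1 : ∀ n → S n (λ _ → 1ℚ) ≡ ℕ→ℚ n
  S-1 zero    = refl
  S-1 (suc n) = trans (cong (_+ 1ℚ) (S-1 n)) (trans (+-comm (ℕ→ℚ n) 1ℚ) (sym (ℕ→ℚ-suc n)))

  S-+ : ∀ n f g → S n (λ i → f i + g i) ≡ S n f + S n g
  S-+ zero    f g = refl
  S-+ (suc n) f g = trans (cong (_+ (f n + g n)) (S-+ n f g))
    (solve 4 (λ a b c d → (a :+ b) :+ (c :+ d) := (a :+ c) :+ (b :+ d)) refl (S n f) (S n g) (f n) (g n))

  S-* : ∀ n c f → S n (λ i → c * f i) ≡ c * S n f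
  S-* zero    c f = sym (*-zeroʳ c)
  S-* (suc n) c f = trans (cong (_+ c * f n) (S-* n c f)) (sym (*-distribˡ-+ c (S n f) (f n)))

  S-head : ∀ n f → S (suc n) f ≡ f 0 + S n (λ i → f (suc i))
  S-head zero    f = +-comm 0ℚ (f 0)
  S-head (suc n) f = trans (cong (_+ f (suc n)) (S-head n f)) (+-assoc (f 0) (S n (λ i → f (suc i))) (f (suc n)))

  S-concat : ∀ m n f → S (m ℕ.+ n) f ≡ S m f + S n (λ i → f (m ℕ.+ i))
  S-concat m zero    f = trans (cong (λ k → S k f) (ℕ.+-identityʳ m)) (sym (+-identityʳ (S m f)))
  S-concat m (suc n) f = trans (cong (λ k → S k f) (ℕ.+-suc m n))
    (trans (cong (_+ f (m ℕ.+ n)) (S-concat m n f)) (+-assoc (S m f) (S n (λ i → f (m ℕ.+ i))) (f (m ℕ.+ n))))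

  S-blocks : ∀ m p f → S (m ℕ.* p) f ≡ S m (λ t → S p (λ r → f (t ℕ.* p ℕ.+ r)))
  S-blocks zero    p f = refl
  S-blocks (suc m) p f = trans (cong (λ k → S k f) (ℕ.+-comm p (m ℕ.* p)))
    (trans (S-concat (m ℕ.* p) p f) (cong (_+ S p (λ r → f (m ℕ.* p ℕ.+ r))) (S-blocks m p f)))

  ℕ→ℚ-+ : ∀ m n → ℕ→ℚ (m ℕ.+ n) ≡ ℕ→ℚ m + ℕ→ℚ n
  ℕ→ℚ-+ zero    n = sym (+-identityˡ (ℕ→ℚ n))
  ℕ→ℚ-+ (suc m) n = trans (ℕ→ℚ-suc (m ℕ.+ n)) (trans (cong (1ℚ +_) (ℕ→ℚ-+ m n))
    (trans (sym (+-assoc 1ℚ (ℕ→ℚ m) (ℕ→ℚ n))) (cong (_+ ℕ→ℚ n) (sym (ℕ→ℚ-suc m)))))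

  ℕ→ℚ-* : ∀ m n → ℕ→ℚ (m ℕ.* n) ≡ ℕ→ℚ m * ℕ→ℚ n
  ℕ→ℚ-* zero    n = sym (*-zeroˡ (ℕ→ℚ n))
  ℕ→ℚ-* (suc m) n = trans (ℕ→ℚ-+ n (m ℕ.* n)) (trans (cong (ℕ→ℚ n +_) (ℕ→ℚ-* m n))
    (trans (solve 2 (λ m n → n :+ m :* n := (con 1ℚ :+ m) :* n) refl (ℕ→ℚ m) (ℕ→ℚ n))
      (cong (_* ℕ→ℚ n) (sym (ℕ→ℚ-suc m)))))

  periodic-* : ∀ {n} {f : ℕ → ℚ} → (∀ t → f (n ℕ.+ t) ≡ f t) → ∀ m t → f (m ℕ.* n ℕ.+ t) ≡ f t
  periodic-* h zero    t = refl
  periodic-* {n} {f} h (suc m) t = trans (cong f (ℕ.+-assoc n (m ℕ.* n) t)) (trans (h (m ℕ.* n ℕ.+ t)) (periodic-* {n} {f} h m t))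

  S-periodic : ∀ n f → (∀ t → f (n ℕ.+ t) ≡ f t) → ∀ m → S (m ℕ.* n) f ≡ ℕ→ℚ m * S n f
  S-periodic n f h m = trans (S-blocks m n f)
    (trans (S-cong m λ t → trans (S-cong n (periodic-* {n} {f} h t)) (sym (*-identityʳ (S n f))))
      (trans (S-* m (S n f) (λ _ → 1ℚ)) (trans (cong (S n f *_) (S-1 m)) (*-comm (S n f) (ℕ→ℚ m)))))

-- The mean of z^Ω as a product over the primes, with bounds for its factors.

module Expectation where

  open import Data.List using ([]; _∷_)
  open import Data.List.Relation.Unary.All as All using (All; []; _∷_)
  open import Data.List.Relation.Unary.AllPairs using ([]; _∷_)
  open import Data.List.Relation.Unary.Unique.Propositional using (Unique)
  open import Data.Nat using (zero; suc)
  open import Data.Nat.Divisibility using (n∣m*n; ∣m+n∣m⇒∣n; >⇒∤; m%n≡0⇒n∣m; n∣m⇒m%n≡0)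
  open import Data.Nat.Primality using (Prime; ¬prime[0])
  import Data.Nat.Properties as ℕ
  open import Data.Rational
  open import Data.Rational.Properties
  open import Data.Rational.Solver using (module +-*-Solver)
  open import Relation.Binary.PropositionalEquality
  open import Relation.Nullary using (contradiction)
  open Rationals
  open RealBounds using (_^_; Π[_])
  open Summation
  open Valuation
  open +-*-Solver

  -- 1/p for p ≥ 1; the value at 0 is junk.
  u : ℕ → ℚ
  u p = recip (ℕ.pred p)

  u-inv : ∀ p .{{_ : ℕ.NonZero p}} → u p * ℕ→ℚ p ≡ 1ℚ
  u-inv (suc p) = recip-inv p

  0≤u : ∀ p → 0ℚ ≤ u p
  0≤u p = <⇒≤ (0<recip (ℕ.pred p))

  -- The mean of z ^ v p e s over the residues s modulo p ^ e.
  ω : ℚ → ℕ → ℕ → ℚ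
  ω z zero    p = 1ℚ
  ω z (suc e) p = (z * u p) * ω z e p + (1ℚ - u p)

  ^-+ : ∀ q m n → q ^ (m ℕ.+ n) ≡ q ^ m * q ^ n
  ^-+ q zero    n = sym (*-identityˡ (q ^ n))
  ^-+ q (suc m) n = trans (cong (q *_) (^-+ q m n)) (sym (*-assoc q (q ^ m) (q ^ n)))

  -- Sum g everywhere, then exchange its values at the multiples of `suc p` for those of h. This
  -- yields the recursion of `ω`; with g = 0 it reindexes the multiples removed by the sieve.
  S-multiples : ∀ m p {f g h : ℕ → ℚ} → (∀ t → f (t ℕ.* suc p) ≡ h t) →
                (∀ s → s ℕ.% suc p ≢ 0 → f s ≡ g s) →
                S (m ℕ.* suc p) f ≡ (S m h - S m (λ t → g (t ℕ.* suc p))) + S (m ℕ.* suc p) g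
  S-multiples m p {f} {g} {h} hf hg = begin
    S (m ℕ.* P) f
      ≡⟨ S-blocks m P f ⟩
    S m (λ t → S P (λ r → f (t ℕ.* P ℕ.+ r)))
      ≡⟨ S-cong m block ⟩
    S m (λ t → (h t + - 1ℚ * g (t ℕ.* P)) + S P (λ r → g (t ℕ.* P ℕ.+ r)))
      ≡⟨ S-+ m (λ t → h t + - 1ℚ * g (t ℕ.* P)) (λ t → S P (λ r → g (t ℕ.* P ℕ.+ r))) ⟩
    S m (λ t → h t + - 1ℚ * g (t ℕ.* P)) + S m (λ t → S P (λ r → g (t ℕ.* P ℕ.+ r)))
      ≡⟨ cong₂ _+_ (trans (S-+ m h (λ t → - 1ℚ * g (t ℕ.* P)))
           (cong (S m h +_) (trans (S-* m (- 1ℚ) (λ t → g (t ℕ.* P)))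
             (solve 1 (λ x → con (- 1ℚ) :* x := :- x) refl (S m (λ t → g (t ℕ.* P)))))))
           (sym (S-blocks m P g)) ⟩
    (S m h - S m (λ t → g (t ℕ.* P))) + S (m ℕ.* P) g ∎
    where
    open ≡-Reasoning
    P = suc p
    nonzero : ∀ t r → r ℕ.< p → (t ℕ.* P ℕ.+ suc r) ℕ.% P ≢ 0
    nonzero t r r<p e = >⇒∤ (ℕ.s≤s r<p) (∣m+n∣m⇒∣n (m%n≡0⇒n∣m (t ℕ.* P ℕ.+ suc r) P e) (n∣m*n t))
    S-cong< : ∀ n {f g : ℕ → ℚ} → (∀ i → i ℕ.< n → f i ≡ g i) → S n f ≡ S n g
    S-cong< n h = ≤-antisym (S-mono n λ i l → ≤-reflexive (h i l)) (S-mono n λ i l → ≤-reflexive (sym (h i l)))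
    block : ∀ t → S P (λ r → f (t ℕ.* P ℕ.+ r)) ≡ (h t + - 1ℚ * g (t ℕ.* P)) + S P (λ r → g (t ℕ.* P ℕ.+ r))
    block t = begin
      S P (λ r → f (t ℕ.* P ℕ.+ r))
        ≡⟨ S-head p (λ r → f (t ℕ.* P ℕ.+ r)) ⟩
      f (t ℕ.* P ℕ.+ 0) + S p (λ r → f (t ℕ.* P ℕ.+ suc r))
        ≡⟨ cong₂ _+_ (trans (cong f (ℕ.+-identityʳ (t ℕ.* P))) (hf t))
             (S-cong< p λ r r<p → hg (t ℕ.* P ℕ.+ suc r) (nonzero t r r<p)) ⟩
      h t + S p (λ r → g (t ℕ.* P ℕ.+ suc r))
        ≡⟨ solve 3 (λ a b c → a :+ b := (a :+ con (- 1ℚ) :* c) :+ (c :+ b)) refl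
             (h t) (S p (λ r → g (t ℕ.* P ℕ.+ suc r))) (g (t ℕ.* P)) ⟩
      (h t + - 1ℚ * g (t ℕ.* P)) + (g (t ℕ.* P) + S p (λ r → g (t ℕ.* P ℕ.+ suc r)))
        ≡⟨ cong ((h t + - 1ℚ * g (t ℕ.* P)) +_) (sym (trans (S-head p (λ r → g (t ℕ.* P ℕ.+ r)))
             (cong (λ k → g k + S p (λ r → g (t ℕ.* P ℕ.+ suc r))) (ℕ.+-identityʳ (t ℕ.* P))))) ⟩
      (h t + - 1ℚ * g (t ℕ.* P)) + S P (λ r → g (t ℕ.* P ℕ.+ r)) ∎

  -- Independence of the prime P from the others. On the multiples s = tP the weight G is unchanged
  -- by `mul` and the exponent drops by one; off them the exponent is 0. `mul` and periodicity thus
  -- do the work of the Chinese remainder theorem.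
  weigh-prime : ∀ z n (G : ℕ → ℚ) p → (∀ t → G (t ℕ.* suc p) ≡ G t) → (∀ t → G (n ℕ.+ t) ≡ G t) → ∀ e →
                S (suc p ℕ.^ e ℕ.* n) (λ s → z ^ v (suc p) e s * G s) ≡
                ω z e (suc p) * (ℕ→ℚ (suc p ℕ.^ e) * S n G)
  weigh-prime z n G p mul per zero = trans (S-cong (1 ℕ.* n) λ s → *-identityˡ (G s))
    (trans (S-periodic n G per 1) (sym (*-identityˡ (ℕ→ℚ 1 * S n G))))
  weigh-prime z n G p mul per (suc e) = begin
    S (P ℕ.* P ℕ.^ e ℕ.* n) f
      ≡⟨ cong (λ k → S k f) size ⟩
    S (N ℕ.* P) f
      ≡⟨ S-multiples N p on off ⟩
    (S N (λ t → z * (z ^ v P e t * G t)) - S N (λ t → G (t ℕ.* P))) + S (N ℕ.* P) G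
      ≡⟨ cong₂ _+_ (cong₂ _-_ (trans (S-* N z (λ t → z ^ v P e t * G t)) (cong (z *_) (weigh-prime z n G p mul per e)))
            (trans (S-cong N mul) (S-periodic n G per (P ℕ.^ e))))
          (trans (cong (λ k → S k G) (sym size)) (trans (S-periodic n G per (P ℕ.* P ℕ.^ e)) (cong (_* A) (ℕ→ℚ-* P (P ℕ.^ e))))) ⟩
    (z * (ω z e P * (Q * A)) - Q * A) + (ℕ→ℚ P * Q) * A
      ≡⟨ solve 5 (λ z w q a pp → (z :* (w :* (q :* a)) :- q :* a) :+ (pp :* q) :* a :=
           ((z :* con 1ℚ) :* w) :* (q :* a) :+ (pp :- con 1ℚ) :* (q :* a)) refl z (ω z e P) Q A (ℕ→ℚ P) ⟩
    ((z * 1ℚ) * ω z e P) * (Q * A) + (ℕ→ℚ P - 1ℚ) * (Q * A)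
      ≡⟨ cong (λ o → ((z * o) * ω z e P) * (Q * A) + (ℕ→ℚ P - o) * (Q * A)) (sym (u-inv P)) ⟩
    ((z * (u P * ℕ→ℚ P)) * ω z e P) * (Q * A) + (ℕ→ℚ P - u P * ℕ→ℚ P) * (Q * A)
      ≡⟨ solve 6 (λ z w q a pp u → ((z :* (u :* pp)) :* w) :* (q :* a) :+ (pp :- u :* pp) :* (q :* a) :=
           ((z :* u) :* w :+ (con 1ℚ :- u)) :* ((pp :* q) :* a)) refl z (ω z e P) Q A (ℕ→ℚ P) (u P) ⟩
    ω z (suc e) P * ((ℕ→ℚ P * Q) * A)
      ≡⟨ cong (λ k → ω z (suc e) P * (k * A)) (sym (ℕ→ℚ-* P (P ℕ.^ e))) ⟩
    ω z (suc e) P * (ℕ→ℚ (P ℕ.* P ℕ.^ e) * A) ∎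
    where
    open ≡-Reasoning
    P = suc p
    N = P ℕ.^ e ℕ.* n
    A = S n G
    Q = ℕ→ℚ (P ℕ.^ e)
    f : ℕ → ℚ
    f s = z ^ v P (suc e) s * G s
    size : P ℕ.* P ℕ.^ e ℕ.* n ≡ N ℕ.* P
    size = trans (ℕ.*-assoc P (P ℕ.^ e) n) (ℕ.*-comm P N)
    on : ∀ t → f (t ℕ.* P) ≡ z * (z ^ v P e t * G t)
    on t = trans (cong₂ (λ a b → z ^ a * b) (v-multiple P e t) (mul t)) (*-assoc z (z ^ v P e t) (G t))
    off : ∀ s → s ℕ.% P ≢ 0 → f s ≡ G s
    off s h = trans (cong (λ a → z ^ a * G s) (v-nonmultiple P e λ P∣s → h (n∣m⇒m%n≡0 s P P∣s))) (*-identityˡ (G s))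

  mean-z^Ω : ∀ z e {ps} → All Prime ps → Unique ps →
             S (modulus ps e) (λ s → z ^ Ω ps e s) ≡ Π[ ps ] (ω z e) * ℕ→ℚ (modulus ps e)
  mean-z^Ω z e [] [] = refl
  mean-z^Ω z e {zero ∷ ps} (p0 ∷ _) _ = contradiction p0 ¬prime[0]
  mean-z^Ω z e {suc p ∷ ps} (pp ∷ pps) (p∉ps ∷ unique) = begin
    S (P ℕ.^ e ℕ.* n) (λ s → z ^ (v P e s ℕ.+ Ω ps e s))
      ≡⟨ S-cong (P ℕ.^ e ℕ.* n) (λ s → ^-+ z (v P e s) (Ω ps e s)) ⟩
    S (P ℕ.^ e ℕ.* n) (λ s → z ^ v P e s * z ^ Ω ps e s)
      ≡⟨ weigh-prime z n (λ s → z ^ Ω ps e s) p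
           (λ t → cong (z ^_) (Ω-*-prime e t pp pps p∉ps))
           (λ t → cong (z ^_) (Ω-+-modulus e t pps (^∣modulus ps e))) e ⟩
    ω z e P * (ℕ→ℚ (P ℕ.^ e) * S n (λ s → z ^ Ω ps e s))
      ≡⟨ cong (λ q → ω z e P * (ℕ→ℚ (P ℕ.^ e) * q)) (mean-z^Ω z e pps unique) ⟩
    ω z e P * (ℕ→ℚ (P ℕ.^ e) * (Π[ ps ] (ω z e) * ℕ→ℚ n))
      ≡⟨ solve 4 (λ w q p n → w :* (q :* (p :* n)) := (w :* p) :* (q :* n)) refl (ω z e P) (ℕ→ℚ (P ℕ.^ e)) (Π[ ps ] (ω z e)) (ℕ→ℚ n) ⟩
    (ω z e P * Π[ ps ] (ω z e)) * (ℕ→ℚ (P ℕ.^ e) * ℕ→ℚ n)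
      ≡⟨ cong ((ω z e P * Π[ ps ] (ω z e)) *_) (sym (ℕ→ℚ-* (P ℕ.^ e) n)) ⟩
    Π[ suc p ∷ ps ] (ω z e) * ℕ→ℚ (P ℕ.^ e ℕ.* n) ∎
    where
    open ≡-Reasoning
    P = suc p
    n = modulus ps e

  ω≥0 : ∀ {z p} → 0ℚ ≤ z → ∀ e → 0ℚ ≤ ω z e p
  ω≥0 0≤z zero = 0≤1
  ω≥0 {z} {p} 0≤z (suc e) = +≥0 (*≥0 (*≥0 0≤z (0≤u p)) (ω≥0 0≤z e)) (diff≥0 (recip-antimono {0} {ℕ.pred p} ℕ.z≤n))

  -- A value r ≥ 1 that the recursion step does not increase bounds all its iterates, uniformly in
  -- e.
  ω≤ : ∀ {z p r} → 0ℚ ≤ z → 1ℚ ≤ r → (z * u p) * r + (1ℚ - u p) ≤ r → ∀ e → ω z e p ≤ r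
  ω≤ 0≤z 1≤r h zero = 1≤r
  ω≤ {z} {p} 0≤z 1≤r h (suc e) = ≤-trans
    (+-monoˡ-≤ (1ℚ - u p) (*-mono (*≥0 0≤z (0≤u p)) ≤-refl (ω≥0 0≤z e) (ω≤ {z} {p} 0≤z 1≤r h e))) h

  -- The recursion keeps values at most 1, and unfolding it once more produces the linear term. The
  -- exponent is a successor because `ω z 0 p` is still 1.
  ω≤-small : ∀ {z} p → 0ℚ ≤ z → z ≤ 1ℚ → ∀ e → ω z (suc e) p ≤ 1ℚ + (z - 1ℚ) * u p
  ω≤-small {z} p 0≤z z≤1 e = ≤-trans
    (+-monoˡ-≤ (1ℚ - u p) (*-mono (*≥0 0≤z (0≤u p)) ≤-refl (ω≥0 0≤z e)
      (ω≤ {z} {p} {1ℚ} 0≤z ≤-refl (≤-by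
        (solve 2 (λ z u → con 1ℚ :- ((z :* u) :* con 1ℚ :+ (con 1ℚ :- u)) := (con 1ℚ :- z) :* u) refl z (u p))
        (*≥0 (diff≥0 z≤1) (0≤u p))) e)))
    (≤-reflexive (solve 2 (λ z u → (z :* u) :* con 1ℚ :+ (con 1ℚ :- u) := con 1ℚ :+ (z :- con 1ℚ) :* u) refl z (u p)))

  -- For uncapped exponents and z = 1 + w the mean is 1 + wu/(1 - zu) = 1 + wu + wzu²/(1 - zu). At w
  -- = u = ½ the coefficient wz/(1 - zu) reaches its maximum 3.
  ω≤-large : ∀ {w} p → 0ℚ ≤ w → w ≤ ½ → u p ≤ ½ → ∀ e →
             ω (1ℚ + w) e p ≤ 1ℚ + (w * u p + ℕ→ℚ 3 * (u p * u p))
  ω≤-large {w} p 0≤w w≤½ u≤½ = ω≤ {1ℚ + w} {p} (+≥0 0≤1 0≤w)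
    (≤-by (solve 1 (λ x → (con 1ℚ :+ x) :- con 1ℚ := x) refl (w * U + ℕ→ℚ 3 * (U * U)))
      (+≥0 (*≥0 0≤w 0≤U) (*≥0 (0≤ℕ→ℚ 3) (*≥0 0≤U 0≤U))))
    (≤-by
      (solve 2 (λ w u →
          (con 1ℚ :+ (w :* u :+ con (ℕ→ℚ 3) :* (u :* u))) :-
            (((con 1ℚ :+ w) :* u) :* (con 1ℚ :+ (w :* u :+ con (ℕ→ℚ 3) :* (u :* u))) :+ (con 1ℚ :- u)) :=
          (u :* u) :* ((con (ℕ→ℚ 3) :* (con 1ℚ :+ w)) :* (con ½ :- u) :+ (con ½ :- w) :* (con (ℕ→ℚ 3) :+ w))) refl w U)
      (*≥0 (*≥0 0≤U 0≤U) (+≥0 (*≥0 (*≥0 (0≤ℕ→ℚ 3) (+≥0 0≤1 0≤w)) (diff≥0 u≤½))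
        (*≥0 (diff≥0 w≤½) (+≥0 (0≤ℕ→ℚ 3) 0≤w)))))
    where
    U = u p
    0≤U = 0≤u p

-- The product-free set and Chernoff's bound for its complement.

module Density where

  open import Data.Bool using (Bool; true; false; if_then_else_)
  open import Data.Fin using (Fin; toℕ)
  open import Data.Fin.Subset using (Subset; _∈_) renaming (∣_∣ to card)
  import Data.Integer as ℤ
  import Data.Integer.Properties as ℤ
  open import Data.List using ([]; _∷_; filter; map)
  open import Data.List.Extrema using (xs≤max)
  open import Data.List.Membership.Propositional using () renaming (_∈_ to _∈ˡ_)
  open import Data.List.Membership.Propositional.Properties using (∈-map⁺; ∈-filter⁺; ∈-++⁺ˡ; ∈-++⁺ʳ)
  open import Data.List.Relation.Unary.All as All using (All)
  open import Data.List.Relation.Unary.Any using (here)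
  open import Data.List.Relation.Unary.Unique.Propositional using (Unique)
  open import Data.Nat using (zero; suc)
  open import Data.Nat.Primality using (Prime)
  import Data.Nat.Properties as ℕ
  open import Data.Product using (_×_; _,_; proj₁; proj₂)
  open import Data.Rational
  open import Data.Rational.Properties
  open import Data.Rational.Solver using (module +-*-Solver)
  import Data.Rational.Unnormalised as ℚᵘ
  import Data.Rational.Unnormalised.Properties as ℚᵘ
  open import Data.Vec using (tabulate; []; _∷_)
  open import Data.Vec.Properties using (lookup∘tabulate; []=⇒lookup)
  open import Function using (_∘_)
  open import Relation.Binary.Bundles using (DecTotalOrder)
  open import Relation.Binary.PropositionalEquality
  open import Relation.Nullary using (Dec; does; yes; no)
  open import Relation.Nullary.Decidable using (_×-dec_)
  open Rationals
  open RealBounds using (_^_; Π[_]; ^≥0)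
  open Summation
  open Valuation
  open Expectation
  open +-*-Solver

  density-* : ∀ n .{{_ : ℕ.NonZero n}} (A : Subset n) → density n A * ℕ→ℚ n ≡ ℕ→ℚ (card A)
  density-* n@(suc m) A = toℚᵘ-injective (begin
    toℚᵘ (density n A * ℕ→ℚ n)
      ≈⟨ toℚᵘ-homo-* (density n A) (ℕ→ℚ n) ⟩
    toℚᵘ (density n A) ℚᵘ.* toℚᵘ (ℕ→ℚ n)
      ≈⟨ ℚᵘ.*-cong (toℚᵘ-fromℚᵘ (ℚᵘ.mkℚᵘ (ℤ.+ card A) m)) (toℚᵘ-fromℚᵘ (ℚᵘ.mkℚᵘ (ℤ.+ n) 0)) ⟩
    ℚᵘ.mkℚᵘ (ℤ.+ card A) m ℚᵘ.* ℚᵘ.mkℚᵘ (ℤ.+ n) 0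
      ≈⟨ ℚᵘ.*≡* (trans (ℤ.*-identityʳ (ℤ.+ card A ℤ.* ℤ.+ n)) (cong (λ k → ℤ.+ card A ℤ.* ℤ.+ suc k) (sym (ℕ.*-identityʳ m)))) ⟩
    ℚᵘ.mkℚᵘ (ℤ.+ card A) 0
      ≈⟨ ℚᵘ.≃-sym (toℚᵘ-fromℚᵘ (ℚᵘ.mkℚᵘ (ℤ.+ card A) 0)) ⟩
    toℚᵘ (ℕ→ℚ (card A)) ∎)
    where open import Relation.Binary.Reasoning.Setoid ℚᵘ.≃-setoid

  ∈-subsets : ∀ {n} (A : Subset n) → A ∈ˡ subsets n
  ∈-subsets []          = here refl
  ∈-subsets (true ∷ A)  = ∈-++⁺ˡ (∈-map⁺ (true ∷_) (∈-subsets A))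
  ∈-subsets (false ∷ A) = ∈-++⁺ʳ (map (true ∷_) (subsets _)) (∈-map⁺ (false ∷_) (∈-subsets A))

  density≤D : ∀ n .{{_ : ℕ.NonZero n}} {A : Subset n} → ProductFree n A → density n A ≤ D n
  density≤D n {A} free = All.lookup
    (xs≤max (DecTotalOrder.totalOrder ≤-decTotalOrder) 0ℚ (map (density n) (filter (productFree? n) (subsets n))))
    (∈-map⁺ (density n) (∈-filter⁺ (productFree? n) (∈-subsets A) free))

  indicator : Bool → ℚ
  indicator b = if b then 1ℚ else 0ℚ

  card-tabulate : ∀ n (b : ℕ → Bool) → ℕ→ℚ (card (tabulate {n = n} (b ∘ toℕ))) ≡ S n (indicator ∘ b)
  card-tabulate zero    b = refl
  card-tabulate (suc n) b = trans (first (b 0)) (sym (S-head n (indicator ∘ b)))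
    where
    rest : Subset n
    rest = tabulate (b ∘ suc ∘ toℕ)
    first : ∀ c → ℕ→ℚ (card (c ∷ rest)) ≡ indicator c + S n (indicator ∘ b ∘ suc)
    first true  = trans (ℕ→ℚ-suc (card rest)) (cong (1ℚ +_) (card-tabulate n (b ∘ suc)))
    first false = trans (card-tabulate n (b ∘ suc)) (sym (+-identityˡ (S n (indicator ∘ b ∘ suc))))

  ∈-tabulate : ∀ {n} (b : Fin n → Bool) i → i ∈ tabulate b → b i ≡ true
  ∈-tabulate b i i∈ = trans (sym (lookup∘tabulate b i)) ([]=⇒lookup i∈)

  middle? : ∀ k j → Dec (k ℕ.≤ j × j ℕ.< k ℕ.+ k)
  middle? k j = (k ℕ.≤? j) ×-dec (j ℕ.<? k ℕ.+ k)

  layers : ∀ ps e k n → Subset n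
  layers ps e k n = tabulate λ i → does (middle? k (Ω ps e (toℕ i)))

  -- In a product of two elements either all exponents add up, to at least 2k, or one is capped at e ≥ 2k.
  layers-productFree : ∀ ps e k → All Prime ps → k ℕ.+ k ℕ.≤ e → .{{_ : ℕ.NonZero (modulus ps e)}} →
                       ProductFree (modulus ps e) (layers ps e k (modulus ps e))
  layers-productFree ps e k pps 2k≤e a a∈ b b∈ c c∈ ab≡c = ℕ.<⇒≱ (proj₂ (layer c c∈)) (begin
    k ℕ.+ k
      ≤⟨ ℕ.⊓-glb 2k≤e (ℕ.+-mono-≤ (proj₁ (layer a a∈)) (proj₁ (layer b b∈))) ⟩
    e ℕ.⊓ (Ω ps e (toℕ a) ℕ.+ Ω ps e (toℕ b))
      ≤⟨ Ω-* e (toℕ a) (toℕ b) pps ⟩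
    Ω ps e (toℕ a ℕ.* toℕ b)
      ≡⟨ sym (Ω-% e (toℕ a ℕ.* toℕ b) pps (^∣modulus ps e)) ⟩
    Ω ps e ((toℕ a ℕ.* toℕ b) ℕ.% modulus ps e)
      ≡⟨ cong (Ω ps e) ab≡c ⟩
    Ω ps e (toℕ c ℕ.% modulus ps e)
      ≡⟨ Ω-% e (toℕ c) pps (^∣modulus ps e) ⟩
    Ω ps e (toℕ c) ∎)
    where
    open ℕ.≤-Reasoning
    witness : ∀ {P : Set} (d : Dec P) → does d ≡ true → P
    witness (yes p) _ = p
    layer : ∀ i → i ∈ layers ps e k (modulus ps e) → k ℕ.≤ Ω ps e (toℕ i) × Ω ps e (toℕ i) ℕ.< k ℕ.+ k
    layer i i∈ = witness (middle? k (Ω ps e (toℕ i))) (∈-tabulate _ i i∈)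

  ^-inverse : ∀ {y z} → y * z ≡ 1ℚ → ∀ n → y ^ n * z ^ n ≡ 1ℚ
  ^-inverse h zero = refl
  ^-inverse {y} {z} h (suc n) = trans
    (solve 4 (λ y z a b → (y :* a) :* (z :* b) := (y :* z) :* (a :* b)) refl y z (y ^ n) (z ^ n))
    (cong₂ _*_ h (^-inverse h n))

  1≤^ : ∀ {q} → 1ℚ ≤ q → ∀ n → 1ℚ ≤ q ^ n
  1≤^ h zero    = ≤-refl
  1≤^ h (suc n) = *-mono {p = 1ℚ} {r = 1ℚ} 0≤1 h 0≤1 (1≤^ h n)

  -- With y = 1/z the product is y to the power k - j. The lower tail uses this directly, the upper
  -- tail with z′, 1/z′, j and 2k in place of y, z, k and j.
  1≤tail-below : ∀ {y z} → 1ℚ ≤ y → y * z ≡ 1ℚ → ∀ {j k} → j ℕ.≤ k → 1ℚ ≤ y ^ k * z ^ j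
  1≤tail-below {y} {z} 1≤y h {j} {k} j≤k = subst (1ℚ ≤_) (sym (begin
    y ^ k * z ^ j                   ≡⟨ cong (λ i → y ^ i * z ^ j) (sym (ℕ.m∸n+n≡m j≤k)) ⟩
    y ^ (k ℕ.∸ j ℕ.+ j) * z ^ j     ≡⟨ cong (_* z ^ j) (^-+ y (k ℕ.∸ j) j) ⟩
    (y ^ (k ℕ.∸ j) * y ^ j) * z ^ j ≡⟨ *-assoc (y ^ (k ℕ.∸ j)) (y ^ j) (z ^ j) ⟩
    y ^ (k ℕ.∸ j) * (y ^ j * z ^ j) ≡⟨ cong (y ^ (k ℕ.∸ j) *_) (^-inverse h j) ⟩
    y ^ (k ℕ.∸ j) * 1ℚ              ≡⟨ *-identityʳ (y ^ (k ℕ.∸ j)) ⟩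
    y ^ (k ℕ.∸ j) ∎)) (1≤^ 1≤y (k ℕ.∸ j))
    where open ≡-Reasoning

  -- Chernoff's bound for both tails, with z ≤ 1 below and z′ ≥ 1 above.
  1-D≤ : ∀ ps e k {y z y′ z′} → All Prime ps → Unique ps → k ℕ.+ k ℕ.≤ e →
         1ℚ ≤ y → 0ℚ ≤ z → y * z ≡ 1ℚ → 0ℚ ≤ y′ → 1ℚ ≤ z′ → y′ * z′ ≡ 1ℚ → .{{_ : ℕ.NonZero (modulus ps e)}} →
         1ℚ - D (modulus ps e) ≤ y ^ k * Π[ ps ] (ω z e) + (y′ ^ k * y′ ^ k) * Π[ ps ] (ω z′ e)
  1-D≤ ps e k {y} {z} {y′} {z′} pps unique 2k≤e 1≤y 0≤z yz≡1 0≤y′ 1≤z′ y′z′≡1 = ≤-trans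
    (+-monoʳ-≤ 1ℚ (neg-antimono-≤ (density≤D n (layers-productFree ps e k pps 2k≤e))))
    (≤-by (solve 2 (λ r d → r :- (con 1ℚ :- d) := (r :+ d) :- con 1ℚ) refl R δ)
      (diff≥0 (*-cancelʳ-≤-pos {1ℚ} {R + δ} (ℕ→ℚ n) {{positive 0<n}} (begin
        1ℚ * ℕ→ℚ n
          ≡⟨ trans (*-identityˡ (ℕ→ℚ n)) (sym (S-1 n)) ⟩
        S n (λ _ → 1ℚ)
          ≤⟨ S-mono n (λ s _ → covered (Ω ps e s)) ⟩
        S n (λ s → (y ^ k * z ^ Ω ps e s + (y′ ^ k * y′ ^ k) * z′ ^ Ω ps e s) + indicator (inside s))
          ≡⟨ trans (S-+ n (λ s → y ^ k * z ^ Ω ps e s + (y′ ^ k * y′ ^ k) * z′ ^ Ω ps e s) (indicator ∘ inside))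
               (cong₂ _+_ (trans (S-+ n (λ s → y ^ k * z ^ Ω ps e s) (λ s → (y′ ^ k * y′ ^ k) * z′ ^ Ω ps e s))
                   (cong₂ _+_ (trans (S-* n (y ^ k) (λ s → z ^ Ω ps e s)) (cong (y ^ k *_) (mean-z^Ω z e pps unique)))
                     (trans (S-* n (y′ ^ k * y′ ^ k) (λ s → z′ ^ Ω ps e s)) (cong ((y′ ^ k * y′ ^ k) *_) (mean-z^Ω z′ e pps unique)))))
                 (trans (sym (card-tabulate n inside)) (sym (density-* n (layers ps e k n))))) ⟩
        (y ^ k * (Π[ ps ] (ω z e) * ℕ→ℚ n) + (y′ ^ k * y′ ^ k) * (Π[ ps ] (ω z′ e) * ℕ→ℚ n)) + δ * ℕ→ℚ n
          ≡⟨ solve 6 (λ a b c d δ n → (a :* (b :* n) :+ c :* (d :* n)) :+ δ :* n := ((a :* b :+ c :* d) :+ δ) :* n) refl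
               (y ^ k) (Π[ ps ] (ω z e)) (y′ ^ k * y′ ^ k) (Π[ ps ] (ω z′ e)) δ (ℕ→ℚ n) ⟩
        (R + δ) * ℕ→ℚ n ∎))))
    where
    open ≤-Reasoning
    n = modulus ps e
    δ = density n (layers ps e k n)
    R = y ^ k * Π[ ps ] (ω z e) + (y′ ^ k * y′ ^ k) * Π[ ps ] (ω z′ e)
    inside : ℕ → Bool
    inside s = does (middle? k (Ω ps e s))
    0<n : 0ℚ < ℕ→ℚ n
    0<n = subst (λ m → 0ℚ < ℕ→ℚ m) (ℕ.suc-pred n) (0<ℕ→ℚ-suc (ℕ.pred n))
    0≤y = ≤-trans 0≤1 1≤y
    0≤z′ = ≤-trans 0≤1 1≤z′
    -- The pointwise form of the bound: each residue is charged to one of the tails or to the set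
    -- itself.
    covered : ∀ j → 1ℚ ≤ (y ^ k * z ^ j + (y′ ^ k * y′ ^ k) * z′ ^ j) + indicator (does (middle? k j))
    covered j = cases (middle? k j)
      where
      cases : ∀ d → 1ℚ ≤ (y ^ k * z ^ j + (y′ ^ k * y′ ^ k) * z′ ^ j) + indicator (does d)
      cases (no outside) with k ℕ.≤? j
      ... | no k≰j = ≤-trans (1≤tail-below 1≤y yz≡1 (ℕ.≰⇒≥ k≰j))
        (≤-by (solve 2 (λ a b → ((a :+ b) :+ con 0ℚ) :- a := b) refl (y ^ k * z ^ j) ((y′ ^ k * y′ ^ k) * z′ ^ j))
          (*≥0 (*≥0 (^≥0 0≤y′ k) (^≥0 0≤y′ k)) (^≥0 0≤z′ j)))
      ... | yes k≤j = ≤-trans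
        (subst (1ℚ ≤_) (trans (*-comm (z′ ^ j) (y′ ^ (k ℕ.+ k))) (cong (_* z′ ^ j) (^-+ y′ k k)))
          (1≤tail-below 1≤z′ (trans (*-comm z′ y′) y′z′≡1) (ℕ.≮⇒≥ λ j<2k → outside (k≤j , j<2k))))
        (≤-by (solve 2 (λ a b → ((a :+ b) :+ con 0ℚ) :- b := a) refl (y ^ k * z ^ j) ((y′ ^ k * y′ ^ k) * z′ ^ j))
          (*≥0 (^≥0 0≤y k) (^≥0 0≤z j)))
      cases (yes _) = ≤-by
        (solve 1 (λ a → (a :+ con 1ℚ) :- con 1ℚ := a) refl (y ^ k * z ^ j + (y′ ^ k * y′ ^ k) * z′ ^ j))
        (+≥0 (*≥0 (^≥0 0≤y k) (^≥0 0≤z j)) (*≥0 (*≥0 (^≥0 0≤y′ k) (^≥0 0≤y′ k)) (^≥0 0≤z′ j)))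

-- Sums over primes, the sieved harmonic sum, and the size of n.

module PrimeSums where

  import Data.Integer as ℤ
  open import Data.List using (List; []; _∷_; filter; downFrom; length)
  open import Data.List.Membership.Propositional using (_∈_)
  open import Data.List.Membership.Propositional.Properties using (∈-filter⁺; ∈-downFrom⁺; ∈-downFrom⁻)
  open import Data.List.Properties using (length-filter; length-downFrom)
  open import Data.List.Relation.Unary.All as All using (All; []; _∷_; all?)
  open import Data.List.Relation.Unary.All.Properties using (all-filter) renaming (filter⁺ to All-filter⁺)
  open import Data.List.Relation.Unary.Unique.Propositional using (Unique)
  open import Data.List.Relation.Unary.Unique.Propositional.Properties using (downFrom⁺) renaming (filter⁺ to Unique-filter⁺)
  open import Data.Nat using (zero; suc; z≤n; s≤s)
  open import Data.Nat.Divisibility using (_∣_; _∣?_; ∣⇒≤; m∣m*n; ∣m⇒∣m*n; n∣m⇒m%n≡0)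
  open import Data.Nat.Primality using (Prime; prime?; prime⇒nonZero; prime[2]; ¬prime[0]; ¬prime[1])
  open import Data.Nat.Primality.Factorisation using (factorise)
  import Data.Nat.Properties as ℕ
  open import Data.Product using (∃-syntax; _×_; _,_)
  open import Data.Rational
  open import Data.Rational.Properties
  open import Data.Rational.Solver using (module +-*-Solver)
  open import Relation.Binary.PropositionalEquality
  open import Relation.Nullary using (¬_; Dec; yes; no; contradiction)
  open import Relation.Nullary.Decidable using (¬?)
  open Rationals
  open RealField
  open RealBounds
  open Summation
  open Valuation using (modulus; modulus≢0; ^∣modulus)
  open Expectation using (u; 0≤u)
  open +-*-Solver

  primes : ℕ → List ℕ
  primes y = filter prime? (downFrom y)

  primes-prime : ∀ y → All Prime (primes y)
  primes-prime y = all-filter prime? (downFrom y)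

  primes-unique : ∀ y → Unique (primes y)
  primes-unique y = Unique-filter⁺ prime? (downFrom⁺ y)

  primes-< : ∀ y → All (ℕ._< y) (primes y)
  primes-< y = All-filter⁺ prime? (All.tabulate ∈-downFrom⁻)

  ∈-primes : ∀ {p y} → Prime p → p ℕ.< y → p ∈ primes y
  ∈-primes pp p<y = ∈-filter⁺ prime? (∈-downFrom⁺ p<y) pp

  length-primes : ∀ y → length (primes y) ℕ.≤ y
  length-primes y = subst (length (primes y) ℕ.≤_) (length-downFrom y) (length-filter prime? (downFrom y))

  u≤½ : ∀ {p} → Prime p → u p ≤ ½
  u≤½ {zero}        pp = contradiction pp ¬prime[0]
  u≤½ {suc zero}    pp = contradiction pp ¬prime[1]
  u≤½ {suc (suc p)} pp = recip-antimono {1} {suc p} (s≤s z≤n)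

  Σ-+ : ∀ ps f g → Σ[ ps ] (λ p → f p + g p) ≡ Σ[ ps ] f + Σ[ ps ] g
  Σ-+ []       f g = refl
  Σ-+ (p ∷ ps) f g = trans (cong (f p + g p +_) (Σ-+ ps f g))
    (solve 4 (λ a b c d → (a :+ b) :+ (c :+ d) := (a :+ c) :+ (b :+ d)) refl (f p) (g p) (Σ[ ps ] f) (Σ[ ps ] g))

  Σ-* : ∀ ps c f → Σ[ ps ] (λ p → c * f p) ≡ c * Σ[ ps ] f
  Σ-* []       c f = sym (*-zeroʳ c)
  Σ-* (p ∷ ps) c f = trans (cong (c * f p +_) (Σ-* ps c f)) (sym (*-distribˡ-+ c (f p) (Σ[ ps ] f)))

  Σ-≤ : ∀ (f F : ℕ → ℚ) → 0ℚ ≤ F 0 → (∀ y → F y ≤ F (suc y)) → (∀ {y} → Prime y → f y + F y ≤ F (suc y)) →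
        ∀ y → Σ[ primes y ] f ≤ F y
  Σ-≤ f F base skip take zero = base
  Σ-≤ f F base skip take (suc y) with prime? y
  ... | yes pp = ≤-trans (+-monoʳ-≤ (f y) (Σ-≤ f F base skip take y)) (take pp)
  ... | no  _  = ≤-trans (Σ-≤ f F base skip take y) (skip y)

  -- Crude, but it gives k ≤ μ ≤ y, which keeps 2k below the cap y².
  Σu≤ : ∀ y → Σ[ primes y ] u ≤ ℕ→ℚ y
  Σu≤ = Σ-≤ u ℕ→ℚ ≤-refl (λ y → ℕ→ℚ-mono (ℕ.n≤1+n y)) λ {y} _ →
    subst (u y + ℕ→ℚ y ≤_) (sym (ℕ→ℚ-suc y)) (+-monoˡ-≤ (ℕ→ℚ y) (recip-antimono {0} {ℕ.pred y} z≤n))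

  -- Σ 1/p² telescopes below 1 − 1/(y − 1), since 1/p² ≤ 1/(p − 1) − 1/p.
  Σu²≤1 : ∀ y → Σ[ primes y ] (λ p → u p * u p) ≤ 1ℚ
  Σu²≤1 y = ≤-trans (Σ-≤ (λ p → u p * u p) F ≤-refl skip (λ {p} → take p) y) (F≤1 y)
    where
    F : ℕ → ℚ
    F zero          = 0ℚ
    F (suc zero)    = 0ℚ
    F (suc (suc m)) = 1ℚ - recip m
    F≤1 : ∀ y → F y ≤ 1ℚ
    F≤1 zero          = 0≤1
    F≤1 (suc zero)    = 0≤1
    F≤1 (suc (suc m)) = ≤-by (solve 1 (λ r → con 1ℚ :- (con 1ℚ :- r) := r) refl (recip m)) (<⇒≤ (0<recip m))
    skip : ∀ y → F y ≤ F (suc y)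
    skip zero          = ≤-refl
    skip (suc zero)    = ≤-refl
    skip (suc (suc m)) = +-monoʳ-≤ 1ℚ (neg-antimono-≤ (recip-antimono (ℕ.n≤1+n m)))
    take : ∀ p → Prime p → u p * u p + F p ≤ F (suc p)
    take zero          pp = contradiction pp ¬prime[0]
    take (suc zero)    pp = contradiction pp ¬prime[1]
    -- For a = 1/(p - 1) and b = 1/p one has a - b = ab, so the deficit a - b - b² is b(a - b).
    take (suc (suc m)) pp = ≤-by
      (trans
        (solve 2 (λ a b → (con 1ℚ :- b) :- (b :* b :+ (con 1ℚ :- a)) := a :* con 1ℚ :- b :* con 1ℚ :- b :* b) refl a b)
        (trans
          (cong₂ (λ s t → a * s - b * t - b * b) (sym (recip-inv (suc m))) (sym (recip-inv m)))
          (trans (cong (λ s → a * (b * s) - b * (a * ℕ→ℚ (suc m)) - b * b) (ℕ→ℚ-suc (suc m)))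
            (solve 3 (λ a b x → a :* (b :* (con 1ℚ :+ x)) :- b :* (a :* x) :- b :* b := b :* (a :- b)) refl a b (ℕ→ℚ (suc m))))))
      (*≥0 (<⇒≤ (0<recip (suc m))) (diff≥0 (recip-antimono (ℕ.n≤1+n m))))
      where
      a = recip m
      b = recip (suc m)

  -- 1/m, with the value 0 at m = 0.
  weight : ℕ → ℚ
  weight zero    = 0ℚ
  weight (suc m) = recip m

  0≤weight : ∀ m → 0ℚ ≤ weight m
  0≤weight zero    = ≤-refl
  0≤weight (suc m) = <⇒≤ (0<recip m)

  weight-* : ∀ t p .{{_ : ℕ.NonZero p}} → weight (t ℕ.* p) ≡ u p * weight t
  weight-* zero    p = sym (*-zeroʳ (u p))
  weight-* (suc t) p@(suc q) = begin
    w
      ≡⟨ sym (*-identityʳ w) ⟩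
    w * 1ℚ
      ≡⟨ cong₂ (λ a b → w * (a * b)) (sym (recip-inv t)) (sym (recip-inv q)) ⟩
    w * ((recip t * ℕ→ℚ (suc t)) * (recip q * ℕ→ℚ p))
      ≡⟨ solve 5 (λ w a b c d → w :* ((a :* b) :* (c :* d)) := (w :* (b :* d)) :* (c :* a)) refl w (recip t) (ℕ→ℚ (suc t)) (recip q) (ℕ→ℚ p) ⟩
    (w * (ℕ→ℚ (suc t) * ℕ→ℚ p)) * (recip q * recip t)
      ≡⟨ cong (λ x → (w * x) * (recip q * recip t)) (sym (ℕ→ℚ-* (suc t) p)) ⟩
    (w * ℕ→ℚ (suc t ℕ.* p)) * (recip q * recip t)
      ≡⟨ cong (_* (recip q * recip t)) (recip-inv (q ℕ.+ t ℕ.* p)) ⟩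
    1ℚ * (recip q * recip t)
      ≡⟨ *-identityˡ (recip q * recip t) ⟩
    recip q * recip t ∎
    where
    open ≡-Reasoning
    w = weight (suc t ℕ.* p)

  Unsieved : List ℕ → ℕ → Set
  Unsieved ds m = All (λ d → ¬ d ∣ m) ds

  unsieved? : ∀ ds m → Dec (Unsieved ds m)
  unsieved? ds m = all? (λ d → ¬? (d ∣? m)) ds

  restrict : ∀ {P : Set} → Dec P → ℚ → ℚ
  restrict (yes _) q = q
  restrict (no  _) q = 0ℚ

  restrict≤ : ∀ {P : Set} (d : Dec P) {q} → 0ℚ ≤ q → restrict d q ≤ q
  restrict≤ (yes _) _ = ≤-refl
  restrict≤ (no  _) h = h

  restrict≥0 : ∀ {P : Set} (d : Dec P) {q} → 0ℚ ≤ q → 0ℚ ≤ restrict d q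
  restrict≥0 (yes _) h = h
  restrict≥0 (no  _) _ = ≤-refl

  restrict-yes : ∀ {P : Set} (d : Dec P) {q} → P → restrict d q ≡ q
  restrict-yes (yes _) _ = refl
  restrict-yes (no ¬p) p = contradiction p ¬p

  restrict-no : ∀ {P : Set} (d : Dec P) {q} → ¬ P → restrict d q ≡ 0ℚ
  restrict-no (yes p) ¬p = contradiction p ¬p
  restrict-no (no _)  _  = refl

  sieved : List ℕ → ℕ → ℚ
  sieved ds m = restrict (unsieved? ds m) (weight m)

  sieved≥0 : ∀ ds m → 0ℚ ≤ sieved ds m
  sieved≥0 ds m = restrict≥0 (unsieved? ds m) (0≤weight m)

  S-≤-extend : ∀ {f : ℕ → ℚ} → (∀ i → 0ℚ ≤ f i) → ∀ {m n} → m ℕ.≤′ n → S m f ≤ S n f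
  S-≤-extend h ℕ.≤′-refl = ≤-refl
  S-≤-extend {f} h {m} {suc n} (ℕ.≤′-step l) = ≤-trans (S-≤-extend h l)
    (≤-by (solve 2 (λ a b → (a :+ b) :- a := b) refl (S n f) (f n)) (h n))

  -- What d removes are the terms 1/(td) = (1/d)(1/t). Here t is again unsieved by `ds`, because a
  -- divisor of t divides td; so at most 1/d of the old sum is lost.
  sieve-step : ∀ y d .{{_ : ℕ.NonZero d}} ds → S y (sieved ds) ≤ S y (sieved (d ∷ ds)) + u d * S y (sieved ds)
  sieve-step y d@(suc d′) ds = begin
    S y (sieved ds)
      ≤⟨ S-mono y (λ m _ → split m) ⟩
    S y (λ m → sieved (d ∷ ds) m + multiples m)
      ≡⟨ S-+ y (sieved (d ∷ ds)) multiples ⟩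
    S y (sieved (d ∷ ds)) + S y multiples
      ≤⟨ +-monoʳ-≤ (S y (sieved (d ∷ ds))) (≤-trans
           -- Extending the range to yd makes the multiples of d exactly the td with t < y.
           (S-≤-extend (λ m → restrict≥0 (d ∣? m) (sieved≥0 ds m)) (ℕ.≤⇒≤′ (ℕ.m≤m*n y d)))
           (≤-reflexive (trans (Expectation.S-multiples y d′ {g = λ _ → 0ℚ} (λ t → refl) (λ s h → restrict-no (d ∣? s) λ d∣s → h (n∣m⇒m%n≡0 s d d∣s)))
             (trans (cong₂ (λ a b → (S y (λ t → multiples (t ℕ.* d)) - a) + b) (S-0 y) (S-0 (y ℕ.* d)))
               (solve 1 (λ x → (x :- con 0ℚ) :+ con 0ℚ := x) refl (S y (λ t → multiples (t ℕ.* d)))))))) ⟩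
    S y (sieved (d ∷ ds)) + S y (λ t → multiples (t ℕ.* d))
      ≤⟨ +-monoʳ-≤ (S y (sieved (d ∷ ds))) (S-mono y λ t _ → scale t) ⟩
    S y (sieved (d ∷ ds)) + S y (λ t → u d * sieved ds t)
      ≡⟨ cong (S y (sieved (d ∷ ds)) +_) (S-* y (u d) (sieved ds)) ⟩
    S y (sieved (d ∷ ds)) + u d * S y (sieved ds) ∎
    where
    open ≤-Reasoning
    multiples : ℕ → ℚ
    multiples m = restrict (d ∣? m) (sieved ds m)
    split : ∀ m → sieved ds m ≤ sieved (d ∷ ds) m + multiples m
    split m with d ∣? m | unsieved? ds m
    ... | yes _ | _     = ≤-reflexive (sym (+-identityˡ _))
    ... | no  _ | yes _ = ≤-reflexive (sym (+-identityʳ (weight m)))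
    ... | no  _ | no  _ = ≤-refl
    scale : ∀ t → multiples (t ℕ.* d) ≤ u d * sieved ds t
    scale t = ≤-trans (restrict≤ (d ∣? t ℕ.* d) (sieved≥0 ds (t ℕ.* d))) (cases (unsieved? ds (t ℕ.* d)))
      where
      cases : (c : Dec (Unsieved ds (t ℕ.* d))) → restrict c (weight (t ℕ.* d)) ≤ u d * sieved ds t
      cases (no  _) = *≥0 (0≤u d) (sieved≥0 ds t)
      cases (yes h) = ≤-reflexive (trans (weight-* t d)
        (cong (u d *_) (sym (restrict-yes (unsieved? ds t) (All.map (λ ¬d∣ d∣t → ¬d∣ (∣m⇒∣m*n d d∣t)) h)))))

  -- Solving T ≤ T′ + uT for T asks for 1/(1 - u) = 1 + u + u²/(1 - u), which is at most 1 + u + 2u²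
  -- for u ≤ ½.
  factor : ℕ → ℚ
  factor p = u p + ℕ→ℚ 2 * (u p * u p)

  0≤1+factor : ∀ p → 0ℚ ≤ 1ℚ + factor p
  0≤1+factor p = +≥0 0≤1 (+≥0 (0≤u p) (*≥0 (0≤ℕ→ℚ 2) (*≥0 (0≤u p) (0≤u p))))

  sieve : ∀ y {ds} → All Prime ds → S y (sieved []) ≤ Π[ ds ] (λ p → 1ℚ + factor p) * S y (sieved ds)
  sieve y [] = ≤-reflexive (sym (*-identityˡ (S y (sieved []))))
  sieve y {d ∷ ds} (pd ∷ pds) = ≤-trans (sieve y pds) (begin
    R * T
      ≤⟨ *-mono 0≤R ≤-refl (S≥0) T≤ ⟩
    R * (c * T′)
      ≡⟨ solve 3 (λ r c t → r :* (c :* t) := (c :* r) :* t) refl R c T′ ⟩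
    (c * R) * T′ ∎)
    where
    open ≤-Reasoning
    R = Π[ ds ] (λ p → 1ℚ + factor p)
    T = S y (sieved ds)
    T′ = S y (sieved (d ∷ ds))
    c = 1ℚ + factor d
    U = u d
    0≤R : 0ℚ ≤ R
    0≤R = Π≥0 {ps = ds} (All.tabulate λ {p} _ → 0≤1+factor p)
    S≥0 : 0ℚ ≤ T
    S≥0 = ≤-trans (≤-reflexive (sym (S-0 y))) (S-mono y λ m _ → sieved≥0 ds m)
    T≤ : T ≤ c * T′
    T≤ = ≤-by
      (solve 3 (λ T T′ U → (con 1ℚ :+ (U :+ con (ℕ→ℚ 2) :* (U :* U))) :* T′ :- T :=
          (con 1ℚ :+ (U :+ con (ℕ→ℚ 2) :* (U :* U))) :* ((T′ :+ U :* T) :- T)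
            :+ (con (ℕ→ℚ 2) :* ((U :* U) :* T)) :* (con ½ :- U)) refl T T′ U)
      (+≥0 (*≥0 (0≤1+factor d) (diff≥0 (sieve-step y d {{prime⇒nonZero pd}} ds)))
        (*≥0 (*≥0 (0≤ℕ→ℚ 2) (*≥0 (*≥0 (0≤u d) (0≤u d)) S≥0)) (diff≥0 (u≤½ pd))))

  prime-divisor : ∀ m → ∃[ p ] Prime p × p ∣ suc (suc m)
  prime-divisor m with factorise (suc (suc m))
  ... | record { factors = [] ; isFactorisation = () }
  ... | record { factors = p ∷ ps ; isFactorisation = eq ; factorsPrime = pp ∷ _ } =
    p , pp , subst (p ∣_) (sym eq) (m∣m*n _)

  -- Every m with 2 ≤ m < y has a prime divisor below y, so of the whole harmonic sum only the term
  -- m = 1 survives.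
  fully-sieved : ∀ x → S (suc (suc x)) (sieved (primes (suc (suc x)))) ≤ 1ℚ
  fully-sieved x = begin
    S y f
      ≡⟨ S-head (suc x) f ⟩
    f 0 + S (suc x) (λ i → f (suc i))
      ≡⟨ cong (f 0 +_) (S-head x (λ i → f (suc i))) ⟩
    f 0 + (f 1 + S x (λ i → f (suc (suc i))))
      ≤⟨ +-mono-≤ (restrict≤ (unsieved? (primes y) 0) ≤-refl)
           (+-mono-≤ (restrict≤ (unsieved? (primes y) 1) 0≤1) (≤-trans (S-mono x λ i i<x → ≤-reflexive (gone i i<x)) (≤-reflexive (S-0 x)))) ⟩
    0ℚ + (1ℚ + 0ℚ) ≡⟨ refl ⟩
    1ℚ ∎
    where
    open ≤-Reasoning
    y = suc (suc x)
    f = sieved (primes y)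
    gone : ∀ i → i ℕ.< x → f (suc (suc i)) ≡ 0ℚ
    gone i i<x = let p , pp , p∣ = prime-divisor i in restrict-no (unsieved? (primes y) (suc (suc i))) λ h →
      All.lookup h (∈-primes pp (ℕ.≤-<-trans (∣⇒≤ p∣) (s≤s (s≤s i<x)))) p∣

  H : ℕ → ℚ
  H y = S y weight

  0≤H : ∀ y → 0ℚ ≤ H y
  0≤H y = ≤-trans (≤-reflexive (sym (S-0 y))) (S-mono y λ m _ → 0≤weight m)

  -- The sieve bounds the harmonic sum by a product, hence by exp Σ(1/p + 2/p²); the 2 in the
  -- exponent comes from Σ 1/p² ≤ 1.
  H≤E : ∀ x → ⟨ H (suc (suc x)) ⟩ ≤ʳ E ⟨ Σ[ primes (suc (suc x)) ] u + ℤ.+ 2 / 1 ⟩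
  H≤E x = ≤ʳ-trans (⟨⟩-mono H≤Π) (≤ʳ-trans
    (≤E-Π {y = factor} {ps = ps} (All.tabulate λ {p} _ → 0≤1+factor p) (All.tabulate λ _ → ≤-refl))
    (E-mono (⟨⟩-mono (subst (_≤ Σ[ ps ] u + ℤ.+ 2 / 1)
      (sym (trans (Σ-+ ps u (λ p → ℕ→ℚ 2 * (u p * u p))) (cong (Σ[ ps ] u +_) (Σ-* ps (ℕ→ℚ 2) (λ p → u p * u p)))))
      (+-monoʳ-≤ (Σ[ ps ] u) (subst (ℕ→ℚ 2 * Σ[ ps ] (λ p → u p * u p) ≤_) (*-identityʳ (ℕ→ℚ 2))
        (*-monoˡ-≤-nonNeg (ℕ→ℚ 2) (Σu²≤1 y))))))))
    where
    y = suc (suc x)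
    ps = primes y
    R = Π[ ps ] (λ p → 1ℚ + factor p)
    H≤Π : H y ≤ R
    H≤Π = ≤-trans (sieve y (primes-prime y))
      (subst (R * S y (sieved ps) ≤_) (*-identityʳ R)
        (*-monoˡ-≤-nonNeg R {{nonNegative (Π≥0 {ps = ps} (All.tabulate λ {p} _ → 0≤1+factor p))}} (fully-sieved x)))

  -- 1 + 1/m ≤ exp (1/m), and the product of the left-hand sides telescopes.
  ≤E-H : ∀ x → ⟨ ℕ→ℚ (suc x) ⟩ ≤ʳ E ⟨ H (suc x) ⟩
  ≤E-H zero    = 1≤E0
  ≤E-H (suc x) = subst₂ (λ p q → ⟨ p ⟩ ≤ʳ E q)
    (trans (solve 2 (λ y r → y :* (con 1ℚ :+ r) := y :+ r :* y) refl Y (recip x))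
      (trans (cong (Y +_) (recip-inv x)) (trans (+-comm Y 1ℚ) (sym (ℕ→ℚ-suc (suc x))))))
    refl
    (≤ʳ-trans (≤E* (0≤ℕ→ℚ (suc x)) (+≥0 0≤1 (<⇒≤ (0<recip x))) (≤E-H x)
        (≤ʳ-trans (≈⇒≤ (⟨+⟩ 1ℚ (recip x))) (1⊕≤E ⟨ recip x ⟩)))
      (≈⇒≤ (E-cong (≈-sym (⟨+⟩ (H (suc x)) (recip x))))))
    where Y = ℕ→ℚ (suc x)

  ℕ→ℚ-^ : ∀ p e → ℕ→ℚ (p ℕ.^ e) ≡ ℕ→ℚ p ^ e
  ℕ→ℚ-^ p zero    = refl
  ℕ→ℚ-^ p (suc e) = trans (ℕ→ℚ-* p (p ℕ.^ e)) (cong (ℕ→ℚ p *_) (ℕ→ℚ-^ p e))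

  modulus≤E : ∀ {x} e {ps} → All (λ p → ⟨ ℕ→ℚ p ⟩ ≤ʳ E x) ps →
              ⟨ ℕ→ℚ (modulus ps e) ⟩ ≤ʳ E (⟨ ℕ→ℚ (length ps) ⟩ ⊗ (⟨ ℕ→ℚ e ⟩ ⊗ x))
  modulus≤E {x} e [] = ≤ʳ-trans 1≤E0 (≈⇒≤ (E-cong (Solver.solve 1 (λ x → Solver.con 0ℚ Solver.:= Solver.con 0ℚ Solver.:* x) ≈-refl (⟨ ℕ→ℚ e ⟩ ⊗ x))))
  modulus≤E {x} e {p ∷ ps} (h ∷ hs) = ≤ʳ-trans
    (subst (λ q → ⟨ q ⟩ ≤ʳ E ((⟨ ℕ→ℚ e ⟩ ⊗ x) ⊕ (⟨ ℕ→ℚ (length ps) ⟩ ⊗ (⟨ ℕ→ℚ e ⟩ ⊗ x))))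
      (trans (cong (_* ℕ→ℚ (modulus ps e)) (sym (ℕ→ℚ-^ p e))) (sym (ℕ→ℚ-* (p ℕ.^ e) (modulus ps e))))
      (≤E* (^≥0 (0≤ℕ→ℚ p) e) (0≤ℕ→ℚ (modulus ps e)) (≤E-^ (0≤ℕ→ℚ p) h e) (modulus≤E e hs)))
    (≈⇒≤ (E-cong (≈-trans
      (Solver.solve 2 (λ z k → z Solver.:+ k Solver.:* z Solver.:= (Solver.con 1ℚ Solver.:+ k) Solver.:* z) ≈-refl (⟨ ℕ→ℚ e ⟩ ⊗ x) ⟨ ℕ→ℚ (length ps) ⟩)
      (⊗-cong (≈-trans (≈-sym (⟨+⟩ 1ℚ (ℕ→ℚ (length ps)))) (subst (λ z → ⟨ 1ℚ + ℕ→ℚ (length ps) ⟩ ≈ ⟨ z ⟩) (sym (ℕ→ℚ-suc (length ps))) ≈-refl)) ≈-refl))))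

  -- At most y primes, each with exponent y² and each at most y ≤ exp y, give y · y² · y. In log log
  -- n this crudeness costs only a constant factor.
  modulus-primes≤E : ∀ y → ⟨ ℕ→ℚ (modulus (primes y) (y ℕ.* y)) ⟩ ≤ʳ E ⟨ (ℕ→ℚ y * ℕ→ℚ y) * (ℕ→ℚ y * ℕ→ℚ y) ⟩
  modulus-primes≤E y = ≤ʳ-trans
    (modulus≤E {⟨ Y ⟩} (y ℕ.* y) (All.map (λ {p} p<y → ≤ʳ-trans (⟨⟩-mono (ℕ→ℚ-mono (ℕ.<⇒≤ p<y))) Y≤EY) (primes-< y)))
    (E-mono (≤ʳ-trans (≈⇒≤ (≈-trans (⊗-cong ≈-refl (≈-sym (⟨*⟩ (ℕ→ℚ (y ℕ.* y)) Y))) (≈-sym (⟨*⟩ (ℕ→ℚ (length (primes y))) (ℕ→ℚ (y ℕ.* y) * Y)))))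
      (⟨⟩-mono (≤-trans
        (*-monoʳ-≤-nonNeg (ℕ→ℚ (y ℕ.* y) * Y) {{nonNegative (*≥0 (0≤ℕ→ℚ (y ℕ.* y)) (0≤ℕ→ℚ y))}} (ℕ→ℚ-mono (length-primes y)))
        (≤-reflexive (trans (cong (λ z → Y * (z * Y)) (ℕ→ℚ-* y y))
          (solve 1 (λ y → y :* ((y :* y) :* y) := (y :* y) :* (y :* y)) refl Y)))))))
    where
    Y = ℕ→ℚ y
    Y≤EY : ⟨ Y ⟩ ≤ʳ E ⟨ Y ⟩
    Y≤EY = ≤ʳ-trans (⟨⟩-mono (≤-by (solve 1 (λ y → (con 1ℚ :+ y) :- y := con 1ℚ) refl Y) 0≤1))
      (≤ʳ-trans (≈⇒≤ (⟨+⟩ 1ℚ Y)) (1⊕≤E ⟨ Y ⟩))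

  n<2^n : ∀ n → n ℕ.< 2 ℕ.^ n
  n<2^n zero    = s≤s z≤n
  n<2^n (suc n) = begin-strict
    suc n                      <⟨ s≤s (n<2^n n) ⟩
    suc (2 ℕ.^ n)              ≡⟨ ℕ.+-comm 1 (2 ℕ.^ n) ⟩
    2 ℕ.^ n ℕ.+ 1              ≤⟨ ℕ.+-monoʳ-≤ (2 ℕ.^ n) (ℕ.≤-trans (ℕ.m^n>0 2 n) (ℕ.m≤m+n (2 ℕ.^ n) 0)) ⟩
    2 ℕ.* 2 ℕ.^ n ∎
    where open ℕ.≤-Reasoning

  -- For y > 2 the prime 2 takes part, so 2ᵉ divides the modulus. This makes the constructed n
  -- exceed every given N.
  modulus-primes> : ∀ {y e} → 2 ℕ.< y → e ℕ.< modulus (primes y) e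
  modulus-primes> {y} {e} 2<y = ℕ.<-≤-trans (n<2^n e)
    (∣⇒≤ {{modulus≢0 (primes-prime y) e}} (All.lookup (^∣modulus (primes y) e) (∈-primes prime[2] 2<y)))

-- Choice of the parameters and of the constant.

module Assembly where

  import Data.Integer as ℤ
  import Data.List.Relation.Unary.All as All
  open import Data.Nat using (suc; z≤n; s≤s)
  import Data.Nat.Properties as ℕ
  open import Data.Product using (∃-syntax; _×_; _,_; proj₁; proj₂)
  open import Data.Rational
  open import Data.Rational.Properties
  open import Data.Rational.Solver using (module +-*-Solver)
  open import Relation.Binary.PropositionalEquality
  open Rationals
  open Sequences using (inv; inv-spec)
  open RealField
  open RealBounds
  open Estimates
  open Valuation using (modulus; modulus≢0)
  open Expectation using (u; ω; ω≥0; ω≤-small; ω≤-large)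
  open Density using (1-D≤)
  open PrimeSums
  open +-*-Solver

  ℕ→ℚ-cancel-≤ : ∀ {j k} → ℕ→ℚ j ≤ ℕ→ℚ k → j ℕ.≤ k
  ℕ→ℚ-cancel-≤ {j} {k} h = ℕ.≮⇒≥ λ k<j → <-irrefl refl (<-≤-trans
    (<-by {ℕ→ℚ k} {1ℚ + ℕ→ℚ k} (solve 1 (λ k → (con 1ℚ :+ k) :- k := con 1ℚ) refl (ℕ→ℚ k)) 0<1)
    (≤-trans (subst (_≤ ℕ→ℚ j) (ℕ→ℚ-suc k) (ℕ→ℚ-mono k<j)) h))

  module _ (x : ℕ) (32≤μ : ℕ→ℚ 32 ≤ Σ[ primes (suc (suc x)) ] u) where

    y n : ℕ
    y = suc (suc x)
    n = modulus (primes y) (y ℕ.* y)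

    n≢0 : ℕ.NonZero n
    n≢0 = modulus≢0 (primes-prime y) (y ℕ.* y)

    private
      μ : ℚ
      μ = Σ[ primes y ] u

      0<μ : 0ℚ < μ
      0<μ = <-≤-trans (positive⁻¹ (ℕ→ℚ 32)) 32≤μ

      0≤μ = <⇒≤ 0<μ

      0≤¼μ : 0ℚ ≤ μ * ¼
      0≤¼μ = *≥0 0≤μ (nonNegative⁻¹ ¼)

      centre : ∃[ k ] ⟨ μ * ¼ ⟩ ⊗ e ≤ʳ ⟨ ℕ→ℚ k ⟩ × ⟨ ℕ→ℚ k ⟩ ≤ʳ ⟨ μ * ¼ ⟩ ⊗ e ⊕ ⟨ ℤ.+ 2 / 1 ⟩
      centre = ≤ceiling≤ (⟨ μ * ¼ ⟩ ⊗ e) (⊗≥0 (⟨⟩-mono 0≤¼μ) (E≥0 ⟨ 1ℚ ⟩))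

      k : ℕ
      k = proj₁ centre

      lower = proj₁ (proj₂ centre)
      upper = proj₂ (proj₂ centre)

      κ : ℚ
      κ = ℕ→ℚ k

      -- Follows from e ≥ 2, and places the upper parameter 2k/μ at or above 1.
      ½μ≤κ : μ * ¼ * (ℤ.+ 2 / 1) ≤ κ
      ½μ≤κ = ⟨⟩-cancel (≤ʳ-trans (≈⇒≤ (⟨*⟩ (μ * ¼) (ℤ.+ 2 / 1))) (≤ʳ-trans
        (⊗-mono-≤ (⟨⟩-mono 0≤¼μ) ≤ʳ-refl (⟨⟩-mono (nonNegative⁻¹ (ℤ.+ 2 / 1))) 2≤e) lower))

      κ≤ : κ ≤ μ * ¼ * (ℤ.+ 11 / 4) + ℤ.+ 2 / 1
      κ≤ = ⟨⟩-cancel (≤ʳ-trans upper (≤ʳ-trans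
        (⊕-mono-≤ (⊗-mono-≤ (⟨⟩-mono 0≤¼μ) ≤ʳ-refl (E≥0 ⟨ 1ℚ ⟩) e≤11/4) ≤ʳ-refl)
        (≈⇒≤ (≈-sym (≈-trans (⟨+⟩ (μ * ¼ * (ℤ.+ 11 / 4)) (ℤ.+ 2 / 1)) (⊕-cong (⟨*⟩ (μ * ¼) (ℤ.+ 11 / 4)) ≈-refl))))))

      -- e ≤ 11/4 gives k ≤ 11μ/16 + 2, and the rounding error 2 fits into the remaining μ/16
      -- exactly when μ ≥ 32. The bound ¾ keeps 2k/μ ≤ 3/2, the range of `ω≤-large`.
      κ≤¾μ : κ ≤ (ℤ.+ 3 / 4) * μ
      κ≤¾μ = ≤-trans κ≤ (≤-by
        (solve 1 (λ m → con (ℤ.+ 3 / 4) :* m :- (m :* con ¼ :* con (ℤ.+ 11 / 4) :+ con (ℤ.+ 2 / 1)) :=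
          con (ℤ.+ 1 / 16) :* (m :- con (ℕ→ℚ 32))) refl μ)
        (*≥0 (nonNegative⁻¹ (ℤ.+ 1 / 16)) (diff≥0 32≤μ)))

      κ≤μ : κ ≤ μ
      κ≤μ = ≤-trans κ≤¾μ (≤-by (solve 1 (λ m → m :- con (ℤ.+ 3 / 4) :* m := con ¼ :* m) refl μ) (*≥0 (nonNegative⁻¹ ¼) 0≤μ))

      0<κ : 0ℚ < κ
      0<κ = <-≤-trans (*>0 (*>0 0<μ (positive⁻¹ ¼)) (positive⁻¹ (ℤ.+ 2 / 1))) ½μ≤κ

      0≤κ = <⇒≤ 0<κ

      -- `z` is k/μ and `1 + w` is 2k/μ, the points where exp((z - 1)μ) divided by zᵏ, respectively
      -- by z²ᵏ, is least.
      iκ iμ z w : ℚ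
      iκ = inv κ
      iμ = inv μ
      z = κ * iμ
      w = (z + z) - 1ℚ

      0≤iκ = <⇒≤ (proj₁ (inv-spec κ 0<κ))
      0≤iμ = <⇒≤ (proj₁ (inv-spec μ 0<μ))

      κ*iκ≡1 : κ * iκ ≡ 1ℚ
      κ*iκ≡1 = proj₂ (inv-spec κ 0<κ)

      μ*iμ≡1 : μ * iμ ≡ 1ℚ
      μ*iμ≡1 = proj₂ (inv-spec μ 0<μ)

      0≤z : 0ℚ ≤ z
      0≤z = *≥0 0≤κ 0≤iμ

      z≤1 : z ≤ 1ℚ
      z≤1 = subst (z ≤_) μ*iμ≡1 (*-mono 0≤κ κ≤μ 0≤iμ ≤-refl)

      1≤z⁻¹ : 1ℚ ≤ μ * iκ
      1≤z⁻¹ = subst (_≤ μ * iκ) κ*iκ≡1 (*-mono 0≤κ κ≤μ 0≤iκ ≤-refl)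

      0≤w : 0ℚ ≤ w
      0≤w = ≤-by
        (trans (cong (λ o → ((z + z) - o) - 0ℚ) (sym μ*iμ≡1))
          (solve 3 (λ κ μ i → ((κ :* i :+ κ :* i) :- μ :* i) :- con 0ℚ :=
            (con (ℤ.+ 2 / 1) :* (κ :- μ :* con ¼ :* con (ℤ.+ 2 / 1))) :* i) refl κ μ iμ))
        (*≥0 (*≥0 (nonNegative⁻¹ (ℤ.+ 2 / 1)) (diff≥0 ½μ≤κ)) 0≤iμ)

      w≤½ : w ≤ ½
      w≤½ = ≤-by
        (trans (solve 1 (λ z → con ½ :- ((z :+ z) :- con 1ℚ) := con (ℤ.+ 3 / 2) :* con 1ℚ :- (z :+ z)) refl z)
          (trans (cong (λ o → (ℤ.+ 3 / 2) * o - (z + z)) (sym μ*iμ≡1))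
            (solve 3 (λ κ μ i → con (ℤ.+ 3 / 2) :* (μ :* i) :- (κ :* i :+ κ :* i) :=
              (con (ℤ.+ 2 / 1) :* (con (ℤ.+ 3 / 4) :* μ :- κ)) :* i) refl κ μ iμ)))
        (*≥0 (*≥0 (nonNegative⁻¹ (ℤ.+ 2 / 1)) (diff≥0 κ≤¾μ)) 0≤iμ)

      0≤1+w : 0ℚ ≤ 1ℚ + w
      0≤1+w = +≥0 0≤1 0≤w

      1≤1+w : 1ℚ ≤ 1ℚ + w
      1≤1+w = ≤-by (solve 1 (λ w → (con 1ℚ :+ w) :- con 1ℚ := w) refl w) 0≤w

      z⁻¹*z≡1 : (μ * iκ) * z ≡ 1ℚ
      z⁻¹*z≡1 = trans (solve 4 (λ μ i κ j → (μ :* i) :* (κ :* j) := (κ :* i) :* (μ :* j)) refl μ iκ κ iμ)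
        (cong₂ _*_ κ*iκ≡1 μ*iμ≡1)

      half-inverse : (½ * (μ * iκ)) * (1ℚ + w) ≡ 1ℚ
      half-inverse = trans (solve 2 (λ a z → (con ½ :* a) :* (con 1ℚ :+ ((z :+ z) :- con 1ℚ)) := a :* z) refl (μ * iκ) z) z⁻¹*z≡1

      2k≤y² : k ℕ.+ k ℕ.≤ y ℕ.* y
      2k≤y² = ℕ.≤-trans (ℕ.+-mono-≤ k≤y k≤y) (ℕ.≤-trans (ℕ.≤-reflexive (cong (y ℕ.+_) (sym (ℕ.+-identityʳ y))))
        (ℕ.*-monoˡ-≤ y {2} {y} (s≤s (s≤s z≤n))))
        where
        k≤y : k ℕ.≤ y
        k≤y = ℕ→ℚ-cancel-≤ (≤-trans κ≤μ (Σu≤ y))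

      A₁ A₂ : ℚ
      A₁ = Π[ primes y ] (ω z (y ℕ.* y))
      A₂ = Π[ primes y ] (ω (1ℚ + w) (y ℕ.* y))

      0≤A₁ : 0ℚ ≤ A₁
      0≤A₁ = Π≥0 {ps = primes y} (All.tabulate λ {p} _ → ω≥0 {z} {p} 0≤z (y ℕ.* y))

      0≤A₂ : 0ℚ ≤ A₂
      0≤A₂ = Π≥0 {ps = primes y} (All.tabulate λ {p} _ → ω≥0 {1ℚ + w} {p} 0≤1+w (y ℕ.* y))

      A₁≤E : ⟨ A₁ ⟩ ≤ʳ E ⟨ κ - μ ⟩
      A₁≤E = subst (λ q → ⟨ A₁ ⟩ ≤ʳ E ⟨ q ⟩)
        (trans (Σ-* (primes y) (z - 1ℚ) u)
          (trans (solve 3 (λ κ i μ → (κ :* i :- con 1ℚ) :* μ := κ :* (μ :* i) :- μ) refl κ iμ μ)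
            (trans (cong (λ o → κ * o - μ) μ*iμ≡1) (cong (_- μ) (*-identityʳ κ)))))
        (≤E-Π {y = λ p → (z - 1ℚ) * u p} {ps = primes y}
          (All.tabulate λ {p} _ → ω≥0 {z} {p} 0≤z (y ℕ.* y))
          (All.tabulate λ {p} _ → ω≤-small p 0≤z z≤1 (ℕ.pred (y ℕ.* y))))

      -- The linear terms sum to wμ = 2k - μ, and the second-order terms to at most 3 Σ 1/p² ≤ 3.
      A₂≤E : ⟨ A₂ ⟩ ≤ʳ E ⟨ ((κ + κ) - μ) + ℤ.+ 3 / 1 ⟩
      A₂≤E = ≤ʳ-trans
        (≤E-Π {y = λ p → w * u p + ℕ→ℚ 3 * (u p * u p)} {ps = primes y}
          (All.tabulate λ {p} _ → ω≥0 {1ℚ + w} {p} 0≤1+w (y ℕ.* y))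
          (All.map (λ {p} pp → ω≤-large p 0≤w w≤½ (u≤½ pp) (y ℕ.* y)) (primes-prime y)))
        (E-mono (⟨⟩-mono (≤-trans (≤-reflexive exponent)
          (+-monoʳ-≤ ((κ + κ) - μ) (*-monoˡ-≤-nonNeg (ℕ→ℚ 3) (Σu²≤1 y))))))
        where
        u² : ℕ → ℚ
        u² p = u p * u p
        exponent : Σ[ primes y ] (λ p → w * u p + ℕ→ℚ 3 * u² p) ≡ ((κ + κ) - μ) + ℕ→ℚ 3 * Σ[ primes y ] u²
        exponent = trans (Σ-+ (primes y) (λ p → w * u p) (λ p → ℕ→ℚ 3 * u² p))
          (cong₂ _+_
            (trans (Σ-* (primes y) w u)
              (trans (solve 3 (λ κ i μ → ((κ :* i :+ κ :* i) :- con 1ℚ) :* μ := (κ :+ κ) :* (μ :* i) :- μ) refl κ iμ μ)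
                (trans (cong (λ o → (κ + κ) * o - μ) μ*iμ≡1) (cong (_- μ) (*-identityʳ (κ + κ))))))
            (Σ-* (primes y) (ℕ→ℚ 3) u²))

    -- `L₃` stands for log log log n. The bound 2 exp 12 does not depend on x, so one constant
    -- serves all n.
    deficit≤ : ∀ {L₁ L₂ L₃} → E L₁ ≈ ⟨ ℕ→ℚ n ⟩ → E L₂ ≈ L₁ → E L₃ ≈ L₂ →
               ⟨ 1ℚ - D n {{n≢0}} ⟩ ⊗ E (α ⊗ L₃) ≤ʳ ⟨ ℤ.+ 2 / 1 ⟩ ⊗ E ⟨ ℤ.+ 12 / 1 ⟩
    deficit≤ {L₃ = L₃} e₁ e₂ e₃ = ≤ʳ-trans (≈⇒≤ (⊗-cong ≈-refl (E-cong (⊗-cong α≈ ≈-refl))))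
      (tails≤ k 0≤μ 0≤iκ κ*iκ≡1 lower upper
        (logloglog≤ {μ = μ} (0≤ℕ→ℚ y) (0≤H y) (modulus-primes≤E y) (≤E-H (suc x)) (H≤E x) e₁ e₂ e₃)
        0≤A₁ A₁≤E 0≤A₂ A₂≤E
        (1-D≤ (primes y) (y ℕ.* y) k (primes-prime y) (primes-unique y) 2k≤y²
          1≤z⁻¹ 0≤z z⁻¹*z≡1 (*≥0 (nonNegative⁻¹ ½) (≤-trans 0≤1 1≤z⁻¹)) 1≤1+w half-inverse {{n≢0}}))

  -- y ≤ exp H ≤ exp (exp (μ + 2)), so μ is large once y is.
  unbounded-Σu : ∀ {m} → E (E ⟨ ℕ→ℚ 34 ⟩) ≤ʳ ⟨ ℕ→ℚ m ⟩ → ∀ x → m ℕ.≤ x → ℕ→ℚ 32 ≤ Σ[ primes (suc (suc x)) ] u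
  unbounded-Σu {m} hm x m≤x = ≮⇒≥ λ μ<32 → ℕ.<⇒≱ (s≤s (ℕ.m≤n⇒m≤1+n m≤x)) (ℕ→ℚ-cancel-≤ (⟨⟩-cancel
    (≤ʳ-trans (≤E-H (suc x)) (≤ʳ-trans (E-mono (≤ʳ-trans (H≤E x)
      (E-mono (⟨⟩-mono (+-monoˡ-≤ (ℤ.+ 2 / 1) (<⇒≤ μ<32)))))) hm))))

  K : ℚ
  K = ℕ→ℚ (proj₁ (≤⟨ℕ⟩ (⟨ ℤ.+ 2 / 1 ⟩ ⊗ E ⟨ ℤ.+ 12 / 1 ⟩)))

  0<K+1 : 0ℚ < K + 1ℚ
  0<K+1 = +-mono-≤-< (0≤ℕ→ℚ (proj₁ (≤⟨ℕ⟩ (⟨ ℤ.+ 2 / 1 ⟩ ⊗ E ⟨ ℤ.+ 12 / 1 ⟩)))) 0<1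

  C : ℝ
  C = fromℚ (K + 1ℚ)

  0<C : 0ʳ <ʳ C
  0<C = RealOrder.≤ʳ⇒<ʳ {C} 0<K+1 (≤ʳ-refl {C})

  module _ (N : ℕ) where

    private
      threshold = ≤⟨ℕ⟩ (E (E ⟨ ℕ→ℚ 34 ⟩))
      m = proj₁ threshold

      index : ℕ
      -- The summand m forces μ ≥ 32, N makes n exceed N, and 16 makes both iterated logarithms
      -- positive and y larger than 2.
      index = m ℕ.+ (N ℕ.+ 16)

      32≤μ : ℕ→ℚ 32 ≤ Σ[ primes (suc (suc index)) ] u
      32≤μ = unbounded-Σu (proj₂ threshold) index (ℕ.m≤m+n m (N ℕ.+ 16))

    witness : ℕ
    witness = n index 32≤μ

    private
      N+16≤ : N ℕ.+ 16 ℕ.≤ y index 32≤μ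
      N+16≤ = ℕ.≤-trans (ℕ.m≤n+m (N ℕ.+ 16) m) (ℕ.m≤n⇒m≤1+n (ℕ.n≤1+n index))

      y<n : y index 32≤μ ℕ.< witness
      y<n = ℕ.≤-<-trans (ℕ.m≤m*n (y index 32≤μ) (y index 32≤μ))
        (modulus-primes> (ℕ.<-≤-trans (s≤s (s≤s (s≤s z≤n))) (ℕ.≤-trans (ℕ.m≤n+m 16 N) N+16≤)))

    N<witness : N ℕ.< witness
    N<witness = ℕ.≤-<-trans (ℕ.≤-trans (ℕ.m≤m+n N 16) N+16≤) y<n

    16≤witness : 16 ℕ.≤ witness
    16≤witness = ℕ.≤-trans (ℕ.m≤n+m 16 N) (ℕ.≤-trans N+16≤ (ℕ.<⇒≤ y<n))

    witness≢0 : ℕ.NonZero witness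
    witness≢0 = n≢0 index 32≤μ

    log₁ : ℝ
    log₁ = log (fromℕ witness) (fromℕ-positive witness {{witness≢0}})

    2≤log₁ : ⟨ ℤ.+ 2 / 1 ⟩ ≤ʳ log₁
    2≤log₁ = 2≤log witness {{witness≢0}} 16≤witness

    0<log₁ : 0ʳ <ʳ log₁
    0<log₁ = ⟨⟩≤⇒0< (positive⁻¹ (ℤ.+ 2 / 1)) 2≤log₁

    log₂ : ℝ
    log₂ = log log₁ 0<log₁

    0<log₂ : 0ʳ <ʳ log₂
    0<log₂ = ⟨⟩≤⇒0< (positive⁻¹ ½) (½≤log log₁ 0<log₁ 2≤log₁)

    D-witness : 1ʳ -ʳ quotient C (pow log₂ 0<log₂ α) (pow-positive log₂ 0<log₂ α) <ʳ fromℚ (D witness {{witness≢0}})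
    D-witness = conclude-pow {D witness {{witness≢0}}} {K} log₂ 0<log₂ α (≤ʳ-trans
      (deficit≤ index 32≤μ
        (subst (E log₁ ≈_) (fromℕ≡ witness) (E-log (fromℕ witness) (fromℕ-positive witness {{witness≢0}})))
        (E-log log₁ 0<log₁) (E-log log₂ 0<log₂))
      (proj₂ (≤⟨ℕ⟩ (⟨ ℤ.+ 2 / 1 ⟩ ⊗ E ⟨ ℤ.+ 12 / 1 ⟩))))

open import Data.Nat using (_<_)
open import Data.Product using (∃-syntax; Σ-syntax; _×_; _,_)
open Assembly

theorem2p1 : ∃[ C ] 0ʳ <ʳ C ×
    ((N : ℕ) → ∃[ n ] N < n ×
    (Σ[ n≢0 ∈ NonZero n ]
    let logn = log (fromℕ n) (fromℕ-positive n {{n≢0}}) in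
    Σ[ logn>0 ∈ 0ʳ <ʳ logn ]
    let loglogn = log logn logn>0 in
    Σ[ loglogn>0 ∈ 0ʳ <ʳ loglogn ]
    1ʳ -ʳ quotient C (pow loglogn loglogn>0 α) (pow-positive loglogn loglogn>0 α)
    <ʳ fromℚ (D n {{n≢0}})))
theorem2p1 = C , 0<C , λ N → witness N , N<witness N , witness≢0 N , 0<log₁ N , 0<log₂ N , D-witness N
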